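{- Every quasidense circulant S-ring with trivial radical is cyclotomic, and hence dense.
   Context: An S-ring over a finite group $G$ is a subring $\mathcal A$ of $\mathbb Z G$ spanned by the sums $\underline X=\sum_{x\in X}x$ over the blocks $X$ of a partition $\mathcal S(\mathcal A)$ of $G$ (basic sets) containing $\{e\}$ and closed under $X\mapsto X^{ -1}$; it is circulant if $G$ is cyclic. An $\mathcal A$-group is a subgroup of $G$ that is a union of basic sets; an $\mathcal A$-section is $U/L$ with $L\le U$ $\mathcal A$-groups, and $\mathcal A_{U/L}$ is the S-ring over $U/L$ whose basic sets are the images of basic sets contained in $U$. An $\mathcal A$-section $S$ is primitive if the only $\mathcal A_S$-groups are trivial and $S$. A circulant S-ring is quasidense if every primitive $\mathcal A$-section has prime order. The radical of a subset $X$ is $\mathrm{rad}(X)=\{g\in G: gX=X\}$; for a circulant S-ring $\mathcal A$, $\mathrm{rad}(\mathcal A)$ is the radical of any basic set containing a generator of $G$ (all such basic sets have the same radical). $\mathcal A$ is cyclotomic if there is $K\le\mathrm{Aut}(G)$ whose orbits on $G$ are exactly the basic sets, and dense if every subgroup of $G$ is an $\mathcal A$-group. -}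

module Defs where

open import Level using (Level)
open import Data.Nat using (ℕ; zero; suc; _+_; _*_; _∸_; _≡ᵇ_)
open import Data.Nat.DivMod using (_mod_)
open import Data.Nat.Primality using (Prime)
open import Data.Bool using (Bool; _∧_)
open import Data.Fin using (Fin; toℕ)
open import Data.Fin.Subset using (Subset; _∈_; _⊆_; ∣_∣)
open import Data.Vec using (tabulate)
open import Data.Product using (Σ; ∃; ∃-syntax; _×_)
open import Data.Sum using (_⊎_)
open import Relation.Binary.PropositionalEquality using (_≡_; _≢_)
open import Relation.Nullary using (¬_)
open import Function.Definitions using (Injective; Surjective)

module _ {m : ℕ} where

  private
    n : ℕ
    n = suc m

  _⊕_ : Fin n → Fin n → Fin n
  x ⊕ y = (toℕ x + toℕ y) mod n

  e : Fin n
  e = 0 mod n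

  ⊖_ : Fin n → Fin n
  ⊖ x = (n ∸ toℕ x) mod n

  gen : Fin n
  gen = 1 mod n

  record IsSubgroup (H : Subset n) : Set where
    field
      has-e   : e ∈ H
      closed⊕ : ∀ x y → x ∈ H → y ∈ H → (x ⊕ y) ∈ H
      closed⊖ : ∀ x → x ∈ H → (⊖ x) ∈ H

-- A partition of G is encoded by a labelling lab : G → ℕ; the blocks
-- (basic sets) are the non-empty fibres of lab.

module _ {m : ℕ} (lab : Fin (suc m) → ℕ) where

  private
    n : ℕ
    n = suc m

  blk : Fin n → Subset n
  blk x = tabulate (λ y → lab y ≡ᵇ lab x)

  -- coefficient of z in the product  X̲ · Y̲  where X = blk x, Y = blk y:
  -- number of u ∈ X with z ⊖ u ∈ Y, i.e. pairs (u,v) ∈ X×Y with u⊕v = z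
  coeff : Fin n → Fin n → Fin n → ℕ
  coeff x y z = ∣ tabulate (λ u → (lab u ≡ᵇ lab x) ∧ (lab (z ⊕ (⊖ u)) ≡ᵇ lab y)) ∣

record SRing (m : ℕ) : Set where
  field
    lab : Fin (suc m) → ℕ
    e-block   : ∀ x → lab x ≡ lab e → x ≡ e
    inv-block : ∀ x y → lab x ≡ lab y → lab (⊖ x) ≡ lab (⊖ y)
    -- the ℤ-span of the basic sums is closed under multiplication:
    -- each product X̲·Y̲ is constant on every basic set
    mult      : ∀ x y z z' → lab z ≡ lab z' → coeff lab x y z ≡ coeff lab x y z'

module _ {m : ℕ} (A : SRing m) where
  open SRing A

  private
    n : ℕ
    n = suc m

  record IsAGroup (H : Subset n) : Set where
    field
      subgroup : IsSubgroup H
      union    : ∀ x y → lab x ≡ lab y → x ∈ H → y ∈ H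

  -- For an 𝒜-section U/L, subgroups of U/L correspond to subgroups H of G
  -- with L ⊆ H ⊆ U (H = preimage).  H corresponds to an 𝒜_{U/L}-group iff its
  -- image is a union of images of basic sets X ⊆ U, i.e. H is a union of
  -- sets X·L with X basic, X ⊆ U.
  -- y ∈ blk x · L
  InBlkL : Subset n → Fin n → Fin n → Set
  InBlkL L x y = ∃[ u ] ∃[ l ] (lab u ≡ lab x × l ∈ L × y ≡ u ⊕ l)

  IsQuotAGroup : (U L H : Subset n) → Set
  IsQuotAGroup U L H =
    IsSubgroup H × L ⊆ H × H ⊆ U ×
    (∀ h → h ∈ H →
       ∃[ x ] ((∀ u → lab u ≡ lab x → u ∈ U)
              × InBlkL L x h
              × (∀ y → InBlkL L x y → y ∈ H)))

  IsPrimitiveSection : (U L : Subset n) → Set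
  IsPrimitiveSection U L =
    IsAGroup U × IsAGroup L × L ⊆ U × L ≢ U ×
    (∀ H → IsQuotAGroup U L H → H ≡ L ⊎ H ≡ U)

  Quasidense : Set
  Quasidense = ∀ U L → IsPrimitiveSection U L →
    ∃[ p ] (Prime p × ∣ U ∣ ≡ p * ∣ L ∣)

  Stabilises : Fin n → Fin n → Set
  Stabilises g x =
    (∀ y → lab y ≡ lab x → lab (g ⊕ y) ≡ lab x) ×
    (∀ y → lab y ≡ lab x → ∃[ z ] (lab z ≡ lab x × g ⊕ z ≡ y))

  TrivialRadical : Set
  TrivialRadical = ∀ g → Stabilises g gen → g ≡ e

  IsAut : (Fin n → Fin n) → Set
  IsAut σ = (∀ x y → σ (x ⊕ y) ≡ σ x ⊕ σ y) × Injective _≡_ _≡_ σ × Surjective _≡_ _≡_ σ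

  IsAutSubgroup : ((Fin n → Fin n) → Set) → Set
  IsAutSubgroup K =
    (∀ σ → K σ → IsAut σ) ×
    K (λ x → x) ×
    (∀ σ τ → K σ → K τ → K (λ x → σ (τ x))) ×
    (∀ σ → K σ → ∃[ τ ] (K τ × (∀ x → τ (σ x) ≡ x)))

  Cyclotomic : Set₁
  Cyclotomic = Σ ((Fin n → Fin n) → Set) λ K →
    IsAutSubgroup K ×
    (∀ x y → (lab x ≡ lab y → ∃[ σ ] (K σ × σ x ≡ y))
           × (∃[ σ ] (K σ × σ x ≡ y) → lab x ≡ lab y))

  Dense : Set
  Dense = ∀ H → IsSubgroup H → IsAGroup H

module Submission where

-- Write G additively as the ring ℤ/n and let K be the basic set of the generator 1. Taking p-th
-- powers in the group ring modulo a prime p shows that multiplication by a unit permutes the basic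
-- sets, and that for a prime q dividing n the basic set of q x is contained in q [x] as soon as
-- [x] does not contain the whole coset of x modulo the subgroup of order q. With quasidensity and
-- the trivial radical this makes q G an 𝒜-group for every prime q dividing n, so K is a group of
-- units. By a descent, κ ∈ K is 1 when κ ≡ 1 modulo every prime divisor of n (and modulo 4 when 4
-- divides n). Following the basic sets of 1, q, q², … then yields that every subgroup is an 𝒜-group.
--
-- To compare basic sets with K-orbits, consider a family of functions on G that is closed under
-- restriction to subgroups and averaging over them, and whose members satisfy
-- Σ_{κ ∈ K} f(z + κ x) = 0 for all x and z generating the same ideals as idempotents. All its
-- members vanish: the sum can be cut down to those κ that are ≡ 1 modulo one odd prime divisor
-- of n after another, and at most two elements of K are left. For the family of the φ - φ ∘ κ,
-- with φ in the S-ring, this says that K permutes each basic set; for the family of K-invariant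
-- functions orthogonal to the S-ring, it says that K is transitive on each basic set.

open import Defs
open import Algebra.Bundles using (CommutativeRing; CommutativeSemiring)
import Algebra.Properties.CommutativeMonoid.Mult as CMult
import Algebra.Properties.CommutativeSemiring.Binomial as Binomial
import Algebra.Properties.Semiring.Exp as Exp
import Algebra.Properties.Semiring.Mult as Mult
import Algebra.Properties.Semiring.Sum as SemiringSum
import Algebra.Solver.Ring as RingSolver
open import Algebra.Solver.Ring.AlmostCommutativeRing using (fromCommutativeRing; _-Raw-AlmostCommutative⟶_)
open import Algebra.Structures using (IsCommutativeRing; IsCommutativeSemiring)
open import Algebra.Structures.Biased using (IsCommutativeSemiringˡ)
open import Data.Bool using (Bool; true; false; if_then_else_)
open import Data.Empty using (⊥; ⊥-elim)
open import Data.Fin using (Fin; toℕ; zero; suc; fromℕ; inject₁)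
open import Data.Fin.Permutation using (permutation)
open import Data.Fin.Properties using (toℕ-fromℕ<; toℕ<n; toℕ-injective; toℕ-inject₁; toℕ-fromℕ; any?; all?; ¬∀⟶∃¬) renaming (_≟_ to _≟F_)
open import Data.Fin.Subset using (Subset; ∣_∣; _∈_)
open import Data.Fin.Subset.Properties using (_∈?_; ⊆-antisym)
open import Data.Integer as ℤ using (ℤ; 0ℤ; 1ℤ)
open import Data.Integer.Properties as ℤₚ using ()
open import Data.List using ([]; _∷_)
open import Data.List.Relation.Unary.All using ([]; _∷_)
open import Data.Maybe using (Maybe; just; nothing)
open import Data.Nat as ℕ using (ℕ; zero; suc; _≤_; _<_; z≤n; s≤s; NonZero; _!)
open import Data.Nat.Combinatorics using (_C_; nCn≡1; k![n∸k]!∣n!)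
open import Data.Nat.Combinatorics.Specification using (nCk≡n!/k![n-k]!)
open import Data.Nat.Coprimality using (coprime-divisor; gcd≡1⇒coprime)
open import Data.Nat.Divisibility
open import Data.Nat.DivMod
open import Data.Nat.GCD
open import Data.Nat.Induction using (<-rec)
open import Data.Nat.Primality
open import Data.Nat.Primality.Factorisation using (factorise)
open import Data.Nat.Properties as ℕₚ using ()
open import Data.Product using (∃-syntax; _×_; _,_; proj₁; proj₂)
open import Data.Sum using (_⊎_; inj₁; inj₂)
open import Data.Vec using (tabulate)
open import Data.Vec.Properties using (lookup∘tabulate; []=⇒lookup; lookup⇒[]=)
open import Function using (_∘_; id; case_of_)
open import Relation.Binary.PropositionalEquality
import Relation.Binary.Reasoning.Setoid as SetoidReasoning
open import Relation.Binary.Structures using (IsEquivalence)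
open import Relation.Nullary

-- Two obstacles shape the argument. The first is that a `K`-orbit is not known in advance to be a
-- union of basic sets. The orbit of a unit is a basic set, and if x generates the ideal of an
-- idempotent, its orbit is the projection of the orbit of a unit, obtained by averaging over one
-- subgroup and restricting to another; density is what makes both operations preserve the S-ring.
-- No such projection is at hand for other residues, so only the sums Σ f(z + κ x) with x and z of
-- this kind are accessible, and closure of the family under the two operations is what carries the
-- information further. The second obstacle is the prime 2. Squaring 1 + r gains exactly one factor
-- 2, up to a unit, only when 4 divides r, so `K` may contain an element that is 1 modulo the odd
-- part and 3 modulo 4; and for even n an odd residue is never a sum of two odd ones. For density
-- this leaves one configuration, settled by counting representations as sums of two elements of `K`
-- modulo 4; for the vanishing of families it requires an induction of its own on the powers of 2.

-- The ring ℤ/n.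

module Residues (m : ℕ) where

  n : ℕ
  n = suc m

  R : Set
  R = Fin n

  infixl 6 _∔_ _⊟_
  infixl 7 _·_
  infix  8 ⊝_

  abstract
    π : ℕ → R
    π a = a mod n

    _∔_ _·_ : R → R → R
    x ∔ y = x ⊕ y
    x · y = π (toℕ x ℕ.* toℕ y)

    ⊝_ : R → R
    ⊝ x = Defs.⊖ x

    ∔-def : ∀ x y → x ⊕ y ≡ x ∔ y
    ∔-def x y = refl

    ⊝-def : ∀ x → Defs.⊖ x ≡ ⊝ x
    ⊝-def x = refl

    e-def : Defs.e ≡ π 0
    e-def = refl

    gen-def : gen ≡ π 1
    gen-def = refl

    toℕ-π : ∀ a → toℕ (π a) ≡ a % n
    toℕ-π a = toℕ-fromℕ< _

    π-toℕ : ∀ x → π (toℕ x) ≡ x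
    π-toℕ x = toℕ-injective (trans (toℕ-π (toℕ x)) (m<n⇒m%n≡m (toℕ<n x)))

    π-cong : ∀ {a b} → a % n ≡ b % n → π a ≡ π b
    π-cong {a} {b} h = toℕ-injective (trans (toℕ-π a) (trans h (sym (toℕ-π b))))

    π-+ : ∀ a b → π (a ℕ.+ b) ≡ π a ∔ π b
    π-+ a b = π-cong {a ℕ.+ b} {toℕ (π a) ℕ.+ toℕ (π b)} (trans (%-distribˡ-+ a b n)
      (cong (_% n) (cong₂ ℕ._+_ (sym (toℕ-π a)) (sym (toℕ-π b)))))

    π-* : ∀ a b → π (a ℕ.* b) ≡ π a · π b
    π-* a b = π-cong {a ℕ.* b} {toℕ (π a) ℕ.* toℕ (π b)} (trans (%-distribˡ-* a b n)
      (cong (_% n) (cong₂ ℕ._*_ (sym (toℕ-π a)) (sym (toℕ-π b)))))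

    ∔-inverse : ∀ x → x ∔ ⊝ x ≡ π 0
    ∔-inverse x = trans (cong (_∔ ⊝ x) (sym (π-toℕ x))) (trans (sym (π-+ (toℕ x) (n ℕ.∸ toℕ x)))
      (trans (cong π (ℕₚ.m+[n∸m]≡n (ℕₚ.<⇒≤ (toℕ<n x)))) (π-cong {n} {0} (n%n≡0 n))))

  π-n : π n ≡ π 0
  π-n = π-cong (trans (n%n≡0 n) refl)

  _⊟_ : R → R → R
  x ⊟ y = x ∔ ⊝ y

  private
    ∔-assoc : ∀ x y z → (x ∔ y) ∔ z ≡ x ∔ (y ∔ z)
    ∔-assoc x y z rewrite sym (π-toℕ x) | sym (π-toℕ y) | sym (π-toℕ z)
      | sym (π-+ (toℕ x) (toℕ y)) | sym (π-+ (toℕ y) (toℕ z))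
      | sym (π-+ (toℕ x ℕ.+ toℕ y) (toℕ z)) | sym (π-+ (toℕ x) (toℕ y ℕ.+ toℕ z))
      = cong π (ℕₚ.+-assoc (toℕ x) (toℕ y) (toℕ z))

    ∔-comm : ∀ x y → x ∔ y ≡ y ∔ x
    ∔-comm x y = trans (cong₂ _∔_ (sym (π-toℕ x)) (sym (π-toℕ y))) (trans (sym (π-+ _ _))
      (trans (cong π (ℕₚ.+-comm (toℕ x) (toℕ y))) (trans (π-+ _ _) (cong₂ _∔_ (π-toℕ y) (π-toℕ x)))))

    ∔-identityˡ : ∀ x → π 0 ∔ x ≡ x
    ∔-identityˡ x = trans (cong (π 0 ∔_) (sym (π-toℕ x))) (trans (sym (π-+ 0 (toℕ x))) (π-toℕ x))

    ·-assoc : ∀ x y z → (x · y) · z ≡ x · (y · z)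
    ·-assoc x y z rewrite sym (π-toℕ x) | sym (π-toℕ y) | sym (π-toℕ z)
      | sym (π-* (toℕ x) (toℕ y)) | sym (π-* (toℕ y) (toℕ z))
      | sym (π-* (toℕ x ℕ.* toℕ y) (toℕ z)) | sym (π-* (toℕ x) (toℕ y ℕ.* toℕ z))
      = cong π (ℕₚ.*-assoc (toℕ x) (toℕ y) (toℕ z))

    ·-comm : ∀ x y → x · y ≡ y · x
    ·-comm x y = trans (cong₂ _·_ (sym (π-toℕ x)) (sym (π-toℕ y))) (trans (sym (π-* _ _))
      (trans (cong π (ℕₚ.*-comm (toℕ x) (toℕ y))) (trans (π-* _ _) (cong₂ _·_ (π-toℕ y) (π-toℕ x)))))

    ·-identityˡ : ∀ x → π 1 · x ≡ x
    ·-identityˡ x = trans (cong (π 1 ·_) (sym (π-toℕ x))) (trans (sym (π-* 1 (toℕ x)))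
      (trans (cong π (ℕₚ.*-identityˡ (toℕ x))) (π-toℕ x)))

    ·-distribˡ : ∀ x y z → x · (y ∔ z) ≡ x · y ∔ x · z
    ·-distribˡ x y z rewrite sym (π-toℕ x) | sym (π-toℕ y) | sym (π-toℕ z)
      | sym (π-+ (toℕ y) (toℕ z)) | sym (π-* (toℕ x) (toℕ y)) | sym (π-* (toℕ x) (toℕ z))
      | sym (π-* (toℕ x) (toℕ y ℕ.+ toℕ z)) | sym (π-+ (toℕ x ℕ.* toℕ y) (toℕ x ℕ.* toℕ z))
      = cong π (ℕₚ.*-distribˡ-+ (toℕ x) (toℕ y) (toℕ z))

  ring : CommutativeRing _ _
  ring = record
    { Carrier = R ; _≈_ = _≡_ ; _+_ = _∔_ ; _*_ = _·_ ; -_ = ⊝_ ; 0# = π 0 ; 1# = π 1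
    ; isCommutativeRing = record
      { isRing = record
        { +-isAbelianGroup = record
          { isGroup = record
            { isMonoid = record
              { isSemigroup = record
                { isMagma = record { isEquivalence = isEquivalence ; ∙-cong = cong₂ _∔_ }
                ; assoc = ∔-assoc }
              ; identity = ∔-identityˡ , λ x → trans (∔-comm x _) (∔-identityˡ x) }
            ; inverse = (λ x → trans (∔-comm _ x) (∔-inverse x)) , ∔-inverse
            ; ⁻¹-cong = cong ⊝_ }
          ; comm = ∔-comm }
        ; *-cong = cong₂ _·_
        ; *-assoc = ·-assoc
        ; *-identity = ·-identityˡ , λ x → trans (·-comm x _) (·-identityˡ x)
        ; distrib = ·-distribˡ , λ x y z → trans (·-comm (y ∔ z) x)
            (trans (·-distribˡ x y z) (cong₂ _∔_ (·-comm x y) (·-comm x z))) }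
      ; *-comm = ·-comm } }

  module CR = CommutativeRing ring
  open import Algebra.Properties.Ring CR.ring public
    using (-‿distribˡ-*; -‿distribʳ-*; -‿involutive; -‿+-comm; -0#≈0#)

  private
    -- The canonical homomorphism, which lets the ring solver work in ℤ/n with integer coefficients.
    ι : ℤ → R
    ι (ℤ.+ a)    = π a
    ι ℤ.-[1+ a ] = ⊝ π (suc a)

    cancel : ∀ x y c → (c ∔ x) ∔ ⊝ (c ∔ y) ≡ x ∔ ⊝ y
    cancel x y c = begin
      (c ∔ x) ∔ ⊝ (c ∔ y)      ≡⟨ cong₂ _∔_ (∔-comm c x) (sym (-‿+-comm c y)) ⟩
      (x ∔ c) ∔ (⊝ c ∔ ⊝ y)    ≡⟨ ∔-assoc x c _ ⟩
      x ∔ (c ∔ (⊝ c ∔ ⊝ y))    ≡⟨ cong (x ∔_) (sym (∔-assoc c (⊝ c) (⊝ y))) ⟩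
      x ∔ ((c ∔ ⊝ c) ∔ ⊝ y)    ≡⟨ cong (λ v → x ∔ (v ∔ ⊝ y)) (∔-inverse c) ⟩
      x ∔ (π 0 ∔ ⊝ y)          ≡⟨ cong (x ∔_) (∔-identityˡ _) ⟩
      x ∔ ⊝ y                  ∎
      where open ≡-Reasoning

    ι-⊖ : ∀ a b → ι (a ℤ.⊖ b) ≡ π a ∔ ⊝ π b
    ι-⊖ a zero = sym (trans (cong (π a ∔_) -0#≈0#) (trans (∔-comm _ _) (∔-identityˡ _)))
    ι-⊖ zero (suc b) = sym (∔-identityˡ _)
    ι-⊖ (suc a) (suc b) = trans (cong ι (ℤₚ.[1+m]⊖[1+n]≡m⊖n a b)) (trans (ι-⊖ a b)
      (sym (trans (cong₂ (λ u v → u ∔ ⊝ v) (π-+ 1 a) (π-+ 1 b)) (cancel (π a) (π b) (π 1)))))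

    ι-neg : ∀ a → ι (ℤ.- a) ≡ ⊝ ι a
    ι-neg (ℤ.+ zero) = sym -0#≈0#
    ι-neg (ℤ.+ suc a) = refl
    ι-neg ℤ.-[1+ a ] = sym (-‿involutive _)

    ι-+ : ∀ a b → ι (a ℤ.+ b) ≡ ι a ∔ ι b
    ι-+ (ℤ.+ a) (ℤ.+ b) = π-+ a b
    ι-+ (ℤ.+ a) ℤ.-[1+ b ] = ι-⊖ a (suc b)
    ι-+ ℤ.-[1+ a ] (ℤ.+ b) = trans (ι-⊖ b (suc a)) (∔-comm _ _)
    ι-+ ℤ.-[1+ a ] ℤ.-[1+ b ] = trans (cong ⊝_ (trans (cong π (cong suc (sym (ℕₚ.+-suc a b)))) (π-+ (suc a) (suc b))))
      (sym (-‿+-comm _ _))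

    ι-pos* : ∀ a b → ι (ℤ.+ a ℤ.* ℤ.+ b) ≡ π a · π b
    ι-pos* a b = trans (cong ι (sym (ℤₚ.pos-* a b))) (π-* a b)

    ι-* : ∀ a b → ι (a ℤ.* b) ≡ ι a · ι b
    ι-* (ℤ.+ a) (ℤ.+ b) = ι-pos* a b
    ι-* (ℤ.+ a) ℤ.-[1+ b ] = trans (cong ι (sym (ℤₚ.neg-distribʳ-* (ℤ.+ a) (ℤ.+ suc b))))
      (trans (ι-neg (ℤ.+ a ℤ.* ℤ.+ suc b)) (trans (cong ⊝_ (ι-pos* a (suc b))) (-‿distribʳ-* _ _)))
    ι-* ℤ.-[1+ a ] (ℤ.+ b) = trans (cong ι (sym (ℤₚ.neg-distribˡ-* (ℤ.+ suc a) (ℤ.+ b))))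
      (trans (ι-neg (ℤ.+ suc a ℤ.* ℤ.+ b)) (trans (cong ⊝_ (ι-pos* (suc a) b)) (-‿distribˡ-* _ _)))
    ι-* ℤ.-[1+ a ] ℤ.-[1+ b ] = trans (π-* (suc a) (suc b))
      (trans (sym (-‿involutive _)) (trans (cong ⊝_ (-‿distribˡ-* _ _)) (-‿distribʳ-* _ _)))

    morphism : CommutativeRing.rawRing ℤₚ.+-*-commutativeRing -Raw-AlmostCommutative⟶ fromCommutativeRing ring
    morphism = record { ⟦_⟧ = ι ; +-homo = ι-+ ; *-homo = ι-* ; -‿homo = ι-neg ; 0-homo = refl ; 1-homo = refl }

    coeff≟ : ∀ a b → Maybe (ι a ≡ ι b)
    coeff≟ a b with a ℤ.≟ b
    ... | yes h = just (cong ι h)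
    ... | no _  = nothing

  open RingSolver (CommutativeRing.rawRing ℤₚ.+-*-commutativeRing) (fromCommutativeRing ring) morphism coeff≟
    public using (Polynomial; solve; _:+_; _:*_; _:-_; :-_; con; _:=_)

  :1 :2 :4 : ∀ {k} → Polynomial k
  :1 = con 1ℤ
  :2 = con (ℤ.+ 2)
  :4 = con (ℤ.+ 4)

-- Prime divisors and coprimality of natural numbers.

abstract
  prime-divisor : ∀ k → k ≢ 0 → k ≢ 1 → ∃[ q ] (Prime q × q ∣ k)
  prime-divisor k k≢0 k≢1 with factorise k {{ℕ.≢-nonZero k≢0}}
  ... | record { factors = [] ; isFactorisation = eq } = ⊥-elim (k≢1 eq)
  ... | record { factors = q ∷ qs ; isFactorisation = eq ; factorsPrime = pq ∷ _ } =
    q , pq , subst (q ∣_) (sym eq) (m∣m*n _)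

prime≢0 : ∀ {q} → Prime q → q ≢ 0
prime≢0 pq refl = ¬prime[0] pq

prime≢1 : ∀ {q} → Prime q → q ≢ 1
prime≢1 pq refl = ¬prime[1] pq

prime>1 : ∀ {q} → Prime q → 1 < q
prime>1 {q} pq = ℕ.nonTrivial⇒n>1 q {{prime⇒nonTrivial pq}}

prime∤1 : ∀ {q} → Prime q → ¬ q ∣ 1
prime∤1 pq h = prime≢1 pq (∣1⇒≡1 h)

prime∣prime : ∀ {p q} → Prime p → Prime q → p ∣ q → p ≡ q
prime∣prime {p} {q} pp pq h with prime⇒irreducible pq h
... | inj₁ p≡1 = ⊥-elim (prime≢1 pp p≡1)
... | inj₂ p≡q = p≡q

prime∣^ : ∀ {p q} → Prime p → ∀ a → p ∣ q ℕ.^ a → p ∣ q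
prime∣^ pp zero h = ⊥-elim (prime∤1 pp h)
prime∣^ {p} {q} pp (suc a) h with euclidsLemma q (q ℕ.^ a) pp h
... | inj₁ h₁ = h₁
... | inj₂ h₂ = prime∣^ pp a h₂

abstract
  split-prime : ∀ q → Prime q → ∀ k → k ≢ 0 → ∃[ a ] ∃[ b ] (k ≡ q ℕ.^ a ℕ.* b × ¬ q ∣ b)
  split-prime q pq = <-rec _ go
    where
    go : ∀ k → (∀ {j} → j < k → j ≢ 0 → ∃[ a ] ∃[ b ] (j ≡ q ℕ.^ a ℕ.* b × ¬ q ∣ b)) →
         k ≢ 0 → ∃[ a ] ∃[ b ] (k ≡ q ℕ.^ a ℕ.* b × ¬ q ∣ b)
    go k rec k≢0 with q ∣? k
    ... | no q∤k = 0 , k , sym (ℕₚ.*-identityˡ k) , q∤k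
    ... | yes (divides j k≡jq) with rec j<k j≢0
      where
      j≢0 : j ≢ 0
      j≢0 refl = k≢0 k≡jq
      j<k : j < k
      j<k = subst (j <_) (sym k≡jq) (ℕₚ.m<m*n j q {{ℕ.≢-nonZero j≢0}} (prime>1 pq))
    ... | a , b , j≡ , q∤b = suc a , b , trans k≡jq (trans (cong (ℕ._* q) j≡)
            (trans (ℕₚ.*-comm _ q) (sym (ℕₚ.*-assoc q (q ℕ.^ a) b)))) , q∤b

gcd≡1 : ∀ b c → b ≢ 0 → (∀ q → Prime q → q ∣ b → q ∣ c → ⊥) → gcd b c ≡ 1
gcd≡1 b c b≢0 h with gcd b c ℕ.≟ 1
... | yes g≡1 = g≡1
... | no g≢1 with prime-divisor (gcd b c) (b≢0 ∘ gcd[m,n]≡0⇒m≡0) g≢1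
... | q , pq , q∣g = ⊥-elim (h q pq (∣-trans q∣g (gcd[m,n]∣m b c)) (∣-trans q∣g (gcd[m,n]∣n b c)))

gcd-prime-power : ∀ {q b} → Prime q → ¬ q ∣ b → ∀ a → gcd (q ℕ.^ a) b ≡ 1
gcd-prime-power {q} {b} pq q∤b a = gcd≡1 (q ℕ.^ a) b
  (λ h → prime≢0 pq (ℕₚ.m^n≡0⇒m≡0 q a h))
  λ p pp p∣qa p∣b → q∤b (subst (_∣ b) (prime∣prime pp pq (prime∣^ pp a p∣qa)) p∣b)

*≡⇒∣ʳ : ∀ {k} a b → k ≡ a ℕ.* b → b ∣ k
*≡⇒∣ʳ a b eq = divides a eq

*≡⇒∣ˡ : ∀ {k} a b → k ≡ a ℕ.* b → a ∣ k
*≡⇒∣ˡ a b eq = divides b (trans eq (ℕₚ.*-comm a b))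

-- Ideals, units and the Chinese remainder theorem in ℤ/n.

module Divides (m : ℕ) where
  open Residues m public

  -- Membership in the ideal `d` ℤ/n. It implies divisibility of representatives only when `d ∣ n`,
  -- whence this hypothesis in `D-π` and `D-toℕ`.
  D : ℕ → R → Set
  D d x = ∃[ y ] x ≡ π d · y

  abstract
    D? : ∀ d x → Dec (D d x)
    D? d x = any? (λ y → x ≟F (π d · y))

  n≢0 : n ≢ 0
  n≢0 ()

  ∣n⇒≢0 : ∀ {d} → d ∣ n → d ≢ 0
  ∣n⇒≢0 h refl = n≢0 (0∣⇒≡0 h)

  π-% : ∀ {d a b} → d ∣ n → π a ≡ π b → d ∣ b → d ∣ a
  π-% {d} {a} {b} d∣n eq d∣b = ∣n∣m%n⇒∣m d∣n
    (subst (d ∣_) (trans (sym (toℕ-π b)) (trans (cong toℕ (sym eq)) (toℕ-π a))) (%-presˡ-∣ d∣b d∣n))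

  D-π : ∀ {d a} → d ∣ n → D d (π a) → d ∣ a
  D-π {d} {a} d∣n (y , eq) = π-% d∣n
    (trans eq (trans (cong (π d ·_) (sym (π-toℕ y))) (sym (π-* d (toℕ y))))) (m∣m*n (toℕ y))

  D-toℕ : ∀ {d x} → d ∣ n → D d x → d ∣ toℕ x
  D-toℕ {d} {x} d∣n h = D-π d∣n (subst (D d) (sym (π-toℕ x)) h)

  π-D : ∀ {d a} → d ∣ a → D d (π a)
  π-D {d} (divides c eq) = π c , trans (cong π eq) (trans (π-* c d) (CR.*-comm _ _))

  toℕ-D : ∀ {d x} → d ∣ toℕ x → D d x
  toℕ-D {d} {x} h = subst (D d) (π-toℕ x) (π-D h)

  D-self : ∀ d → D d (π d)
  D-self d = π-D ∣-refl

  D-0 : ∀ {d} → D d (π 0)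
  D-0 {d} = π-D (d ∣0)

  D-1 : ∀ x → D 1 x
  D-1 x = x , sym (CR.*-identityˡ x)

  D-∔ : ∀ {d x y} → D d x → D d y → D d (x ∔ y)
  D-∔ {d} (a , p) (b , q) = a ∔ b , trans (cong₂ _∔_ p q) (sym (CR.distribˡ (π d) a b))

  D-⊝ : ∀ {d x} → D d x → D d (⊝ x)
  D-⊝ {d} (a , p) = ⊝ a , trans (cong ⊝_ p) (-‿distribʳ-* (π d) a)

  D-⊟ : ∀ {d x y} → D d x → D d y → D d (x ⊟ y)
  D-⊟ h k = D-∔ h (D-⊝ k)

  D-·ʳ : ∀ {d x} y → D d x → D d (x · y)
  D-·ʳ {d} y (a , p) = a · y , trans (cong (_· y) p) (CR.*-assoc (π d) a y)

  D-·ˡ : ∀ {d x} y → D d x → D d (y · x)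
  D-·ˡ {d} y h = subst (D d) (CR.*-comm _ _) (D-·ʳ y h)

  D-∣ : ∀ {c d x} → c ∣ d → D d x → D c x
  D-∣ {c} {d} {x} h (a , p) = subst (D c) (sym p) (D-·ʳ a (π-D h))

  D-n : ∀ {x} → D n x → x ≡ π 0
  D-n (a , p) = trans p (trans (cong (_· a) π-n) (CR.zeroˡ a))

  D-mul : ∀ {c d x} → D d x → D (c ℕ.* d) (π c · x)
  D-mul {c} {d} (a , p) = a , trans (cong (π c ·_) p) (trans (sym (CR.*-assoc _ _ _)) (cong (_· a) (sym (π-* c d))))

  D-·· : ∀ {c d x y} → D c x → D d y → D (c ℕ.* d) (x · y)
  D-·· {c} {d} {x} {y} (a , p) h =
    subst (D (c ℕ.* d)) (trans (solve 3 (λ c y a → c :* y :* a := c :* a :* y) refl (π c) y a) (cong (_· y) (sym p)))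
      (D-·ʳ a (D-mul h))

  D-cancel : ∀ {c d x} → c ℕ.* d ∣ n → D (c ℕ.* d) (π c · x) → D d x
  D-cancel {c} {d} {x} h k = toℕ-D (*-cancelˡ-∣ c {{ℕ.≢-nonZero c≢0}}
    (D-π h (subst (D (c ℕ.* d)) (trans (cong (π c ·_) (sym (π-toℕ x))) (sym (π-* c (toℕ x)))) k)))
    where
    c≢0 : c ≢ 0
    c≢0 refl = ∣n⇒≢0 h refl

  D-annihilator : ∀ {c d x} → n ≡ c ℕ.* d → π c · x ≡ π 0 → D d x
  D-annihilator {c} {d} {x} eq h = D-cancel {c} {d} (subst (_∣ n) eq ∣-refl) (subst (D (c ℕ.* d)) (sym h) D-0)

  abstract
    D-prime : ∀ {q x y} → Prime q → q ∣ n → D q (x · y) → D q x ⊎ D q y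
    D-prime {q} {x} {y} pq q∣n h with euclidsLemma (toℕ x) (toℕ y) pq
      (D-π q∣n (subst (D q) (trans (cong₂ _·_ (sym (π-toℕ x)) (sym (π-toℕ y))) (sym (π-* (toℕ x) (toℕ y)))) h))
    ... | inj₁ k = inj₁ (toℕ-D k)
    ... | inj₂ k = inj₂ (toℕ-D k)

  ¬D-1 : ∀ {q} → Prime q → q ∣ n → ¬ D q (π 1)
  ¬D-1 pq q∣n h = prime∤1 pq (D-π q∣n h)

  bezout : ∀ a b → ∃[ s ] ∃[ t ] π (gcd a b) ≡ s · π a ∔ t · π b
  bezout a b with Bézout.identity (gcd-GCD a b)
  ... | Bézout.+- x y eq = π x , ⊝ π y , (begin
          π g                                   ≡⟨ solve 2 (λ g v → g := g :+ v :- v) refl (π g) (π y · π b) ⟩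
          π g ∔ π y · π b ⊟ π y · π b           ≡⟨ cong (λ v → π g ∔ v ⊟ π y · π b) (sym (π-* y b)) ⟩
          π g ∔ π (y ℕ.* b) ⊟ π y · π b         ≡⟨ cong (_⊟ π y · π b) (trans (sym (π-+ g _)) (trans (cong π eq) (π-* x a))) ⟩
          π x · π a ⊟ π y · π b                 ≡⟨ solve 3 (λ u y b → u :- y :* b := u :+ :- y :* b) refl (π x · π a) (π y) (π b) ⟩
          π x · π a ∔ (⊝ π y) · π b             ∎)
    where
    open ≡-Reasoning
    g = gcd a b
  ... | Bézout.-+ x y eq = ⊝ π x , π y , (begin
          π g                                   ≡⟨ solve 2 (λ g v → g := g :+ v :- v) refl (π g) (π x · π a) ⟩
          π g ∔ π x · π a ⊟ π x · π a           ≡⟨ cong (λ v → π g ∔ v ⊟ π x · π a) (sym (π-* x a)) ⟩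
          π g ∔ π (x ℕ.* a) ⊟ π x · π a         ≡⟨ cong (_⊟ π x · π a) (trans (sym (π-+ g _)) (trans (cong π eq) (π-* y b))) ⟩
          π y · π b ⊟ π x · π a                 ≡⟨ solve 3 (λ u y b → u :- y :* b := :- y :* b :+ u) refl (π y · π b) (π x) (π a) ⟩
          (⊝ π x) · π a ∔ π y · π b             ∎)
    where
    open ≡-Reasoning
    g = gcd a b

  bezout₁ : ∀ {a b} → gcd a b ≡ 1 → ∃[ s ] ∃[ t ] π 1 ≡ s · π a ∔ t · π b
  bezout₁ {a} {b} g≡1 with bezout a b
  ... | s , t , eq = s , t , trans (cong π (sym g≡1)) eq

  abstract
    D-coprime : ∀ {b c x} → gcd b c ≡ 1 → D b x → D c x → D (b ℕ.* c) x
    D-coprime {b} {c} {x} g≡1 hb hc with bezout₁ g≡1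
    ... | s , t , eq = subst (D (b ℕ.* c)) (begin
            s · (π b · x) ∔ t · (x · π c)  ≡⟨ solve 5 (λ s t b c x → s :* (b :* x) :+ t :* (x :* c) := (s :* b :+ t :* c) :* x) refl s t (π b) (π c) x ⟩
            (s · π b ∔ t · π c) · x        ≡⟨ cong (_· x) (sym eq) ⟩
            π 1 · x                        ≡⟨ CR.*-identityˡ x ⟩
            x                              ∎)
          (D-∔ (D-·ˡ s (D-·· (D-self b) hc)) (D-·ˡ t (D-·· hb (D-self c))))
      where open ≡-Reasoning

  abstract
    crt : ∀ {b c} → gcd b c ≡ 1 → ∀ x y → ∃[ z ] (D b (z ⊟ x) × D c (z ⊟ y))
    crt {b} {c} g≡1 x y with bezout₁ g≡1
    ... | s , t , eq = z
        , subst (D b) (trans (solve 4 (λ σ τ x y → σ :* (y :- x) := σ :* y :+ τ :* x :- (σ :+ τ) :* x) refl σ τ x y) (one x)) (D-·ʳ _ (D-·ˡ s (D-self b)))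
        , subst (D c) (trans (solve 4 (λ σ τ x y → τ :* (x :- y) := σ :* y :+ τ :* x :- (σ :+ τ) :* y) refl σ τ x y) (one y)) (D-·ʳ _ (D-·ˡ t (D-self c)))
      where
      σ τ z : R
      σ = s · π b
      τ = t · π c
      z = σ · y ∔ τ · x
      one : ∀ v → z ⊟ (σ ∔ τ) · v ≡ z ⊟ v
      one v = cong (λ w → z ⊟ w) (trans (cong (_· v) (sym eq)) (CR.*-identityˡ v))

  Unit : R → Set
  Unit x = ∃[ y ] x · y ≡ π 1

  abstract
    unit : ∀ {x} → (∀ q → Prime q → q ∣ n → ¬ D q x) → Unit x
    unit {x} h with bezout₁ {n} {toℕ x} (gcd≡1 n (toℕ x) n≢0 (λ q pq q∣n q∣x → h q pq q∣n (toℕ-D q∣x)))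
    ... | s , t , eq = t , trans (solve 2 (λ x t → x :* t := con 0ℤ :+ t :* x) refl x t)
            (trans (cong₂ (λ u v → u ∔ t · v) (sym (trans (cong (s ·_) π-n) (CR.zeroʳ s))) (sym (π-toℕ x))) (sym eq))

  unit-¬D : ∀ {q x} → Prime q → q ∣ n → Unit x → ¬ D q x
  unit-¬D {q} pq q∣n (y , eq) h = ¬D-1 pq q∣n (subst (D q) eq (D-·ʳ y h))

  D-unit : ∀ {d u x} → Unit u → D d (u · x) → D d x
  D-unit {d} {u} {x} (v , eq) h = subst (D d)
    (trans (solve 3 (λ u v x → v :* (u :* x) := u :* v :* x) refl u v x) (trans (cong (_· x) eq) (CR.*-identityˡ x))) (D-·ˡ v h)

  unit-cancel : ∀ {u x y} → Unit u → u · x ≡ u · y → x ≡ y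
  unit-cancel {u} {x} {y} (v , eq) h = trans (sym (lem x)) (trans (cong (v ·_) h) (lem y))
    where
    lem : ∀ x → v · (u · x) ≡ x
    lem x = trans (solve 3 (λ u v x → v :* (u :* x) := u :* v :* x) refl u v x) (trans (cong (_· x) eq) (CR.*-identityˡ x))

-- Opaque copies of the integer operations: the unifier then treats sums and products of
-- integers as first-order terms.
module Integers where
  infixl 6 _+_ _-_
  infixl 7 _*_
  infix  8 -_

  opaque
    _+_ _*_ : ℤ → ℤ → ℤ
    _+_ = ℤ._+_
    _*_ = ℤ._*_

    -_ : ℤ → ℤ
    -_ = ℤ.-_

    +-def : ∀ a b → a + b ≡ a ℤ.+ b
    +-def a b = refl

    *-def : ∀ a b → a * b ≡ a ℤ.* b
    *-def a b = refl

    neg-def : ∀ a → - a ≡ ℤ.- a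
    neg-def a = refl

    isCommutativeRing : IsCommutativeRing _≡_ _+_ _*_ -_ 0ℤ 1ℤ
    isCommutativeRing = ℤₚ.+-*-isCommutativeRing

  _-_ : ℤ → ℤ → ℤ
  a - b = a + - b

  ringℤ : CommutativeRing _ _
  ringℤ = record { isCommutativeRing = isCommutativeRing }

  module ℤR = CommutativeRing ringℤ

  private
    morphism : CommutativeRing.rawRing ℤₚ.+-*-commutativeRing -Raw-AlmostCommutative⟶ fromCommutativeRing ringℤ
    morphism = record { ⟦_⟧ = λ a → a ; +-homo = λ a b → sym (+-def a b) ; *-homo = λ a b → sym (*-def a b)
                      ; -‿homo = λ a → sym (neg-def a) ; 0-homo = refl ; 1-homo = refl }

    coeff≟ : ∀ a b → Maybe (a ≡ b)
    coeff≟ a b with a ℤ.≟ b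
    ... | yes h = just h
    ... | no _  = nothing

  open RingSolver (CommutativeRing.rawRing ℤₚ.+-*-commutativeRing) (fromCommutativeRing ringℤ) morphism coeff≟
    public using () renaming
    ( solve to solveℤ ; con to conℤ ; _:+_ to infixl 6 _⟨+⟩_ ; _:*_ to infixl 7 _⟨*⟩_
    ; _:-_ to infixl 6 _⟨-⟩_ ; :-_ to infix 8 ⟨-⟩_ ; _:=_ to infix 4 _⟨=⟩_)

open Integers

-- Indicators and integer-valued sums over ℤ/n.

𝟙 : ∀ {a} {P : Set a} → Dec P → ℤ
𝟙 (yes _) = 1ℤ
𝟙 (no _)  = 0ℤ

module _ {a} {P : Set a} where

  𝟙-yes : (d : Dec P) → P → 𝟙 d ≡ 1ℤ
  𝟙-yes (yes _) _ = refl
  𝟙-yes (no ¬p) p = ⊥-elim (¬p p)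

  𝟙-no : (d : Dec P) → ¬ P → 𝟙 d ≡ 0ℤ
  𝟙-no (yes p) ¬p = ⊥-elim (¬p p)
  𝟙-no (no _) _ = refl

  𝟙-guard : (d : Dec P) → ∀ {x y} → (P → x ≡ y) → 𝟙 d * x ≡ 𝟙 d * y
  𝟙-guard (yes p) h = cong (1ℤ *_) (h p)
  𝟙-guard (no _) {x} {y} h = trans (ℤR.zeroˡ x) (sym (ℤR.zeroˡ y))

  𝟙-nonneg : (d : Dec P) → 0ℤ ℤ.≤ 𝟙 d
  𝟙-nonneg (yes _) = ℤ.+≤+ z≤n
  𝟙-nonneg (no _) = ℤ.+≤+ z≤n

  𝟙≢0 : (d : Dec P) → 𝟙 d ≢ 0ℤ → P
  𝟙≢0 (yes p) _ = p
  𝟙≢0 (no _) h = ⊥-elim (h refl)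

  𝟙*≢0 : (d : Dec P) → ∀ {x} → 𝟙 d * x ≢ 0ℤ → P × x ≢ 0ℤ
  𝟙*≢0 (yes p) {x} h = p , λ eq → h (trans (ℤR.*-identityˡ x) eq)
  𝟙*≢0 (no _) {x} h = ⊥-elim (h (ℤR.zeroˡ x))

  𝟙-idem : (d : Dec P) → 𝟙 d * 𝟙 d ≡ 𝟙 d
  𝟙-idem (yes _) = ℤR.*-identityˡ 1ℤ
  𝟙-idem (no _) = ℤR.zeroˡ 0ℤ

module _ {a b} {P : Set a} {Q : Set b} where

  𝟙-⇔ : (d : Dec P) (d′ : Dec Q) → (P → Q) → (Q → P) → 𝟙 d ≡ 𝟙 d′
  𝟙-⇔ (yes p) d′ f g = sym (𝟙-yes d′ (f p))
  𝟙-⇔ (no ¬p) d′ f g = sym (𝟙-no d′ (¬p ∘ g))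

  𝟙-× : (d : Dec P) (d′ : Dec Q) → 𝟙 d * 𝟙 d′ ≡ 𝟙 (d ×-dec d′)
  𝟙-× (yes p) (yes q) = ℤR.*-identityˡ 1ℤ
  𝟙-× (yes p) (no ¬q) = ℤR.*-identityˡ 0ℤ
  𝟙-× (no ¬p) d′ = ℤR.zeroˡ (𝟙 d′)

𝟙-does : ∀ {a} {P : Set a} (d : Dec P) → (if does d then 1ℤ else 0ℤ) ≡ 𝟙 d
𝟙-does (yes _) = refl
𝟙-does (no _)  = refl

module FiniteSums where
  open SemiringSum (CommutativeRing.semiring ringℤ) public

  sum-δ : ∀ {k} (x : Fin k) (f : Fin k → ℤ) → sum (λ u → 𝟙 (u ≟F x) * f u) ≡ f x
  sum-δ {suc k} zero f = trans (cong₂ _+_ (ℤR.*-identityˡ (f zero))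
    (trans (sum-cong-≗ (λ i → ℤR.zeroˡ (f (suc i)))) (sum-replicate-zero k))) (ℤR.+-identityʳ _)
  sum-δ {suc k} (suc x) f = trans (cong (_+ sum (λ i → 𝟙 (suc i ≟F suc x) * f (suc i))) (ℤR.zeroˡ (f zero))) (trans (ℤR.+-identityˡ _)
    (trans (sum-cong-≗ (λ i → cong (_* f (suc i)) (𝟙-⇔ (suc i ≟F suc x) (i ≟F x) (λ { refl → refl }) (cong suc)))) (sum-δ x (f ∘ suc))))

  opaque
    unfolding _+_

    sum-nonneg : ∀ {k} (f : Fin k → ℤ) → (∀ i → 0ℤ ℤ.≤ f i) → 0ℤ ℤ.≤ sum f
    sum-nonneg {zero} f h = ℤₚ.≤-refl
    sum-nonneg {suc k} f h = ℤₚ.+-mono-≤ (h zero) (sum-nonneg (f ∘ suc) (h ∘ suc))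

    sum-mono : ∀ {k} {f g : Fin k → ℤ} → (∀ i → f i ℤ.≤ g i) → sum f ℤ.≤ sum g
    sum-mono {zero} h = ℤₚ.≤-refl
    sum-mono {suc k} h = ℤₚ.+-mono-≤ (h zero) (sum-mono (h ∘ suc))

    sum-pos : ∀ {k} (f : Fin k → ℤ) → (∀ i → 0ℤ ℤ.≤ f i) → ∀ x → f x ℤ.≤ sum f
    sum-pos {suc k} f h zero = subst (ℤ._≤ sum f) (ℤₚ.+-identityʳ _) (ℤₚ.+-monoʳ-≤ (f zero) (sum-nonneg (f ∘ suc) (h ∘ suc)))
    sum-pos {suc k} f h (suc x) = subst (ℤ._≤ sum f) (ℤₚ.+-identityˡ _) (ℤₚ.+-mono-≤ (h zero) (sum-pos (f ∘ suc) (h ∘ suc) x))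

    sum-one : ∀ k → sum {k} (λ _ → 1ℤ) ≡ ℤ.+ k
    sum-one zero = refl
    sum-one (suc k) = cong (λ v → 1ℤ + v) (sum-one k)

    sum-∣tabulate∣ : ∀ {k} (b : Fin k → Bool) → ℤ.+ ∣ tabulate b ∣ ≡ sum (λ u → if b u then 1ℤ else 0ℤ)
    sum-∣tabulate∣ {zero} b = refl
    sum-∣tabulate∣ {suc k} b with b zero
    ... | true = cong (λ v → 1ℤ + v) (sum-∣tabulate∣ (b ∘ suc))
    ... | false = trans (sum-∣tabulate∣ (b ∘ suc)) (sym (ℤₚ.+-identityˡ _))

module Sums (m : ℕ) where
  open Divides m public
  private module S = FiniteSums

  abstract
    ∑ : (R → ℤ) → ℤ
    ∑ f = S.sum f

    ∑-def : ∀ f → ∑ f ≡ S.sum f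
    ∑-def f = refl

    ∑-cong : ∀ {f g} → (∀ x → f x ≡ g x) → ∑ f ≡ ∑ g
    ∑-cong = S.sum-cong-≗

    ∑-+ : ∀ f g → ∑ (λ x → f x + g x) ≡ ∑ f + ∑ g
    ∑-+ = S.∑-distrib-+

    ∑-*ˡ : ∀ c f → c * ∑ f ≡ ∑ (λ x → c * f x)
    ∑-*ˡ = S.*-distribˡ-sum

    ∑-comm : ∀ (f : R → R → ℤ) → ∑ (λ x → ∑ (f x)) ≡ ∑ (λ y → ∑ (λ x → f x y))
    ∑-comm = S.∑-comm

    ∑-bij : ∀ (σ τ : R → R) → (∀ x → σ (τ x) ≡ x) → (∀ x → τ (σ x) ≡ x) → ∀ f → ∑ f ≡ ∑ (f ∘ σ)
    ∑-bij σ τ στ τσ f = S.sum-permute f (permutation σ τ στ τσ)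

    ∑-δ : ∀ (x : R) (f : R → ℤ) → ∑ (λ u → 𝟙 (u ≟F x) * f u) ≡ f x
    ∑-δ = S.sum-δ

    ∑-mono : ∀ {f g} → (∀ i → f i ℤ.≤ g i) → ∑ f ℤ.≤ ∑ g
    ∑-mono = S.sum-mono

    ∑-pos : ∀ f → (∀ i → 0ℤ ℤ.≤ f i) → ∀ x → f x ℤ.≤ ∑ f
    ∑-pos = S.sum-pos

    ∑-one : ∑ (λ _ → 1ℤ) ≡ ℤ.+ n
    ∑-one = S.sum-one n

    ∑-∣tabulate∣ : ∀ (b : R → Bool) → ℤ.+ ∣ tabulate b ∣ ≡ ∑ (λ u → if b u then 1ℤ else 0ℤ)
    ∑-∣tabulate∣ = S.sum-∣tabulate∣

    ∑-sum : ∀ k (g : R → Fin k → ℤ) → S.sum (λ i → ∑ (λ t → g t i)) ≡ ∑ (λ t → S.sum (g t))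
    ∑-sum k g = S.∑-comm (λ i t → g t i)

  ∑-*ʳ : ∀ f c → ∑ f * c ≡ ∑ (λ x → f x * c)
  ∑-*ʳ f c = trans (ℤR.*-comm _ c) (trans (∑-*ˡ c f) (∑-cong (λ x → ℤR.*-comm c (f x))))

  ∑-zero : ∑ (λ _ → 0ℤ) ≡ 0ℤ
  ∑-zero = trans (∑-cong (λ _ → sym (ℤR.zeroˡ 0ℤ))) (trans (sym (∑-*ˡ 0ℤ (λ _ → 0ℤ))) (ℤR.zeroˡ _))

  ∑-− : ∀ f g → ∑ (λ x → f x - g x) ≡ ∑ f - ∑ g
  ∑-− f g = trans (∑-+ f (λ x → - g x)) (cong (∑ f +_) (begin
      ∑ (λ x → - g x)            ≡⟨ ∑-cong (λ x → neg (g x)) ⟩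
      ∑ (λ x → (- 1ℤ) * g x)     ≡⟨ ∑-*ˡ (- 1ℤ) g ⟨
      (- 1ℤ) * ∑ g               ≡⟨ neg (∑ g) ⟨
      - ∑ g                      ∎))
    where
    open ≡-Reasoning
    neg : ∀ v → - v ≡ (- 1ℤ) * v
    neg = solveℤ 1 (λ v → ⟨-⟩ v ⟨=⟩ (⟨-⟩ conℤ 1ℤ) ⟨*⟩ v) refl

  ∑-vanish : ∀ {f} → (∀ x → f x ≡ 0ℤ) → ∑ f ≡ 0ℤ
  ∑-vanish h = trans (∑-cong h) ∑-zero

  ∑≢0 : ∀ f → ∑ f ≢ 0ℤ → ∃[ x ] f x ≢ 0ℤ
  ∑≢0 f h with any? (λ x → ¬? (f x ℤ.≟ 0ℤ))
  ... | yes p = p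
  ... | no ¬p = ⊥-elim (h (∑-vanish λ x → case f x ℤ.≟ 0ℤ of λ { (yes q) → q ; (no q) → ⊥-elim (¬p (x , q)) }))

  ∑≥1 : ∀ f → (∀ i → 0ℤ ℤ.≤ f i) → ∀ x → f x ≡ 1ℤ → ∑ f ≢ 0ℤ
  ∑≥1 f h x fx≡1 eq = case subst₂ ℤ._≤_ fx≡1 eq (∑-pos f h x) of λ { (ℤ.+≤+ ()) }

  ∔-⊟ : ∀ x t → x ⊟ t ∔ t ≡ x
  ∔-⊟ = solve 2 (λ x t → x :- t :+ t := x) refl

  ⊟-∔ : ∀ x t → x ∔ t ⊟ t ≡ x
  ⊟-∔ = solve 2 (λ x t → x :+ t :- t := x) refl

  ∑-shift : ∀ t f → ∑ f ≡ ∑ (λ x → f (x ∔ t))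
  ∑-shift t f = ∑-bij (_∔ t) (_⊟ t) (λ x → ∔-⊟ x t) (λ x → ⊟-∔ x t) f

  ∑-reflect : ∀ z f → ∑ f ≡ ∑ (λ x → f (z ⊟ x))
  ∑-reflect z f = ∑-bij (z ⊟_) (z ⊟_) lem lem f
    where
    lem : ∀ x → z ⊟ (z ⊟ x) ≡ x
    lem = solve 2 (λ z x → z :- (z :- x) := x) refl z

  ∑-scale : ∀ {u} → Unit u → ∀ f → ∑ f ≡ ∑ (λ x → f (u · x))
  ∑-scale {u} (v , uv≡1) f = ∑-bij (u ·_) (v ·_)
    (λ x → trans (sym (CR.*-assoc u v x)) (trans (cong (_· x) uv≡1) (CR.*-identityˡ x)))
    (λ x → trans (trans (sym (CR.*-assoc v u x)) (cong (_· x) (CR.*-comm v u))) (trans (cong (_· x) uv≡1) (CR.*-identityˡ x))) f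

  -- Each residue lies in exactly one of the d translates of dℤ/n by 0, 1, …, d - 1.
  D-count : ∀ {d} → d ∣ n → ℤ.+ d * ∑ (λ t → 𝟙 (D? d t)) ≡ ℤ.+ n
  D-count {d} d∣n = begin
    ℤ.+ d * N                                     ≡⟨ cong (_* N) (sym (S.sum-one d)) ⟩
    S.sum (λ (i : Fin d) → 1ℤ) * N               ≡⟨ S.*-distribʳ-sum N (λ (i : Fin d) → 1ℤ) ⟩
    S.sum (λ (i : Fin d) → 1ℤ * N)               ≡⟨ S.sum-cong-≗ {d} (λ i → trans (ℤR.*-identityˡ N) (∑-shift (⊝ π (toℕ i)) _)) ⟩
    S.sum (λ (i : Fin d) → ∑ (λ t → h t i))         ≡⟨ ∑-sum d h ⟩
    ∑ (λ t → S.sum (λ (i : Fin d) → h t i))         ≡⟨ ∑-cong one ⟩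
    ∑ (λ t → 1ℤ)                                   ≡⟨ ∑-one ⟩
    ℤ.+ n                                           ∎
    where
    open ≡-Reasoning
    N = ∑ (λ t → 𝟙 (D? d t))
    h : R → Fin d → ℤ
    h t i = 𝟙 (D? d (t ⊟ π (toℕ i)))
    instance
      d≢0 : NonZero d
      d≢0 = ℕ.≢-nonZero (∣n⇒≢0 d∣n)
    one : ∀ t → S.sum (h t) ≡ 1ℤ
    one t = trans (S.sum-cong-≗ (λ i → trans (𝟙-⇔ (D? d (t ⊟ π (toℕ i))) (i ≟F toℕ t mod d) (to i) (from i)) (sym (ℤR.*-identityʳ _))))
              (S.sum-δ (toℕ t mod d) (λ _ → 1ℤ))
      where
      r = toℕ t % d
      D-r : D d (t ⊟ π r)
      D-r = subst (D d) (trans (solve 2 (λ r q → q := r :+ q :- r) refl (π r) _) (cong (_⊟ π r)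
              (trans (sym (π-+ r _)) (trans (cong π (sym (m≡m%n+[m/n]*n (toℕ t) d))) (π-toℕ t)))))
              (π-D (n∣m*n (toℕ t / d) {d}))
      from : ∀ i → i ≡ toℕ t mod d → D d (t ⊟ π (toℕ i))
      from i refl = subst (λ v → D d (t ⊟ π v)) (sym (toℕ-fromℕ< _)) D-r
      to : ∀ i → D d (t ⊟ π (toℕ i)) → i ≡ toℕ t mod d
      to i hi = toℕ-injective (trans (close (toℕ<n i) (m%n<n (toℕ t) d) (diff (toℕ i) r (D-⊟ D-r hi)) (diff r (toℕ i) (D-⊟ hi D-r))) (sym (toℕ-fromℕ< _)))
        where
        diff : ∀ a b → D d ((t ⊟ π b) ⊟ (t ⊟ π a)) → b ≤ a → d ∣ a ℕ.∸ b
        diff a b hd b≤a = D-π d∣n (subst (D d) (trans (cong (λ v → (t ⊟ π b) ⊟ (t ⊟ v)) (trans (cong π (sym (ℕₚ.m∸n+n≡m b≤a))) (π-+ _ _)))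
          (solve 3 (λ t b c → (t :- b) :- (t :- (c :+ b)) := c) refl t (π b) (π (a ℕ.∸ b)))) hd)
        small : ∀ {a b} → a < d → b ≤ a → d ∣ a ℕ.∸ b → a ≡ b
        small {a} {b} a<d b≤a hd with a ℕ.∸ b in eq
        ... | zero = ℕₚ.≤-antisym (ℕₚ.m∸n≡0⇒m≤n eq) b≤a
        ... | suc c = ⊥-elim (ℕₚ.<⇒≱ a<d (ℕₚ.≤-trans (∣⇒≤ hd) (subst (_≤ a) eq (ℕₚ.m∸n≤m a b))))
        close : ∀ {a b} → a < d → b < d → (b ≤ a → d ∣ a ℕ.∸ b) → (a ≤ b → d ∣ b ℕ.∸ a) → a ≡ b
        close {a} {b} a<d b<d p q with ℕₚ.≤-total b a
        ... | inj₁ b≤a = small a<d b≤a (p b≤a)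
        ... | inj₂ a≤b = sym (small b<d a≤b (q a≤b))

-- The S-ring as a ring of functions under convolution.

module Blocks {m : ℕ} (A : SRing m) where
  open Sums m public
  open SRing A public using (lab)

  infix 4 _~_ _~?_

  _~_ : R → R → Set
  x ~ y = lab x ≡ lab y

  _~?_ : ∀ x y → Dec (x ~ y)
  x ~? y = lab x ℕ.≟ lab y

  ~-0 : ∀ {x} → x ~ π 0 → x ≡ π 0
  ~-0 {x} h = trans (SRing.e-block A x (subst (x ~_) (sym e-def) h)) e-def

  ~-⊝ : ∀ {x y} → x ~ y → ⊝ x ~ ⊝ y
  ~-⊝ {x} {y} h = subst₂ _~_ (⊝-def x) (⊝-def y) (SRing.inv-block A x y h)

  coeff-∑ : ∀ x y z → ℤ.+ coeff lab x y z ≡ ∑ (λ u → 𝟙 (u ~? x) * 𝟙 (z ⊟ u ~? y))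
  coeff-∑ x y z = trans (∑-∣tabulate∣ _) (∑-cong λ u →
    trans (𝟙-does (u ~? x ×-dec z ⊕ (Defs.⊖ u) ~? y))
      (trans (cong (λ v → 𝟙 (u ~? x ×-dec v ~? y)) (trans (∔-def z _) (cong (z ∔_) (⊝-def u))))
        (sym (𝟙-× (u ~? x) (z ⊟ u ~? y)))))

  coeff-const : ∀ x y {z z′} → z ~ z′ →
    ∑ (λ u → 𝟙 (u ~? x) * 𝟙 (z ⊟ u ~? y)) ≡ ∑ (λ u → 𝟙 (u ~? x) * 𝟙 (z′ ⊟ u ~? y))
  coeff-const x y {z} {z′} h = trans (sym (coeff-∑ x y z)) (trans (cong ℤ.+_ (SRing.mult A x y z z′ h)) (coeff-∑ x y z′))

  -- The elements of the S-ring, as coefficient functions; _⋆_ is its multiplication.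
  AFun : (R → ℤ) → Set
  AFun φ = ∀ {x y} → x ~ y → φ x ≡ φ y

  infixl 7 _⋆_
  _⋆_ : (R → ℤ) → (R → ℤ) → R → ℤ
  (f ⋆ g) z = ∑ (λ u → f u * g (z ⊟ u))

  block-AFun : ∀ x → AFun (λ y → 𝟙 (y ~? x))
  block-AFun x {y} {z} y~z = 𝟙-⇔ (y ~? x) (z ~? x) (trans (sym y~z)) (trans y~z)

  private
    -- One representative per block, depending on the label alone. The fixed points of `r` index the
    -- blocks, so every `AFun` is a combination of block indicators over them, and bilinearity
    -- reduces `⋆-AFun` to the structure constants.
    rep : ℕ → R
    rep c with any? (λ x → lab x ℕ.≟ c)
    ... | yes (x , _) = x
    ... | no _ = π 0

    rep-~ : ∀ u → rep (lab u) ~ u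
    rep-~ u with any? (λ x → lab x ℕ.≟ lab u)
    ... | yes (x , h) = h
    ... | no ¬h = ⊥-elim (¬h (u , refl))

    r : R → R
    r u = rep (lab u)

    is-rep : ∀ x u → 𝟙 (x ≟F r u) ≡ 𝟙 (x ≟F r x) * 𝟙 (u ~? x)
    is-rep x u = trans (𝟙-⇔ (x ≟F r u) (x ≟F r x ×-dec u ~? x) to from) (sym (𝟙-× (x ≟F r x) (u ~? x)))
      where
      to : x ≡ r u → (x ≡ r x) × (u ~ x)
      to refl = cong rep (sym (rep-~ u)) , sym (rep-~ u)
      from : (x ≡ r x) × (u ~ x) → x ≡ r u
      from (p , q) = trans p (cong rep (sym q))

    expand : ∀ {f} → AFun f → ∀ u → f u ≡ ∑ (λ x → f x * (𝟙 (x ≟F r x) * 𝟙 (u ~? x)))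
    expand {f} hf u = trans (hf (sym (rep-~ u))) (trans (sym (∑-δ (r u) f))
      (∑-cong λ x → trans (ℤR.*-comm _ (f x)) (cong (f x *_) (is-rep x u))))

    ⋆-expand : ∀ {f g} → AFun f → AFun g → ∀ z → (f ⋆ g) z ≡
      ∑ (λ x → ∑ (λ y → f x * 𝟙 (x ≟F r x) * (g y * 𝟙 (y ≟F r y)) * ∑ (λ u → 𝟙 (u ~? x) * 𝟙 (z ⊟ u ~? y))))
    ⋆-expand {f} {g} hf hg z = begin
      ∑ (λ u → f u * g (z ⊟ u))
        ≡⟨ ∑-cong (λ u → trans (cong₂ _*_ (expand hf u) (expand hg (z ⊟ u)))
             (trans (∑-*ʳ _ _) (∑-cong λ x → ∑-*ˡ _ _))) ⟩
      ∑ (λ u → ∑ (λ x → ∑ (λ y → f x * (p x * q u x) * (g y * (p y * q (z ⊟ u) y)))))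
        ≡⟨ ∑-comm _ ⟩
      ∑ (λ x → ∑ (λ u → ∑ (λ y → f x * (p x * q u x) * (g y * (p y * q (z ⊟ u) y)))))
        ≡⟨ ∑-cong (λ x → ∑-comm _) ⟩
      ∑ (λ x → ∑ (λ y → ∑ (λ u → f x * (p x * q u x) * (g y * (p y * q (z ⊟ u) y)))))
        ≡⟨ ∑-cong (λ x → ∑-cong (λ y → trans (∑-cong λ u → arith (f x) (p x) (q u x) (g y) (p y) (q (z ⊟ u) y)) (sym (∑-*ˡ _ _)))) ⟩
      ∑ (λ x → ∑ (λ y → f x * p x * (g y * p y) * ∑ (λ u → q u x * q (z ⊟ u) y))) ∎
      where
      open ≡-Reasoning
      p : R → ℤ
      p x = 𝟙 (x ≟F r x)
      q : R → R → ℤ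
      q u x = 𝟙 (u ~? x)
      arith : ∀ a b c d e f → a * (b * c) * (d * (e * f)) ≡ a * b * (d * e) * (c * f)
      arith = solveℤ 6 (λ a b c d e f → a ⟨*⟩ (b ⟨*⟩ c) ⟨*⟩ (d ⟨*⟩ (e ⟨*⟩ f)) ⟨=⟩ a ⟨*⟩ b ⟨*⟩ (d ⟨*⟩ e) ⟨*⟩ (c ⟨*⟩ f)) refl

  ⋆-AFun : ∀ {f g} → AFun f → AFun g → AFun (f ⋆ g)
  ⋆-AFun hf hg {z} {z′} h = trans (⋆-expand hf hg z) (trans
    (∑-cong λ x → ∑-cong λ y → cong (_ *_) (coeff-const x y h)) (sym (⋆-expand hf hg z′)))

  abstract
    -- The structure constant for the blocks of `u` and `v` is positive at `z`, hence also at `z′`.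
    ~-sum : ∀ {z z′ u v} → z ~ z′ → z ≡ u ∔ v → ∃[ u′ ] ∃[ v′ ] (u′ ~ u × v′ ~ v × z′ ≡ u′ ∔ v′)
    ~-sum {z} {z′} {u} {v} h refl with ∑≢0 _ (subst (_≢ 0ℤ) (coeff-const u v h) (∑≥1 _ nonneg u one))
      where
      nonneg : ∀ x → 0ℤ ℤ.≤ 𝟙 (x ~? u) * 𝟙 (z ⊟ x ~? v)
      nonneg x = subst (0ℤ ℤ.≤_) (sym (𝟙-× (x ~? u) (z ⊟ x ~? v))) (𝟙-nonneg (x ~? u ×-dec z ⊟ x ~? v))
      one : 𝟙 (u ~? u) * 𝟙 (z ⊟ u ~? v) ≡ 1ℤ
      one = trans (cong₂ _*_ (𝟙-yes (u ~? u) refl) (𝟙-yes (z ⊟ u ~? v) (cong lab (solve 2 (λ u v → u :+ v :- u := v) refl u v)))) (ℤR.*-identityˡ 1ℤ)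
    ... | u′ , nz with 𝟙*≢0 (u′ ~? u) nz
    ... | p , nz′ = u′ , z′ ⊟ u′ , p , 𝟙≢0 (z′ ⊟ u′ ~? v) nz′ , solve 2 (λ z u → z := u :+ (z :- u)) refl z′ u′

-- The Frobenius congruence in a commutative semiring.

prime∤! : ∀ {p} → Prime p → ∀ k → k < p → ¬ p ∣ k !
prime∤! pp zero _ h = prime∤1 pp h
prime∤! {p} pp (suc k) k<p h with euclidsLemma (suc k) (k !) pp h
... | inj₁ p∣k = ℕₚ.<⇒≱ k<p (∣⇒≤ p∣k)
... | inj₂ p∣k! = prime∤! pp k (ℕₚ.<-trans (ℕₚ.n<1+n k) k<p) p∣k!

prime∣C : ∀ {p} → Prime p → ∀ k → 0 < k → k < p → p ∣ p C k
prime∣C {p} pp k 0<k k<p with euclidsLemma (p C k) (k ! ℕ.* (p ℕ.∸ k) !) pp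
  (subst (p ∣_) (sym C*≡p!) (n∣n! p (prime≢0 pp)))
  where
  nz : NonZero (k ! ℕ.* (p ℕ.∸ k) !)
  nz = ℕₚ.m*n≢0 (k !) ((p ℕ.∸ k) !) {{ℕₚ._!≢0 k}} {{ℕₚ._!≢0 (p ℕ.∸ k)}}
  C*≡p! : (p C k) ℕ.* (k ! ℕ.* (p ℕ.∸ k) !) ≡ p !
  C*≡p! = trans (cong (ℕ._* (k ! ℕ.* (p ℕ.∸ k) !)) (nCk≡n!/k![n-k]! (ℕₚ.<⇒≤ k<p))) (m/n*n≡m {{nz}} (k![n∸k]!∣n! (ℕₚ.<⇒≤ k<p)))
  n∣n! : ∀ p → p ≢ 0 → p ∣ p !
  n∣n! zero h = ⊥-elim (h refl)
  n∣n! (suc p) _ = m∣m*n (p !)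
... | inj₁ h = h
... | inj₂ h with euclidsLemma (k !) ((p ℕ.∸ k) !) pp h
... | inj₁ h₁ = ⊥-elim (prime∤! pp k k<p h₁)
... | inj₂ h₂ = ⊥-elim (prime∤! pp (p ℕ.∸ k) (ℕₚ.∸-monoʳ-< 0<k (ℕₚ.<⇒≤ k<p)) h₂)

module Frobenius {c ℓ} (S : CommutativeSemiring c ℓ) where
  private module S = CommutativeSemiring S
  open S using (Carrier; _≈_; 0#; 1#)
    renaming (_+_ to _⊹_; _*_ to _✶_)
  open Exp S.semiring using (_^_)
  open Mult S.semiring using (×-congˡ; ×-homo-1; ×-assocˡ) renaming (_×_ to _⊡_)
  open CMult S.+-commutativeMonoid using (×-distrib-+)
  open SemiringSum S.semiring using (sum; sum-init-last)
  open SetoidReasoning S.setoid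

  ⊡-0# : ∀ k → k ⊡ 0# ≈ 0#
  ⊡-0# zero = S.refl
  ⊡-0# (suc k) = S.trans (S.+-identityˡ _) (⊡-0# k)

  sum-multiple : ∀ p {k} (t : Fin k → Carrier) → (∀ i → ∃[ w ] t i ≈ p ⊡ w) → ∃[ w ] sum t ≈ p ⊡ w
  sum-multiple p {zero} t h = 0# , S.sym (⊡-0# p)
  sum-multiple p {suc k} t h with h zero | sum-multiple p (t ∘ suc) (h ∘ suc)
  ... | w , eq | w′ , eq′ = w ⊹ w′ , S.trans (S.+-cong eq eq′) (S.sym (×-distrib-+ w w′ p))

  frobenius₂ : ∀ p → Prime p → ∀ x y → ∃[ w ] (x ⊹ y) ^ p ≈ x ^ p ⊹ y ^ p ⊹ p ⊡ w
  frobenius₂ zero pp x y = ⊥-elim (¬prime[0] pp)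
  frobenius₂ p@(suc k) pp x y = w , (begin
    (x ⊹ y) ^ p                         ≈⟨ Binomial.theorem S p x y ⟩
    t zero ⊹ sum (t ∘ suc)              ≈⟨ S.+-congˡ (sum-init-last (t ∘ suc)) ⟩
    t zero ⊹ (sum mid ⊹ t (suc (fromℕ k))) ≈⟨ S.+-cong t₀ (S.+-cong mid≈ tₚ) ⟩
    y ^ p ⊹ (p ⊡ w ⊹ x ^ p)             ≈⟨ S.+-congˡ (S.+-comm _ _) ⟩
    y ^ p ⊹ (x ^ p ⊹ p ⊡ w)             ≈⟨ S.+-assoc _ _ _ ⟨
    y ^ p ⊹ x ^ p ⊹ p ⊡ w               ≈⟨ S.+-congʳ (S.+-comm _ _) ⟩
    x ^ p ⊹ y ^ p ⊹ p ⊡ w               ∎)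
    where
    t : Fin (suc p) → Carrier
    t = Binomial.binomialTerm S x y p
    mid : Fin k → Carrier
    mid i = t (suc (inject₁ i))
    t₀ : t zero ≈ y ^ p
    t₀ = S.trans (×-homo-1 _) (S.*-identityˡ _)
    tₚ : t (suc (fromℕ k)) ≈ x ^ p
    tₚ = begin
      (p C suc (toℕ (fromℕ k))) ⊡ (x ^ suc (toℕ (fromℕ k)) ✶ y ^ (k ℕ.∸ toℕ (fromℕ k)))
        ≡⟨ cong (λ v → (p C suc v) ⊡ (x ^ suc v ✶ y ^ (k ℕ.∸ v))) (toℕ-fromℕ k) ⟩
      (p C p) ⊡ (x ^ p ✶ y ^ (k ℕ.∸ k))
        ≡⟨ cong₂ (λ u v → u ⊡ (x ^ p ✶ y ^ v)) (nCn≡1 p) (ℕₚ.n∸n≡0 k) ⟩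
      1 ⊡ (x ^ p ✶ 1#)                  ≈⟨ ×-homo-1 _ ⟩
      x ^ p ✶ 1#                        ≈⟨ S.*-identityʳ _ ⟩
      x ^ p                             ∎
    multiple : ∀ {c} b → p ∣ c → ∃[ w ] c ⊡ b ≈ p ⊡ w
    multiple b (divides q eq) = q ⊡ b , S.trans (×-congˡ (trans eq (ℕₚ.*-comm q p))) (S.sym (×-assocˡ b p q))
    mid-multiple : ∀ i → ∃[ w ] mid i ≈ p ⊡ w
    mid-multiple i = multiple (Binomial.binomial S x y p (suc (inject₁ i)))
      (prime∣C pp (suc (toℕ (inject₁ i))) (s≤s z≤n) (s≤s (subst (_< k) (sym (toℕ-inject₁ i)) (toℕ<n i))))
    w = proj₁ (sum-multiple p mid mid-multiple)
    mid≈ = proj₂ (sum-multiple p mid mid-multiple)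

  frobenius : ∀ p → Prime p → ∀ {k} (t : Fin k → Carrier) → ∃[ w ] (sum t) ^ p ≈ sum (λ i → t i ^ p) ⊹ p ⊡ w
  frobenius zero pp = ⊥-elim (¬prime[0] pp)
  frobenius p@(suc _) pp {zero} t = 0# , (begin
    0# ^ p           ≈⟨ S.zeroˡ _ ⟩
    0#               ≈⟨ ⊡-0# p ⟨
    p ⊡ 0#           ≈⟨ S.+-identityˡ _ ⟨
    0# ⊹ p ⊡ 0#      ∎)
  frobenius p@(suc _) pp {suc k} t = w′ ⊹ w , (begin
    (t zero ⊹ sum (t ∘ suc)) ^ p                     ≈⟨ eq ⟩
    t zero ^ p ⊹ sum (t ∘ suc) ^ p ⊹ p ⊡ w           ≈⟨ S.+-congʳ (S.+-congˡ eq′) ⟩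
    t zero ^ p ⊹ (s ⊹ p ⊡ w′) ⊹ p ⊡ w                ≈⟨ S.+-congʳ (S.+-assoc _ _ _) ⟨
    t zero ^ p ⊹ s ⊹ p ⊡ w′ ⊹ p ⊡ w                  ≈⟨ S.+-assoc _ _ _ ⟩
    t zero ^ p ⊹ s ⊹ (p ⊡ w′ ⊹ p ⊡ w)                ≈⟨ S.+-congˡ (×-distrib-+ w′ w p) ⟨
    t zero ^ p ⊹ s ⊹ p ⊡ (w′ ⊹ w)                    ∎)
    where
    s = sum (λ i → t (suc i) ^ p)
    two = frobenius₂ p pp (t zero) (sum (t ∘ suc))
    rec = frobenius p pp (t ∘ suc)
    w = proj₁ two
    eq = proj₂ two
    w′ = proj₁ rec
    eq′ = proj₂ rec

-- Prime powers in the group ring.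

module Schur {m : ℕ} (A : SRing m) where
  open Blocks A public

  private
    Fun : Set
    Fun = R → ℤ

    _≋_ : Fun → Fun → Set
    f ≋ g = ∀ z → f z ≡ g z

    δ : R → Fun
    δ x z = 𝟙 (z ≟F x)

    ⋆-cong : ∀ {f f′ g g′} → f ≋ f′ → g ≋ g′ → (f ⋆ g) ≋ (f′ ⋆ g′)
    ⋆-cong h k z = ∑-cong (λ u → cong₂ _*_ (h u) (k (z ⊟ u)))

    ⋆-comm : ∀ f g → (f ⋆ g) ≋ (g ⋆ f)
    ⋆-comm f g z = trans (∑-reflect z _) (∑-cong λ u → trans (ℤR.*-comm _ _)
      (cong (λ v → g v * f (z ⊟ u)) (solve 2 (λ z u → z :- (z :- u) := u) refl z u)))

    ⋆-assoc : ∀ f g h → ((f ⋆ g) ⋆ h) ≋ (f ⋆ (g ⋆ h))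
    ⋆-assoc f g h z = begin
      ∑ (λ v → ∑ (λ u → f u * g (v ⊟ u)) * h (z ⊟ v))        ≡⟨ ∑-cong (λ v → ∑-*ʳ _ _) ⟩
      ∑ (λ v → ∑ (λ u → f u * g (v ⊟ u) * h (z ⊟ v)))        ≡⟨ ∑-comm _ ⟩
      ∑ (λ u → ∑ (λ v → f u * g (v ⊟ u) * h (z ⊟ v)))        ≡⟨ ∑-cong (λ u → ∑-shift u _) ⟩
      ∑ (λ u → ∑ (λ v → f u * g (v ∔ u ⊟ u) * h (z ⊟ (v ∔ u)))) ≡⟨ ∑-cong (λ u → ∑-cong λ v → trans (ℤR.*-assoc _ _ _)
          (cong₂ (λ a b → f u * (g a * h b)) (⊟-∔ v u) (solve 3 (λ z u v → z :- (v :+ u) := z :- u :- v) refl z u v))) ⟩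
      ∑ (λ u → ∑ (λ v → f u * (g v * h (z ⊟ u ⊟ v))))        ≡⟨ ∑-cong (λ u → ∑-*ˡ _ _) ⟨
      ∑ (λ u → f u * ∑ (λ v → g v * h (z ⊟ u ⊟ v)))          ∎
      where open ≡-Reasoning

    δ-⋆ : ∀ x g z → (δ x ⋆ g) z ≡ g (z ⊟ x)
    δ-⋆ x g z = ∑-δ x (λ u → g (z ⊟ u))

    z⊟0 : ∀ z → z ⊟ π 0 ≡ z
    z⊟0 z = solve 1 (λ z → z :- con 0ℤ := z) refl z

    opaque
      isCommutativeSemiring : IsCommutativeSemiring _≋_ (λ f g z → f z + g z) _⋆_ (λ _ → 0ℤ) (δ (π 0))
      isCommutativeSemiring = IsCommutativeSemiringˡ.isCommutativeSemiring record
        { +-isCommutativeMonoid = record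
          { isMonoid = record
            { isSemigroup = record
              { isMagma = record { isEquivalence = isEq ; ∙-cong = λ h k z → cong₂ _+_ (h z) (k z) }
              ; assoc = λ f g h z → ℤR.+-assoc (f z) (g z) (h z) }
            ; identity = (λ f z → ℤR.+-identityˡ (f z)) , λ f z → ℤR.+-identityʳ (f z) }
          ; comm = λ f g z → ℤR.+-comm (f z) (g z) }
        ; *-isCommutativeMonoid = record
          { isMonoid = record
            { isSemigroup = record
              { isMagma = record { isEquivalence = isEq ; ∙-cong = ⋆-cong }
              ; assoc = ⋆-assoc }
            ; identity = idˡ , λ f z → trans (⋆-comm f (δ (π 0)) z) (idˡ f z) }
          ; comm = ⋆-comm }
        ; distribʳ = λ h f g z → trans (∑-cong λ u → ℤR.distribʳ (h (z ⊟ u)) (f u) (g u)) (∑-+ _ _)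
        ; zeroˡ = λ f z → ∑-vanish (λ u → ℤR.zeroˡ _) }
        where
        isEq : IsEquivalence _≋_
        isEq = record { refl = λ _ → refl ; sym = λ h z → sym (h z) ; trans = λ h k z → trans (h z) (k z) }
        idˡ : ∀ f → (δ (π 0) ⋆ f) ≋ f
        idˡ f z = trans (δ-⋆ (π 0) f z) (cong f (z⊟0 z))

    convolution : CommutativeSemiring _ _
    convolution = record { isCommutativeSemiring = isCommutativeSemiring }

    module C = CommutativeSemiring convolution
    open Exp C.semiring using (_^_; ^-congˡ)
    open Mult C.semiring using () renaming (_×_ to _⊡_)
    module CS = SemiringSum C.semiring

    ^-AFun : ∀ {f} k → AFun f → AFun (f ^ k)
    ^-AFun zero hf {x} {y} x~y = 𝟙-⇔ (x ≟F π 0) (y ≟F π 0) (λ { refl → ~-0 (sym x~y) }) (λ { refl → ~-0 x~y })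
    ^-AFun (suc k) hf = ⋆-AFun hf (^-AFun k hf)

    ⊡-eval : ∀ k f z → (k ⊡ f) z ≡ ℤ.+ k * f z
    ⊡-eval zero f z = sym (ℤR.zeroˡ _)
    ⊡-eval (suc k) f z = trans (cong (f z +_) (⊡-eval k f z))
      (trans (solveℤ 2 (λ a k → a ⟨+⟩ k ⟨*⟩ a ⟨=⟩ (conℤ 1ℤ ⟨+⟩ k) ⟨*⟩ a) refl (f z) (ℤ.+ k)) (cong (_* f z) (+-def 1ℤ (ℤ.+ k))))

    sum-eval : ∀ {k} (t : Fin k → Fun) z → CS.sum t z ≡ FiniteSums.sum (λ i → t i z)
    sum-eval {zero} t z = refl
    sum-eval {suc k} t z = cong (t zero z +_) (sum-eval (t ∘ suc) z)

    module _ (χ : Fun) (idem : ∀ u → χ u * χ u ≡ χ u) where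
      term : R → Fun
      term u z = χ u * δ u z

      -- Since `χ` has idempotent values, `χ u` equals its own powers; the only congruence in the
      -- computation is the one from `frobenius`.
      term^ : ∀ k u → (term u ^ suc k) ≋ (λ z → χ u * 𝟙 (z ≟F π (suc k) · u))
      term^ zero u z = trans (C.*-identityʳ (term u) z) (cong (λ v → χ u * 𝟙 (z ≟F v)) (sym (CR.*-identityˡ u)))
      term^ (suc k) u z = begin
        (term u ⋆ term u ^ suc k) z                                   ≡⟨ ⋆-cong {term u} {term u} {g = term u ^ suc k} (λ _ → refl) (term^ k u) z ⟩
        ∑ (λ v → χ u * 𝟙 (v ≟F u) * (χ u * 𝟙 (z ⊟ v ≟F π (suc k) · u))) ≡⟨ ∑-cong (λ v →
            trans (solveℤ 3 (λ a b c → a ⟨*⟩ b ⟨*⟩ (a ⟨*⟩ c) ⟨=⟩ (a ⟨*⟩ a) ⟨*⟩ (b ⟨*⟩ c)) refl (χ u) (𝟙 (v ≟F u)) _) (cong (_* (𝟙 (v ≟F u) * 𝟙 (z ⊟ v ≟F π (suc k) · u))) (idem u))) ⟩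
        ∑ (λ v → χ u * (𝟙 (v ≟F u) * 𝟙 (z ⊟ v ≟F π (suc k) · u)))     ≡⟨ ∑-*ˡ _ _ ⟨
        χ u * ∑ (λ v → 𝟙 (v ≟F u) * 𝟙 (z ⊟ v ≟F π (suc k) · u))       ≡⟨ cong (χ u *_) (δ-⋆ u (δ (π (suc k) · u)) z) ⟩
        χ u * 𝟙 (z ⊟ u ≟F π (suc k) · u)                              ≡⟨ cong (χ u *_) (𝟙-⇔ (z ⊟ u ≟F π (suc k) · u) (z ≟F π (suc (suc k)) · u)
             (λ h → trans (sym (∔-⊟ z u)) (trans (cong (_∔ u) h) (sym step)))
             (λ h → trans (cong (_⊟ u) (trans h step)) (⊟-∔ _ u))) ⟩
        χ u * 𝟙 (z ≟F π (suc (suc k)) · u)                            ∎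
        where
        open ≡-Reasoning
        step : π (suc (suc k)) · u ≡ π (suc k) · u ∔ u
        step = trans (cong (_· u) (π-+ 1 (suc k))) (solve 2 (λ k u → (:1 :+ k) :* u := k :* u :+ u) refl (π (suc k)) u)

      χ-sum : CS.sum term ≋ χ
      χ-sum z = trans (sum-eval term z) (trans (FiniteSums.sum-cong-≗ (λ u → trans (ℤR.*-comm _ _) (cong (_* χ u) (𝟙-⇔ (z ≟F u) (u ≟F z) sym sym))))
        (FiniteSums.sum-δ z χ))

  -- Modulo a prime p, the p-th power of χ in the group ring is Σ_u χ(u) [pu].
  abstract
    prime-power-AFun : ∀ {p} → Prime p → ∀ χ → (∀ u → χ u * χ u ≡ χ u) → AFun χ → ∀ {z z′} → z ~ z′ →
      ∃[ k ] ∑ (λ u → χ u * 𝟙 (z ≟F π p · u)) ≡ ∑ (λ u → χ u * 𝟙 (z′ ≟F π p · u)) + ℤ.+ p * k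
    prime-power-AFun {zero} pp = ⊥-elim (¬prime[0] pp)
    prime-power-AFun {p@(suc k)} pp χ idem hχ {z} {z′} z~z′ = w z′ - w z , trans (solveℤ 3 (λ a p w → a ⟨=⟩ a ⟨+⟩ p ⟨*⟩ w ⟨-⟩ p ⟨*⟩ w) refl _ (ℤ.+ p) (w z))
        (trans (cong (_- ℤ.+ p * w z) (trans (sym (eval z)) (trans (^-AFun p hχ z~z′) (eval z′))))
          (solveℤ 4 (λ b p w′ w → b ⟨+⟩ p ⟨*⟩ w′ ⟨-⟩ p ⟨*⟩ w ⟨=⟩ b ⟨+⟩ p ⟨*⟩ (w′ ⟨-⟩ w)) refl _ (ℤ.+ p) (w z′) (w z)))
      where
      expansion : ∃[ w ] (CS.sum (term χ idem) ^ p) ≋ (λ z → CS.sum (λ u → term χ idem u ^ p) z + (p ⊡ w) z)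
      expansion = Frobenius.frobenius convolution p pp (term χ idem)
      w : Fun
      w = proj₁ expansion
      eq : (CS.sum (term χ idem) ^ p) ≋ (λ z → CS.sum (λ u → term χ idem u ^ p) z + (p ⊡ w) z)
      eq = proj₂ expansion
      eval : ∀ z → (χ ^ p) z ≡ ∑ (λ u → χ u * 𝟙 (z ≟F π p · u)) + ℤ.+ p * w z
      eval z = trans (sym (^-congˡ p (χ-sum χ idem) z)) (trans (eq z)
        (cong₂ _+_ (trans (sum-eval (λ u → term χ idem u ^ p) z) (trans (FiniteSums.sum-cong-≗ (λ u → term^ χ idem k u z)) (sym (∑-def _)))) (⊡-eval p w z)))

multiple-abs : ∀ p {a} k → a ≡ ℤ.+ p * k → p ∣ ℤ.∣ a ∣
multiple-abs p {a} k eq = divides ℤ.∣ k ∣ (trans (cong ℤ.∣_∣ (trans eq (*-def (ℤ.+ p) k)))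
  (trans (ℤₚ.abs-* (ℤ.+ p) k) (ℕₚ.*-comm p ℤ.∣ k ∣)))

-- Schur's theorem on multipliers, and multiplication by primes dividing n.

module Multipliers {m : ℕ} (A : SRing m) where
  open Schur A public

  -- The coefficient of `z` in the image of the block of `x` under multiplication by `p`; for prime
  -- `p`, this is modulo `p` its coefficient in the `p`-th power of the block sum.
  pullback : ℕ → R → R → ℤ
  pullback p x z = ∑ (λ u → 𝟙 (u ~? x) * 𝟙 (z ≟F π p · u))

  pullback-≡ : ∀ {p} → Prime p → ∀ x {z z′} → z ~ z′ → ∃[ k ] pullback p x z ≡ pullback p x z′ + ℤ.+ p * k
  pullback-≡ pp x = prime-power-AFun pp (λ u → 𝟙 (u ~? x)) (λ u → 𝟙-idem (u ~? x)) (block-AFun x)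

  pullback≢0 : ∀ p x z → pullback p x z ≢ 0ℤ → ∃[ u ] (u ~ x × z ≡ π p · u)
  pullback≢0 p x z h = u , proj₁ both , 𝟙≢0 (z ≟F π p · u) (proj₂ both)
    where
    u = proj₁ (∑≢0 _ h)
    both = 𝟙*≢0 (u ~? x) (proj₂ (∑≢0 _ h))

  pullback-nonneg : ∀ p x z u → 0ℤ ℤ.≤ 𝟙 (u ~? x) * 𝟙 (z ≟F π p · u)
  pullback-nonneg p x z u = subst (0ℤ ℤ.≤_) (sym (𝟙-× (u ~? x) (z ≟F π p · u))) (𝟙-nonneg (u ~? x ×-dec z ≟F π p · u))

  pullback-one : ∀ p x u → u ~ x → 𝟙 (u ~? x) * 𝟙 (π p · u ≟F π p · u) ≡ 1ℤ
  pullback-one p x u h = trans (cong₂ _*_ (𝟙-yes (u ~? x) h) (𝟙-yes (π p · u ≟F π p · u) refl)) (ℤR.*-identityˡ 1ℤ)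

  private
    prime-unit : ∀ {p} → Prime p → ¬ p ∣ n → Unit (π p)
    prime-unit {p} pp p∤n = unit (λ q pq q∣n h → p∤n (subst (_∣ n) (prime∣prime pq pp (D-π q∣n h)) q∣n))

    -- Multiplication by `p` is injective, so `pullback p x (π p · w)` is 1 or 0 according to
    -- whether `w ~ x`, and these values differ modulo `p`.
    cancel-prime : ∀ {p x y} → Prime p → ¬ p ∣ n → π p · x ~ π p · y → x ~ y
    cancel-prime {p} {x} {y} pp p∤n h = case y ~? x of λ
      { (yes y~x) → sym y~x
      ; (no y≁x) → ⊥-elim (prime∤1 pp (multiple-abs p k (trans (sym (at x (inj₁ refl)))
          (trans eq (trans (cong (_+ ℤ.+ p * k) (at y (inj₂ y≁x))) (ℤR.+-identityˡ _)))))) }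
      where
      k = proj₁ (pullback-≡ pp x h)
      eq = proj₂ (pullback-≡ pp x h)
      value : ∀ {w} → w ~ x ⊎ ¬ w ~ x → ℤ
      value (inj₁ _) = 1ℤ
      value (inj₂ _) = 0ℤ
      at : ∀ w (d : w ~ x ⊎ ¬ w ~ x) → pullback p x (π p · w) ≡ value d
      at w d = trans (∑-cong λ u → trans (ℤR.*-comm _ _)
                 (cong (_* 𝟙 (u ~? x)) (𝟙-⇔ (π p · w ≟F π p · u) (u ≟F w) (λ eq → sym (unit-cancel (prime-unit pp p∤n) eq)) (λ { refl → refl }))))
               (trans (∑-δ w _) (val d))
        where
        val : ∀ d → 𝟙 (w ~? x) ≡ value d
        val (inj₁ h) = 𝟙-yes (w ~? x) h
        val (inj₂ h) = 𝟙-no (w ~? x) h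

    cancel-coprime : ∀ k → k ≢ 0 → (∀ q → Prime q → q ∣ n → ¬ q ∣ k) → ∀ {x y} → π k · x ~ π k · y → x ~ y
    cancel-coprime = <-rec _ go
      where
      go : ∀ k → (∀ {j} → j < k → j ≢ 0 → (∀ q → Prime q → q ∣ n → ¬ q ∣ j) → ∀ {x y} → π j · x ~ π j · y → x ~ y) →
           k ≢ 0 → (∀ q → Prime q → q ∣ n → ¬ q ∣ k) → ∀ {x y} → π k · x ~ π k · y → x ~ y
      go k rec k≢0 cop {x} {y} h with k ℕ.≟ 1
      ... | yes refl = subst₂ _~_ (CR.*-identityˡ x) (CR.*-identityˡ y) h
      ... | no k≢1 with prime-divisor k k≢0 k≢1
      ... | p , pp , divides j k≡jp = rec j<k j≢0 (λ q pq q∣n q∣j → cop q pq q∣n (subst (q ∣_) (sym k≡jp) (∣m⇒∣m*n p q∣j)))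
              (cancel-prime pp (λ p∣n → cop p pp p∣n (subst (p ∣_) (sym k≡jp) (n∣m*n j))) (subst₂ _~_ (eq x) (eq y) h))
        where
        j≢0 : j ≢ 0
        j≢0 refl = k≢0 k≡jp
        j<k : j < k
        j<k = subst (j <_) (sym k≡jp) (ℕₚ.m<m*n j p {{ℕ.≢-nonZero j≢0}} (prime>1 pp))
        eq : ∀ x → π k · x ≡ π p · (π j · x)
        eq x = trans (cong (_· x) (trans (cong π k≡jp) (π-* j p))) (solve 3 (λ j p x → j :* p :* x := p :* (j :* x)) refl (π j) (π p) x)

  abstract
    -- A representative of a unit is a product of primes not dividing n, and `cancel-prime` removes
    -- them one by one.
    ~-cancel : ∀ {u x y} → Unit u → u · x ~ u · y → x ~ y
    -- Adding `n` keeps the residue and makes the representative nonzero even when n = 1.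
    ~-cancel {u} {x} {y} uu h = cancel-coprime (toℕ u ℕ.+ n) (λ eq → n≢0 (ℕₚ.m+n≡0⇒n≡0 (toℕ u) eq))
      (λ q pq q∣n q∣k → unit-¬D pq q∣n uu (toℕ-D (∣m+n∣m⇒∣n (subst (q ∣_) (ℕₚ.+-comm (toℕ u) n) q∣k) q∣n)))
      (subst₂ _~_ (cong (_· x) (sym eq)) (cong (_· y) (sym eq)) h)
      where
      eq : π (toℕ u ℕ.+ n) ≡ u
      eq = trans (π-+ (toℕ u) n) (trans (cong₂ _∔_ (π-toℕ u) π-n) (CR.+-identityʳ u))

  abstract
    ~-scale : ∀ {u x y} → Unit u → x ~ y → u · x ~ u · y
    ~-scale {u} {x} {y} (v , uv≡1) h = ~-cancel (u , trans (CR.*-comm v u) uv≡1) (subst₂ _~_ (eq x) (eq y) h)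
      where
      eq : ∀ x → x ≡ v · (u · x)
      eq x = sym (trans (solve 3 (λ u v x → v :* (u :* x) := u :* v :* x) refl u v x) (trans (cong (_· x) uv≡1) (CR.*-identityˡ x)))

  -- The fibre of multiplication by q over q · u₀ has q elements, of which the block of u₀
  -- contains u₀ but not u₁; so the fibre count is nonzero modulo q, on all of the block of q · u₀.
  abstract
    fibre : ∀ {q u₀ u₁} → Prime q → q ∣ n → π q · u₀ ≡ π q · u₁ → ¬ u₁ ~ u₀ →
      ∀ {z} → z ~ π q · u₀ → ∃[ u ] (u ~ u₀ × z ≡ π q · u)
    fibre {q} {u₀} {u₁} pq q∣n q₀≡q₁ u₁≁u₀ {z} h = pullback≢0 q u₀ z λ b≡0 →
      small (multiple-abs q (- k) (trans (solveℤ 2 (λ b v → b ⟨=⟩ (b ⟨+⟩ v) ⟨-⟩ v) refl b (ℤ.+ q * k))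
        (trans (cong (_- ℤ.+ q * k) (trans (sym eq) b≡0)) (solveℤ 2 (λ p k → conℤ 0ℤ ⟨-⟩ p ⟨*⟩ k ⟨=⟩ p ⟨*⟩ (⟨-⟩ k)) refl (ℤ.+ q) k))))
      where
      n′ : ℕ
      n′ = (n / q) {{ℕ.≢-nonZero (prime≢0 pq)}}
      n≡ : n ≡ q ℕ.* n′
      n≡ = sym (m*[n/m]≡n {{ℕ.≢-nonZero (prime≢0 pq)}} q∣n)
      n′∣n : n′ ∣ n
      n′∣n = *≡⇒∣ʳ q n′ n≡
      b k : ℤ
      b = pullback q u₀ (π q · u₀)
      k = proj₁ (pullback-≡ pq u₀ h)
      eq : pullback q u₀ z ≡ b + ℤ.+ q * k
      eq = proj₂ (pullback-≡ pq u₀ h)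
      kernel : ∑ (λ t → 𝟙 (D? n′ t)) ≡ ℤ.+ q
      kernel = ℤₚ.*-cancelˡ-≡ (ℤ.+ n′) _ _ {{ℕ.≢-nonZero (∣n⇒≢0 n′∣n)}}
        (trans (sym (*-def (ℤ.+ n′) _)) (trans (D-count n′∣n) (trans (cong ℤ.+_ (trans n≡ (ℕₚ.*-comm q n′))) (ℤₚ.pos-* n′ q))))
      size : ∑ (λ u → 𝟙 (π q · u₀ ≟F π q · u)) ≡ ℤ.+ q
      size = trans (∑-shift u₀ _) (trans (∑-cong λ v → 𝟙-⇔ (π q · u₀ ≟F π q · (v ∔ u₀)) (D? n′ v)
        (λ e → D-annihilator {q} {n′} n≡ (trans (solve 3 (λ q v u → q :* v := q :* (v :+ u) :- q :* u) refl (π q) v u₀)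
           (trans (cong (_⊟ π q · u₀) (sym e)) (CR.-‿inverseʳ _))))
        (λ d → sym (trans (CR.distribˡ (π q) v u₀) (trans (cong (_∔ π q · u₀) (D-n (subst (λ j → D j (π q · v)) (sym n≡) (D-mul d)))) (CR.+-identityˡ _)))))
        kernel)
      upper : b + 1ℤ ℤ.≤ ℤ.+ q
      upper = subst₂ ℤ._≤_ (trans (∑-+ _ _) (cong (b +_) (trans (∑-cong λ u → sym (ℤR.*-identityʳ _)) (∑-δ u₁ (λ _ → 1ℤ))))) size
        (∑-mono λ u → le u (u ~? u₀) (u ≟F u₁) (π q · u₀ ≟F π q · u))
        where
        le : ∀ u (d₁ : Dec (u ~ u₀)) (d₂ : Dec (u ≡ u₁)) (d₃ : Dec (π q · u₀ ≡ π q · u)) → 𝟙 d₁ * 𝟙 d₃ + 𝟙 d₂ ℤ.≤ 𝟙 d₃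
        le u (yes p) (yes refl) d₃ = ⊥-elim (u₁≁u₀ p)
        le u (no ¬p) (yes refl) d₃ = ℤₚ.≤-reflexive (trans (cong (_+ 1ℤ) (ℤR.zeroˡ _)) (trans (ℤR.+-identityˡ _) (sym (𝟙-yes d₃ q₀≡q₁))))
        le u (yes p) (no _) d₃ = ℤₚ.≤-reflexive (trans (ℤR.+-identityʳ _) (ℤR.*-identityˡ _))
        le u (no ¬p) (no _) d₃ = subst (ℤ._≤ 𝟙 d₃) (sym (trans (ℤR.+-identityʳ _) (ℤR.zeroˡ _))) (𝟙-nonneg d₃)
      lower : 1ℤ ℤ.≤ b
      lower = subst (ℤ._≤ b) (pullback-one q u₀ u₀ refl) (∑-pos _ (pullback-nonneg q u₀ (π q · u₀)) u₀)
      small : ¬ q ∣ ℤ.∣ b ∣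
      small q∣b = go b lower upper q∣b
        where
        go : ∀ b → 1ℤ ℤ.≤ b → b + 1ℤ ℤ.≤ ℤ.+ q → ¬ q ∣ ℤ.∣ b ∣
        go (ℤ.+ suc β) _ up q∣β = ℕₚ.<⇒≱ (drop (subst (ℤ._≤ ℤ.+ q) (+-def (ℤ.+ suc β) 1ℤ) up)) (∣⇒≤ q∣β)
          where
          drop : ℤ.+ (suc β ℕ.+ 1) ℤ.≤ ℤ.+ q → suc β < q
          drop (ℤ.+≤+ h) = subst (_≤ q) (ℕₚ.+-comm (suc β) 1) h
        go (ℤ.+ zero) (ℤ.+≤+ ())

-- Subgroups of ℤ/n and their generators.

module Subgroups (m : ℕ) where
  open Sums m public

  abstract
    ⟪_⟫ : ℕ → Subset n
    ⟪ d ⟫ = tabulate (λ x → does (D? d x))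

    ∈⇒D : ∀ {d x} → x ∈ ⟪ d ⟫ → D d x
    ∈⇒D {d} {x} h = dec-true (D? d x) (trans (sym (lookup∘tabulate (λ x → does (D? d x)) x)) ([]=⇒lookup h))
      where
      dec-true : (p : Dec (D d x)) → does p ≡ true → D d x
      dec-true (yes p) _ = p

    D⇒∈ : ∀ {d x} → D d x → x ∈ ⟪ d ⟫
    D⇒∈ {d} {x} h = lookup⇒[]= x ⟪ d ⟫ (trans (lookup∘tabulate (λ x → does (D? d x)) x) (dec-true (D? d x)))
      where
      dec-true : (p : Dec (D d x)) → does p ≡ true
      dec-true (yes _) = refl
      dec-true (no ¬p) = ⊥-elim (¬p h)

    ∣⟪⟫∣ : ∀ d → ℤ.+ ∣ ⟪ d ⟫ ∣ ≡ ∑ (λ x → 𝟙 (D? d x))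
    ∣⟪⟫∣ d = trans (∑-∣tabulate∣ (λ x → does (D? d x))) (∑-cong (λ x → 𝟙-does (D? d x)))

  ⟪⟫-subgroup : ∀ d → IsSubgroup ⟪ d ⟫
  ⟪⟫-subgroup d = record
    { has-e = D⇒∈ (subst (D d) (sym e-def) D-0)
    ; closed⊕ = λ x y hx hy → D⇒∈ (subst (D d) (sym (∔-def x y)) (D-∔ (∈⇒D hx) (∈⇒D hy)))
    ; closed⊖ = λ x hx → D⇒∈ (subst (D d) (sym (⊝-def x)) (D-⊝ (∈⇒D hx))) }

  ⟪⟫-size : ∀ {d} → d ∣ n → d ℕ.* ∣ ⟪ d ⟫ ∣ ≡ n
  ⟪⟫-size {d} d∣n = ℤₚ.+-injective (trans (ℤₚ.pos-* d ∣ ⟪ d ⟫ ∣) (trans (sym (*-def (ℤ.+ d) _))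
    (trans (cong (ℤ.+ d *_) (∣⟪⟫∣ d)) (D-count d∣n))))

  record IsAdditive (P : R → Set) : Set where
    field
      has-0 : P (π 0)
      has-∔ : ∀ {x y} → P x → P y → P (x ∔ y)

    has-· : ∀ y {x} → P x → P (y · x)
    has-· y {x} px = subst (λ v → P (v · x)) (π-toℕ y) (go (toℕ y))
      where
      go : ∀ k → P (π k · x)
      go zero = subst P (sym (CR.zeroˡ x)) has-0
      go (suc k) = subst P (trans (solve 2 (λ k x → x :+ k :* x := (:1 :+ k) :* x) refl (π k) x) (cong (_· x) (sym (π-+ 1 k))))
        (has-∔ px (go k))

  abstract
    -- `g` is the gcd of n and the elements of `Q`, and Bézout's identity puts it into `P`.
    -- Decidability is asked of `Q` only, because `P` will be the inductively generated `Closure`.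
    generator : ∀ {P Q : R → Set} → IsAdditive P → (∀ x → Dec (Q x)) → (∀ {x} → Q x → P x) →
      ∃[ g ] (g ∣ n × (∀ {x} → Q x → D g x) × P (π g))
    generator {P} {Q} add Q? Q⊆P = case go n f f-P of λ { (g , g∣n , all-D , p) →
        g , g∣n , (λ {x} qx → subst (D g) (f-Q x qx) (all-D x)) , p }
      where
      open IsAdditive add
      select : ∀ x → Dec (Q x) → R
      select x (yes _) = x
      select x (no _) = π 0
      f : R → R
      f x = select x (Q? x)
      f-P : ∀ x → P (f x)
      f-P x with Q? x
      ... | yes q = Q⊆P q
      ... | no _ = has-0
      f-Q : ∀ x → Q x → f x ≡ x
      f-Q x q with Q? x
      ... | yes _ = refl
      ... | no ¬q = ⊥-elim (¬q q)
      go : ∀ k (f : Fin k → R) → (∀ i → P (f i)) → ∃[ g ] (g ∣ n × (∀ i → D g (f i)) × P (π g))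
      go zero f h = n , ∣-refl , (λ ()) , subst P (sym π-n) has-0
      go (suc k) f h with go k (f ∘ suc) (h ∘ suc)
      ... | g , g∣n , all-D , p = gcd g a , ∣-trans (gcd[m,n]∣m g a) g∣n , all , subst P (sym (proj₂ (proj₂ bez)))
              (has-∔ (has-· _ p) (has-· _ (subst P (sym (π-toℕ (f zero))) (h zero))))
        where
        a : ℕ
        a = toℕ (f zero)
        bez : ∃[ s ] ∃[ t ] π (gcd g a) ≡ s · π g ∔ t · π a
        bez = bezout g a
        all : ∀ i → D (gcd g a) (f i)
        all zero = toℕ-D (gcd[m,n]∣n g a)
        all (suc i) = D-∣ (gcd[m,n]∣m g a) (all-D i)

  abstract
    subgroup-generator : ∀ {H} → IsSubgroup H → ∃[ g ] (g ∣ n × (∀ {x} → x ∈ H → D g x) × (∀ {x} → D g x → x ∈ H))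
    subgroup-generator {H} sub = g , proj₁ (proj₂ span) , proj₁ (proj₂ (proj₂ span)) ,
        λ { {x} (y , eq) → subst (_∈ H) (trans (CR.*-comm y (π g)) (sym eq)) (IsAdditive.has-· add y (proj₂ (proj₂ (proj₂ span)))) }
      where
      add : IsAdditive (_∈ H)
      add = record { has-0 = subst (_∈ H) e-def (IsSubgroup.has-e sub)
                   ; has-∔ = λ {x} {y} hx hy → subst (_∈ H) (∔-def x y) (IsSubgroup.closed⊕ sub x y hx hy) }
      span : ∃[ g ] (g ∣ n × (∀ {x} → x ∈ H → D g x) × π g ∈ H)
      span = generator add (_∈? H) id
      g : ℕ
      g = proj₁ span

-- 𝒜-groups and primitive sections.

module AGroups {m : ℕ} (A : SRing m) where
  open Multipliers A public
  open Subgroups m using (⟪_⟫; ∈⇒D; D⇒∈; ⟪⟫-subgroup; ⟪⟫-size; IsAdditive; generator; subgroup-generator) public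

  Good : ℕ → Set
  Good d = ∀ x y → x ~ y → D d x → D d y

  abstract
    Good? : ∀ d → Dec (Good d)
    Good? d = all? (λ x → all? (λ y → (x ~? y) →-dec (D? d x →-dec D? d y)))

  Good-1 : Good 1
  Good-1 x y _ _ = D-1 y

  Good-coprime : ∀ {b c} → gcd b c ≡ 1 → Good b → Good c → Good (b ℕ.* c)
  Good-coprime {b} {c} g≡1 hb hc x y x~y d =
    D-coprime g≡1 (hb x y x~y (D-∣ (m∣m*n c) d)) (hc x y x~y (D-∣ (n∣m*n b) d))

  Good⇒AGroup : ∀ {d} → Good d → IsAGroup A ⟪ d ⟫
  Good⇒AGroup {d} h = record { subgroup = ⟪⟫-subgroup d ; union = λ x y x~y hx → D⇒∈ (h x y x~y (∈⇒D hx)) }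

  private
    -- The subgroup generated by the block of `z`; as the group is finite, sums suffice. By `~-sum`
    -- a block meeting it lies in it, which is `closure-~`.
    data Closure (z : R) : R → Set where
      c-0 : Closure z (π 0)
      c-∔ : ∀ {z′ x} → z′ ~ z → Closure z x → Closure z (z′ ∔ x)

    closure-additive : ∀ z → IsAdditive (Closure z)
    closure-additive z = record { has-0 = c-0 ; has-∔ = add }
      where
      add : ∀ {x y} → Closure z x → Closure z y → Closure z (x ∔ y)
      add c-0 c = subst (Closure z) (sym (CR.+-identityˡ _)) c
      add (c-∔ h c′) c = subst (Closure z) (sym (CR.+-assoc _ _ _)) (c-∔ h (add c′ c))

    closure-⊆ : ∀ {z d} → (∀ {z′} → z′ ~ z → D d z′) → ∀ {x} → Closure z x → D d x
    closure-⊆ h c-0 = D-0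
    closure-⊆ h (c-∔ h′ c) = D-∔ (h h′) (closure-⊆ h c)

    closure-~ : ∀ {z x y} → y ~ x → Closure z x → Closure z y
    closure-~ y~x c-0 = subst (Closure _) (sym (~-0 y~x)) c-0
    closure-~ {z} y~x (c-∔ h c) with ~-sum (sym y~x) refl
    ... | u , v , u~ , v~ , refl = c-∔ (trans u~ h) (closure-~ v~ c)

  abstract
    -- `g` is the index of `Closure z`, so the last clause says that `g` ℤ/n is the least subgroup
    -- containing the block.
    block-generator : ∀ z → ∃[ g ] (g ∣ n × Good g × (∀ {z′} → z′ ~ z → D g z′) ×
      (∀ {d} → d ∣ n → (∀ {z′} → z′ ~ z → D d z′) → d ∣ g))
    block-generator z = g , proj₁ (proj₂ span) , good , gD , λ d∣n h → D-π d∣n (closure-⊆ h πg)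
      where
      span : ∃[ g ] (g ∣ n × (∀ {z′} → z′ ~ z → D g z′) × Closure z (π g))
      span = generator (closure-additive z) (_~? z) (λ {x} h → subst (Closure z) (CR.+-identityʳ x) (c-∔ h c-0))
      g : ℕ
      g = proj₁ span
      gD : ∀ {z′} → z′ ~ z → D g z′
      gD = proj₁ (proj₂ (proj₂ span))
      πg : Closure z (π g)
      πg = proj₂ (proj₂ (proj₂ span))
      good : Good g
      good x y x~y (v , eq) = closure-⊆ gD (closure-~ (sym x~y)
        (subst (Closure z) (trans (CR.*-comm v (π g)) (sym eq)) (IsAdditive.has-· (closure-additive z) v πg)))

  Good-generated : ∀ {d z} → d ∣ n → (∀ {z′} → z′ ~ z → D d z′) → (∃[ y ] π d ≡ z · y) → Good d
  Good-generated {d} {z} d∣n h (y , eq) with block-generator z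
  ... | g , g∣n , good , gD , maximal = subst Good (∣-antisym (D-π g∣n (subst (D g) (sym eq) (D-·ʳ y (gD refl)))) (maximal d∣n h)) good

  module _ (qd : Quasidense A) where

    private
      maximal-primitive : ∀ {u l} → l ∣ n → u ∣ l → u ≢ l → Good u → Good l →
        (∀ d → u ∣ d → d ∣ l → d ≢ u → d ≢ l → ¬ Good d) → IsPrimitiveSection A ⟪ u ⟫ ⟪ l ⟫
      maximal-primitive {u} {l} l∣n u∣l u≢l gu gl none =
        Good⇒AGroup gu , Good⇒AGroup gl , (λ h → D⇒∈ (D-∣ u∣l (∈⇒D h))) ,
        (λ eq → u≢l (∣-antisym u∣l (D-π l∣n (∈⇒D (subst (π u ∈_) (sym eq) (D⇒∈ (D-self u))))))) , quot
        where
        quot : ∀ H → IsQuotAGroup A ⟪ u ⟫ ⟪ l ⟫ H → H ≡ ⟪ l ⟫ ⊎ H ≡ ⟪ u ⟫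
        quot H (sub , L⊆H , H⊆U , blocks) with subgroup-generator sub
        ... | g , g∣n , H⇒D , D⇒H = decide (g ℕ.≟ l) (g ℕ.≟ u)
          where
          H≡ : ∀ {d} → g ≡ d → H ≡ ⟪ d ⟫
          H≡ refl = ⊆-antisym (λ h → D⇒∈ (H⇒D h)) (λ h → D⇒H (∈⇒D h))
          g∣l : g ∣ l
          g∣l = D-π g∣n (H⇒D (L⊆H (D⇒∈ (D-self l))))
          u∣g : u ∣ g
          u∣g = D-π (∣-trans u∣l l∣n) (∈⇒D (H⊆U (D⇒H (D-self g))))
          good : Good g
          -- An 𝒜-group of the section pulls back to one of G: `x` is a block element plus an
          -- element of L, `~-sum` splits `y` likewise, and the second summand stays in L because L
          -- is an 𝒜-group.
          good x y x~y dx with blocks x (D⇒H dx)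
          ... | x₀ , _ , (v , w , v~ , w∈ , x≡) , closed with ~-sum x~y (trans x≡ (∔-def v w))
          ... | v′ , w′ , v′~ , w′~ , y≡ = H⇒D (closed y (v′ , w′ , trans v′~ v~ , D⇒∈ (gl w w′ (sym w′~) (∈⇒D w∈)) , trans y≡ (sym (∔-def v′ w′))))
          decide : Dec (g ≡ l) → Dec (g ≡ u) → H ≡ ⟪ l ⟫ ⊎ H ≡ ⟪ u ⟫
          decide (yes g≡l) _ = inj₁ (H≡ g≡l)
          decide (no _) (yes g≡u) = inj₂ (H≡ g≡u)
          decide (no g≢l) (no g≢u) = ⊥-elim (none g u∣g g∣l g≢u g≢l good)

      abstract
        primitive-index : ∀ {u l} → u ∣ n → l ∣ n → IsPrimitiveSection A ⟪ u ⟫ ⟪ l ⟫ → ∃[ p ] (Prime p × u ℕ.* p ≡ l)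
        primitive-index {u} {l} u∣n l∣n prim with qd ⟪ u ⟫ ⟪ l ⟫ prim
        ... | p , pp , size = p , pp , ℕₚ.*-cancelʳ-≡ (u ℕ.* p) l ∣ ⟪ l ⟫ ∣ {{ℕ.≢-nonZero L≢0}}
                (trans (ℕₚ.*-assoc u p _) (trans (cong (u ℕ.*_) (sym size)) (trans (⟪⟫-size u∣n) (sym (⟪⟫-size l∣n)))))
          where
          L≢0 : ∣ ⟪ l ⟫ ∣ ≢ 0
          L≢0 eq = n≢0 (trans (sym (⟪⟫-size l∣n)) (trans (cong (l ℕ.*_) eq) (ℕₚ.*-zeroʳ l)))

    abstract
      -- Replace `l` by a smaller good index strictly above `u` as long as there is one. The section
      -- is then primitive, and quasidensity makes `l / u` prime.
      prime-step : ∀ {u} l → l ∣ n → u ∣ l → u ≢ l → Good u → Good l → ∃[ p ] (Prime p × u ℕ.* p ∣ l × Good (u ℕ.* p))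
      prime-step {u} = <-rec _ go
        where
        go : ∀ l → (∀ {d} → d < l → d ∣ n → u ∣ d → u ≢ d → Good u → Good d → ∃[ p ] (Prime p × u ℕ.* p ∣ d × Good (u ℕ.* p))) →
             l ∣ n → u ∣ l → u ≢ l → Good u → Good l → ∃[ p ] (Prime p × u ℕ.* p ∣ l × Good (u ℕ.* p))
        go l rec l∣n u∣l u≢l gu gl
          with ℕₚ.anyUpTo? (λ d → u ∣? d ×-dec d ∣? l ×-dec ¬? (u ℕ.≟ d) ×-dec Good? d) l
        ... | yes (d , d<l , u∣d , d∣l , u≢d , gd) = case rec d<l (∣-trans d∣l l∣n) u∣d u≢d gu gd of λ
                { (p , pp , up∣d , good) → p , pp , ∣-trans up∣d d∣l , good }
        ... | no none = case primitive-index (∣-trans u∣l l∣n) l∣n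
                  (maximal-primitive l∣n u∣l u≢l gu gl λ d u∣d d∣l d≢u d≢l gd →
                    none (d , ℕₚ.≤∧≢⇒< (∣⇒≤ {{ℕ.≢-nonZero (∣n⇒≢0 l∣n)}} d∣l) d≢l , u∣d , d∣l , d≢u ∘ sym , gd)) of λ
                { (p , pp , refl) → p , pp , ∣-refl , gl }

-- The basic set of 1 is a group of units.

module TrivialRadicals {m : ℕ} (A : SRing m) (qd : Quasidense A) (tr : TrivialRadical A) where
  open AGroups A public

  abstract
    radical-trivial : ∀ {r} → (∀ κ → κ ~ π 1 → κ ∔ r ~ π 1) → r ≡ π 0
    radical-trivial {r} h = trans (tr r (stab₁ , stab₂)) e-def
      where
      g~ : ∀ {x} → lab x ≡ lab gen → x ~ π 1
      g~ {x} = subst (x ~_) gen-def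
      ~g : ∀ {x} → x ~ π 1 → lab x ≡ lab gen
      ~g {x} = subst (x ~_) (sym gen-def)
      stab₁ : ∀ y → lab y ≡ lab gen → lab (r ⊕ y) ≡ lab gen
      stab₁ y hy = ~g (subst (_~ π 1) (trans (CR.+-comm y r) (sym (∔-def r y))) (h y (g~ hy)))
      iterate : ∀ k y → y ~ π 1 → y ∔ π k · r ~ π 1
      iterate zero y hy = subst (_~ π 1) (solve 2 (λ y r → y := y :+ con 0ℤ :* r) refl y r) hy
      iterate (suc k) y hy = subst (_~ π 1) (trans (solve 3 (λ y k r → y :+ r :+ k :* r := y :+ (:1 :+ k) :* r) refl y (π k) r)
        (cong (λ v → y ∔ v · r) (sym (π-+ 1 k)))) (iterate k (y ∔ r) (h y hy))
      stab₂ : ∀ y → lab y ≡ lab gen → ∃[ z ] (lab z ≡ lab gen × r ⊕ z ≡ y)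
      stab₂ y hy = z , ~g (iterate k y (g~ hy)) , trans (∔-def r z)
          (trans (cong (λ v → r ∔ (y ∔ v · r)) (π-toℕ (⊝ π 1))) (solve 2 (λ r y → r :+ (y :+ (:- :1) :* r) := y) refl r y))
        where
        -- `k` represents -1, so adding `r` to `y` `k` times gives the preimage y - r.
        k : ℕ
        k = toℕ (⊝ π 1)
        z : R
        z = y ∔ π k · r

  abstract
    -- As n/q is not in the radical, some `κ` in the block of 1 leaves it under translation by n/q,
    -- and `fibre` makes q divide the whole block of q κ. The subgroup generated by that block is
    -- proper, so `prime-step` yields a good prime p dividing q κ; p cannot divide `κ ~ 1`, hence p
    -- = q.
    Good-prime : ∀ {q} → Prime q → q ∣ n → Good q
    Good-prime {q} pq q∣n = decide (any? (λ κ → κ ~? π 1 ×-dec ¬? (κ ∔ π n′ ~? π 1)))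
      where
      n′ : ℕ
      n′ = (n / q) {{ℕ.≢-nonZero (prime≢0 pq)}}
      n≡ : n ≡ q ℕ.* n′
      n≡ = sym (m*[n/m]≡n {{ℕ.≢-nonZero (prime≢0 pq)}} q∣n)
      found : ∀ κ → κ ~ π 1 → ¬ κ ∔ π n′ ~ π 1 → Good q
      found κ κ~1 ≁ with block-generator (π q · κ)
      ... | g , g∣n , good , gD , maximal = step (prime-step qd g g∣n (1∣ g) (λ 1≡g → prime∤1 pq (subst (q ∣_) (sym 1≡g) q∣g)) Good-1 good)
        where
        same : π q · κ ≡ π q · (κ ∔ π n′)
        same = sym (trans (CR.distribˡ (π q) κ (π n′)) (trans (cong (π q · κ ∔_) (trans (sym (π-* q n′)) (trans (cong π (sym n≡)) π-n))) (CR.+-identityʳ _)))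
        q∣g : q ∣ g
        q∣g = maximal q∣n λ h → case fibre pq q∣n same (λ h′ → ≁ (trans h′ κ~1)) h of λ { (u , _ , refl) → D-·ʳ u (D-self q) }
        step : ∃[ p ] (Prime p × 1 ℕ.* p ∣ g × Good (1 ℕ.* p)) → Good q
        step (p , pp , 1p∣g , gp′) = conclude (D-prime pp p∣n (D-∣ p∣g (gD refl)))
          where
          p∣g : p ∣ g
          p∣g = subst (_∣ g) (ℕₚ.*-identityˡ p) 1p∣g
          p∣n : p ∣ n
          p∣n = ∣-trans p∣g g∣n
          gp : Good p
          gp = subst Good (ℕₚ.*-identityˡ p) gp′
          conclude : D p (π q) ⊎ D p κ → Good q
          conclude (inj₁ h) = subst Good (prime∣prime pp pq (D-π p∣n h)) gp
          conclude (inj₂ h) = ⊥-elim (¬D-1 pp p∣n (gp κ (π 1) κ~1 h))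
      decide : Dec (∃[ κ ] (κ ~ π 1 × ¬ κ ∔ π n′ ~ π 1)) → Good q
      decide (yes (κ , κ~1 , ≁)) = found κ κ~1 ≁
      decide (no none) = ⊥-elim (prime≢1 pq (ℕₚ.*-cancelʳ-≡ q 1 n′ {{ℕ.≢-nonZero n′≢0}}
          (trans (sym n≡) (trans (∣-antisym (D-π ∣-refl (subst (D n) (sym π≡0) D-0)) (*≡⇒∣ʳ q n′ n≡)) (sym (ℕₚ.*-identityˡ n′))))))
        where
        n′≢0 : n′ ≢ 0
        n′≢0 = ∣n⇒≢0 (*≡⇒∣ʳ q n′ n≡)
        π≡0 : π n′ ≡ π 0
        π≡0 = radical-trivial λ κ κ~1 → case κ ∔ π n′ ~? π 1 of λ { (yes h) → h ; (no h) → ⊥-elim (none (κ , κ~1 , h)) }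

  K : R → Set
  K κ = κ ~ π 1

  K-¬D : ∀ {κ q} → K κ → Prime q → q ∣ n → ¬ D q κ
  K-¬D {κ} k pq q∣n h = ¬D-1 pq q∣n (Good-prime pq q∣n κ (π 1) k h)

  K-unit : ∀ {κ} → K κ → Unit κ
  K-unit k = unit (λ q pq q∣n → K-¬D k pq q∣n)

  K-1 : K (π 1)
  K-1 = refl

  K-· : ∀ {κ μ} → K κ → K μ → K (κ · μ)
  K-· {κ} {μ} k l = trans (~-scale (K-unit k) l) (trans (cong lab (CR.*-identityʳ κ)) k)

  K-cancel : ∀ {κ μ} → K κ → K (κ · μ) → K μ
  K-cancel {κ} {μ} k l = ~-cancel (K-unit k) (trans l (trans (sym k) (cong lab (sym (CR.*-identityʳ κ)))))

  K-inverse : ∀ {κ} (k : K κ) → K (proj₁ (K-unit k))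
  K-inverse {κ} k = K-cancel k (cong lab (proj₂ (K-unit k)))

-- Elements of `K` congruent to 1 modulo the primes.

gcd≡1-∣ : ∀ {k a b} → gcd k a ≡ 1 → k ∣ a ℕ.* b → k ∣ b
gcd≡1-∣ {k} {a} {b} g≡1 h = coprime-divisor (gcd≡1⇒coprime g≡1) h

abstract
  odd : ∀ a → ¬ 2 ∣ a → ∃[ h ] a ≡ suc (h ℕ.+ h)
  odd zero 2∤a = ⊥-elim (2∤a (2 ∣0))
  odd (suc zero) _ = 0 , refl
  odd (suc (suc a)) 2∤a with odd a (λ { (divides c eq) → 2∤a (divides (suc c) (cong (λ v → suc (suc v)) eq)) })
  ... | h , eq = suc h , cong suc (trans (cong suc eq) (cong suc (sym (ℕₚ.+-suc h h))))

-- The descent: an element κ = 1 + r of K with r divisible by every prime divisor of n (and by 4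
-- when 4 divides n) is raised to prime powers until q · r = 0 for some prime q; then r² = 0 and r
-- stabilises the block K of 1.
module Descent {m : ℕ} (A : SRing m) (qd : Quasidense A) (tr : TrivialRadical A) where
  open TrivialRadicals A qd tr public

  -- These are the nilpotent residues, so adding 1 gives a unit.
  PrimeDivisible : R → Set
  PrimeDivisible x = ∀ q → Prime q → q ∣ n → D q x

  PrimeDivisible-unit : ∀ {x} → PrimeDivisible x → Unit (π 1 ∔ x)
  PrimeDivisible-unit {x} h = unit λ q pq q∣n d → ¬D-1 pq q∣n
    (subst (D q) (solve 1 (λ x → :1 :+ x :- x := :1) refl x) (D-⊟ d (h q pq q∣n)))

  abstract
    odd-element : ∀ x → ¬ D 2 x → ∃[ y ] x ≡ π 1 ∔ π 2 · y
    odd-element x h with odd (toℕ x) (λ d → h (toℕ-D d))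
    ... | k , eq = π k , trans (sym (π-toℕ x)) (trans (cong π eq) (trans (π-+ 1 (k ℕ.+ k)) (cong (π 1 ∔_)
            (trans (π-+ k k) (solve 1 (λ k → k :+ k := :2 :* k) refl (π k))))))

  private
    oddPower : R → ℕ → R
    oddPower x zero = x
    oddPower x (suc h) = x · (x · oddPower x h)

    K-oddPower : ∀ {κ} h → K κ → K (oddPower κ h)
    K-oddPower zero k = k
    K-oddPower (suc h) k = K-· k (K-· k (K-oddPower h k))

    abstract
      -- The binomial expansion up to third order with exponent q = 1 + 2h, where q(q - 1)/2 = h q.
      oddPower-expand : ∀ r h → ∃[ t ] oddPower (π 1 ∔ r) h ≡
        π 1 ∔ (π 1 ∔ π h ∔ π h) · r ∔ π h · (π 1 ∔ π h ∔ π h) · (r · r) ∔ r · r · r · t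
      oddPower-expand r zero = π 0 , solve 1 (λ r → :1 :+ r := :1 :+ (:1 :+ con 0ℤ :+ con 0ℤ) :* r
          :+ con 0ℤ :* (:1 :+ con 0ℤ :+ con 0ℤ) :* (r :* r) :+ r :* r :* r :* con 0ℤ) refl r
      oddPower-expand r (suc h) with oddPower-expand r h
      ... | t , eq = _ , trans (cong (λ v → (π 1 ∔ r) · ((π 1 ∔ r) · v)) eq) (trans
        (solve 3 (λ r H t → let q = :1 :+ H :+ H ; H′ = :1 :+ H ; q′ = :1 :+ H′ :+ H′ in
            (:1 :+ r) :* ((:1 :+ r) :* (:1 :+ q :* r :+ H :* q :* (r :* r) :+ r :* r :* r :* t)) :=
            :1 :+ q′ :* r :+ H′ :* q′ :* (r :* r) :+ r :* r :* r :* (t :+ H :* q :+ H :* q :+ q :+ r :* (t :+ t :+ H :* q) :+ r :* r :* t))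
          refl r (π h) t)
        (cong (λ H′ → π 1 ∔ (π 1 ∔ H′ ∔ H′) · r ∔ H′ · (π 1 ∔ H′ ∔ H′) · (r · r) ∔ r · r · r ·
            (t ∔ π h · (π 1 ∔ π h ∔ π h) ∔ π h · (π 1 ∔ π h ∔ π h) ∔ (π 1 ∔ π h ∔ π h) ∔ r · (t ∔ t ∔ π h · (π 1 ∔ π h ∔ π h)) ∔ r · r · t))
          (sym (π-+ 1 h))))

    abstract
      -- The linear and quadratic coefficients of the `q`-th power contain `q`, and the cubic term
      -- acquires it from one of its factors `r`; so `q · r` splits off from all terms.
      lift-odd : ∀ {q r} h → q ≡ suc (h ℕ.+ h) → q ∣ n → Prime q → PrimeDivisible r → K (π 1 ∔ r) →
        ∃[ ρ ] (PrimeDivisible ρ × K (π 1 ∔ π q · r · (π 1 ∔ ρ)))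
      lift-odd {q} {r} h q≡ q∣n pq pd k with oddPower-expand r h | pd q pq q∣n
      ... | t , eq | s , r≡qs = r · (π h ∔ s · t) , (λ p pp p∣n → D-·ʳ _ (pd p pp p∣n)) ,
        subst K (trans eq (begin
          π 1 ∔ q′ · r ∔ π h · q′ · (r · r) ∔ r · r · r · t
            ≡⟨ cong (λ v → π 1 ∔ q′ · r ∔ π h · q′ · (r · r) ∔ r · r · v · t) (trans r≡qs (cong (_· s) qq)) ⟩
          π 1 ∔ q′ · r ∔ π h · q′ · (r · r) ∔ r · r · (q′ · s) · t
            ≡⟨ solve 5 (λ q r h s t → :1 :+ q :* r :+ h :* q :* (r :* r) :+ r :* r :* (q :* s) :* t :=
                 :1 :+ q :* r :* (:1 :+ r :* (h :+ s :* t))) refl q′ r (π h) s t ⟩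
          π 1 ∔ q′ · r · (π 1 ∔ r · (π h ∔ s · t))
            ≡⟨ cong (λ v → π 1 ∔ v · r · (π 1 ∔ r · (π h ∔ s · t))) (sym qq) ⟩
          π 1 ∔ π q · r · (π 1 ∔ r · (π h ∔ s · t)) ∎)) (K-oddPower h k)
        where
        open ≡-Reasoning
        q′ : R
        q′ = π 1 ∔ π h ∔ π h
        qq : π q ≡ q′
        qq = trans (cong π q≡) (trans (π-+ 1 (h ℕ.+ h)) (trans (cong (π 1 ∔_) (π-+ h h)) (sym (CR.+-assoc _ _ _))))

    abstract
      -- With r = 4t the square is 1 + 2r(1 + 2t). Divisibility of `r` by 2 alone would not make the
      -- last factor a unit.
      lift-2 : ∀ {r} → PrimeDivisible r → D 4 r → K (π 1 ∔ r) →
        ∃[ ρ ] (PrimeDivisible ρ × K (π 1 ∔ π 2 · r · (π 1 ∔ ρ)))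
      lift-2 {r} pd (t , r≡4t) k = π 2 · t , divisible , subst K (trans (cong (λ v → (π 1 ∔ v) · (π 1 ∔ v)) r≡4t)
        (trans (solve 1 (λ t → let r = :4 :* t in (:1 :+ r) :* (:1 :+ r) := :1 :+ :2 :* r :* (:1 :+ :2 :* t)) refl t)
          (cong (λ v → π 1 ∔ π 2 · v · (π 1 ∔ π 2 · t)) (sym r≡4t)))) (K-· k k)
        where
        divisible : PrimeDivisible (π 2 · t)
        divisible p pp p∣n = case D-prime {p} {π 2} {π 2 · t} pp p∣n (subst (D p)
          (trans r≡4t (solve 1 (λ t → :4 :* t := :2 :* (:2 :* t)) refl t)) (pd p pp p∣n)) of
          λ { (inj₁ d) → D-·ʳ t d ; (inj₂ d) → d }

    -- If 2 but not 4 divides n, then 2s = 2(s + n/2), and s or s + n/2 is even.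
    D-4 : ∀ {r} → 2 ∣ n → D 2 r → (4 ∣ n → D 4 r) → D 4 r
    D-4 {r} (divides n′ n≡) (s , r≡2s) h with 4 ∣? n | D? 2 s
    ... | yes 4∣n | _ = h 4∣n
    ... | no _ | yes (t , s≡) = t , trans r≡2s (trans (cong (π 2 ·_) s≡) (solve 1 (λ t → :2 :* (:2 :* t) := :4 :* t) refl t))
    ... | no 4∤n | no s-odd with odd-element s s-odd | odd n′ (λ { (divides c n′≡) → 4∤n (divides c (trans n≡ (trans (cong (ℕ._* 2) n′≡) (ℕₚ.*-assoc c 2 2)))) })
    ... | y , s≡ | h′ , n′≡ = π 1 ∔ y ∔ π h′ , (begin
      r                                                    ≡⟨ r≡2s ⟩
      π 2 · s                                              ≡⟨ CR.+-identityʳ _ ⟨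
      π 2 · s ∔ π 0                                        ≡⟨ cong (π 2 · s ∔_) (trans (sym π-n) (trans (cong π n≡) (π-* n′ 2))) ⟩
      π 2 · s ∔ π n′ · π 2                                 ≡⟨ cong₂ (λ u v → π 2 · u ∔ v · π 2) s≡ n′≡′ ⟩
      π 2 · (π 1 ∔ π 2 · y) ∔ (π 1 ∔ (π h′ ∔ π h′)) · π 2  ≡⟨ solve 2 (λ y h → :2 :* (:1 :+ :2 :* y) :+ (:1 :+ (h :+ h)) :* :2
                                                                 := :4 :* (:1 :+ y :+ h)) refl y (π h′) ⟩
      π 4 · (π 1 ∔ y ∔ π h′)                               ∎)
      where
      open ≡-Reasoning
      n′≡′ : π n′ ≡ π 1 ∔ (π h′ ∔ π h′)
      n′≡′ = trans (cong π n′≡) (trans (π-+ 1 (h′ ℕ.+ h′)) (cong (π 1 ∔_) (π-+ h′ h′)))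

    abstract
      lift : ∀ {q r} → Prime q → q ∣ n → PrimeDivisible r → (4 ∣ n → D 4 r) → K (π 1 ∔ r) →
        ∃[ ρ ] (PrimeDivisible ρ × K (π 1 ∔ π q · r · (π 1 ∔ ρ)))
      lift {q} pq q∣n pd d4 k with q ℕ.≟ 2
      ... | yes refl = lift-2 pd (D-4 q∣n (pd 2 pq q∣n) d4) k
      ... | no q≢2 with odd q (λ 2∣q → q≢2 (sym (prime∣prime prime[2] pq 2∣q)))
      ... | h , q≡ = lift-odd h q≡ q∣n pq pd k

    -- The powers of 1 + r are the 1 + j r. With j representing the inverse of `κ`, multiplication
    -- by `κ` gives κ + r, so `r` translates `K` into itself.
    square-zero : ∀ {r} → r · r ≡ π 0 → K (π 1 ∔ r) → r ≡ π 0
    square-zero {r} r²≡0 k = radical-trivial λ κ kκ → subst (_~ π 1) (final κ kκ) (K-· kκ (multiples (toℕ (proj₁ (K-unit kκ)))))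
      where
      multiples : ∀ j → K (π 1 ∔ π j · r)
      multiples zero = cong lab (solve 1 (λ r → :1 :+ con 0ℤ :* r := :1) refl r)
      multiples (suc j) = subst K (begin
        (π 1 ∔ r) · (π 1 ∔ π j · r)             ≡⟨ solve 2 (λ r j → (:1 :+ r) :* (:1 :+ j :* r) := :1 :+ (:1 :+ j) :* r :+ j :* (r :* r)) refl r (π j) ⟩
        π 1 ∔ (π 1 ∔ π j) · r ∔ π j · (r · r)   ≡⟨ cong₂ (λ u v → π 1 ∔ u · r ∔ π j · v) (sym (π-+ 1 j)) r²≡0 ⟩
        π 1 ∔ π (suc j) · r ∔ π j · π 0         ≡⟨ solve 2 (λ u j → u :+ j :* con 0ℤ := u) refl _ (π j) ⟩
        π 1 ∔ π (suc j) · r                     ∎) (K-· k (multiples j))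
        where open ≡-Reasoning
      final : ∀ κ (kκ : K κ) → κ · (π 1 ∔ π (toℕ (proj₁ (K-unit kκ))) · r) ≡ κ ∔ r
      final κ kκ = trans (solve 3 (λ κ j r → κ :* (:1 :+ j :* r) := κ :+ κ :* j :* r) refl κ _ r)
        (cong (κ ∔_) (trans (cong (λ v → κ · v · r) (π-toℕ _)) (trans (cong (_· r) (proj₂ (K-unit kκ))) (CR.*-identityˡ r))))

    -- Induction on an annihilator `N` of `r`. If q · r is nonzero for a prime q dividing `N`, then
    -- `lift` gives an element with annihilator N/q; it vanishes by induction, and cancelling the
    -- unit 1 + ρ contradicts q · r being nonzero.
    descend : ∀ N → ∀ {r} → N ∣ n → π N · r ≡ π 0 → PrimeDivisible r → (4 ∣ n → D 4 r) → K (π 1 ∔ r) → r ≡ π 0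
    descend = <-rec _ go
      where
      go : ∀ N → (∀ {j} → j < N → ∀ {r} → j ∣ n → π j · r ≡ π 0 → PrimeDivisible r → (4 ∣ n → D 4 r) → K (π 1 ∔ r) → r ≡ π 0) →
           ∀ {r} → N ∣ n → π N · r ≡ π 0 → PrimeDivisible r → (4 ∣ n → D 4 r) → K (π 1 ∔ r) → r ≡ π 0
      go N rec {r} N∣n Nr≡0 pd d4 k with N ℕ.≟ 1
      ... | yes refl = trans (sym (CR.*-identityˡ r)) Nr≡0
      ... | no N≢1 with prime-divisor N (∣n⇒≢0 N∣n) N≢1
      ... | q , pq , divides j N≡jq = by-cases (π q · r ≟F π 0)
        where
        j≢0 : j ≢ 0
        j≢0 refl = ∣n⇒≢0 N∣n N≡jq
        j<N : j < N
        j<N = subst (j <_) (sym N≡jq) (ℕₚ.m<m*n j q {{ℕ.≢-nonZero j≢0}} (prime>1 pq))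
        q∣n : q ∣ n
        q∣n = ∣-trans (divides j N≡jq) N∣n
        by-cases : Dec (π q · r ≡ π 0) → r ≡ π 0
        by-cases (yes qr≡0) = square-zero r²≡0 k
          where
          r²≡0 : r · r ≡ π 0
          r²≡0 = case pd q pq q∣n of λ { (s , r≡) → trans (cong (_· r) r≡) (trans
            (solve 3 (λ q s r → q :* s :* r := s :* (q :* r)) refl (π q) s r) (trans (cong (s ·_) qr≡0) (CR.zeroʳ s))) }
        by-cases (no qr≢0) = case lift pq q∣n pd d4 k of λ
          { (ρ , pdρ , k′) → ⊥-elim (qr≢0 (unit-cancel (PrimeDivisible-unit pdρ) (trans (CR.*-comm _ _) (trans
              (rec j<N (∣-trans (*≡⇒∣ˡ j q N≡jq) N∣n) (j-kills ρ) (λ p pp p∣n → D-·ʳ _ (D-·ˡ _ (pd p pp p∣n)))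
                (λ 4∣n → D-·ʳ _ (D-·ˡ _ (d4 4∣n))) k′)
              (sym (CR.zeroʳ (π 1 ∔ ρ))))))) }
          where
          j-kills : ∀ ρ → π j · (π q · r · (π 1 ∔ ρ)) ≡ π 0
          j-kills ρ = trans (solve 4 (λ j q r s → j :* (q :* r :* s) := j :* q :* r :* s) refl (π j) (π q) r (π 1 ∔ ρ))
            (trans (cong (λ v → v · r · (π 1 ∔ ρ)) (trans (sym (π-* j q)) (cong π (sym N≡jq)))) (trans (cong (_· (π 1 ∔ ρ)) Nr≡0) (CR.zeroˡ _)))

  abstract
    K-trivial : ∀ {κ} → K κ → PrimeDivisible (κ ⊟ π 1) → (4 ∣ n → D 4 (κ ⊟ π 1)) → κ ≡ π 1
    K-trivial {κ} k pd d4 = trans (solve 1 (λ κ → κ := κ :- :1 :+ :1) refl κ)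
      (trans (cong (_∔ π 1) (descend n ∣-refl (trans (cong (_· (κ ⊟ π 1)) π-n) (CR.zeroˡ _)) pd d4
        (subst K (solve 1 (λ κ → κ := :1 :+ (κ :- :1)) refl κ) k))) (CR.+-identityˡ _))

-- A free involution halves a sum: of u and σ u keep the one with the smaller key h. With the key
-- min(u, β u), the half kept for α is still invariant under β.
module FreeInvolutions (m : ℕ) where
  open Sums m

  private
    module Halve (f : R → ℤ) (σ : R → R) (σσ : ∀ u → σ (σ u) ≡ u) (fσ : ∀ u → f (σ u) ≡ f u)
                 (h : R → ℕ) (free : ∀ u → f u ≢ 0ℤ → h u ≢ h (σ u)) where
      low : R → ℤ
      low u = f u * 𝟙 (h u ℕ.<? h (σ u))

      split : ∀ u → f u ≡ low u + low (σ u)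
      split u = by-cases (f u ℤ.≟ 0ℤ) (h u ℕ.<? h (σ u)) (h (σ u) ℕ.<? h (σ (σ u)))
        where
        by-cases : Dec (f u ≡ 0ℤ) → (d : Dec (h u < h (σ u))) (d′ : Dec (h (σ u) < h (σ (σ u)))) →
                   f u ≡ f u * 𝟙 d + f (σ u) * 𝟙 d′
        by-cases (yes f≡0) d d′ = trans f≡0 (sym (trans (cong₂ (λ a b → a * 𝟙 d + b * 𝟙 d′) f≡0 (trans (fσ u) f≡0))
          (solveℤ 2 (λ a b → conℤ 0ℤ ⟨*⟩ a ⟨+⟩ conℤ 0ℤ ⟨*⟩ b ⟨=⟩ conℤ 0ℤ) refl (𝟙 d) (𝟙 d′))))
        by-cases (no f≢0) (yes p) (yes p′) = ⊥-elim (ℕₚ.<-asym p (subst (λ v → h (σ u) < h v) (σσ u) p′))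
        by-cases (no f≢0) (yes p) (no _) = solveℤ 2 (λ a b → a ⟨=⟩ a ⟨*⟩ conℤ 1ℤ ⟨+⟩ b ⟨*⟩ conℤ 0ℤ) refl (f u) (f (σ u))
        by-cases (no f≢0) (no _) (yes _) = trans (sym (fσ u)) (solveℤ 2 (λ a b → b ⟨=⟩ a ⟨*⟩ conℤ 0ℤ ⟨+⟩ b ⟨*⟩ conℤ 1ℤ) refl (f u) (f (σ u)))
        by-cases (no f≢0) (no p) (no p′) = ⊥-elim (p′ (subst (λ v → h (σ u) < h v) (sym (σσ u)) (ℕₚ.≤∧≢⇒< (ℕₚ.≮⇒≥ p) (free u f≢0 ∘ sym))))

      halve : ∑ f ≡ ℤ.+ 2 * ∑ low
      halve = trans (∑-cong split) (trans (∑-+ low (low ∘ σ)) (trans (cong (∑ low +_) (sym (∑-bij σ σ σσ σσ low)))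
        (solveℤ 1 (λ a → a ⟨+⟩ a ⟨=⟩ conℤ (ℤ.+ 2) ⟨*⟩ a) refl (∑ low))))

  module _ (f : R → ℤ) (α β : R → R) (αα : ∀ u → α (α u) ≡ u) (ββ : ∀ u → β (β u) ≡ u) (αβ : ∀ u → α (β u) ≡ β (α u))
           (fα : ∀ u → f (α u) ≡ f u) (fβ : ∀ u → f (β u) ≡ f u)
           (free-α : ∀ u → f u ≢ 0ℤ → u ≢ α u) (free-β : ∀ u → f u ≢ 0ℤ → u ≢ β u)
           (free-αβ : ∀ u → f u ≢ 0ℤ → u ≢ α (β u)) where
    private
      h : R → ℕ
      h u = toℕ u ℕ.⊓ toℕ (β u)

      h-β : ∀ u → h (β u) ≡ h u
      h-β u = trans (cong (λ v → toℕ (β u) ℕ.⊓ toℕ v) (ββ u)) (ℕₚ.⊓-comm (toℕ (β u)) (toℕ u))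

      -- Equal keys force α u to be u or β u; these cases contradict `free-α` and `free-αβ`.
      h-free : ∀ u → f u ≢ 0ℤ → h u ≢ h (α u)
      h-free u f≢0 eq with ℕₚ.⊓-sel (toℕ u) (toℕ (β u)) | ℕₚ.⊓-sel (toℕ (α u)) (toℕ (β (α u)))
      ... | inj₁ p | inj₁ q = free-α u f≢0 (toℕ-injective (trans (sym p) (trans eq q)))
      ... | inj₁ p | inj₂ q = free-αβ u f≢0 (trans (toℕ-injective (trans (sym p) (trans eq q))) (sym (αβ u)))
      ... | inj₂ p | inj₁ q = free-αβ u f≢0 (trans (sym (ββ u)) (trans (cong β (toℕ-injective (trans (sym p) (trans eq q)))) (sym (αβ u))))
      ... | inj₂ p | inj₂ q = free-α u f≢0 (trans (sym (ββ u)) (trans (cong β (toℕ-injective (trans (sym p) (trans eq q)))) (ββ (α u))))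

      module First = Halve f α αα fα h h-free

      low-β : ∀ u → First.low (β u) ≡ First.low u
      low-β u = cong₂ _*_ (fβ u) (𝟙-⇔ (h (β u) ℕ.<? h (α (β u))) (h u ℕ.<? h (α u))
        (subst₂ _<_ (h-β u) h-αβ) (subst₂ _<_ (sym (h-β u)) (sym h-αβ)))
        where
        h-αβ : h (α (β u)) ≡ h (α u)
        h-αβ = trans (cong h (αβ u)) (h-β (α u))

      low-free : ∀ u → First.low u ≢ 0ℤ → toℕ u ≢ toℕ (β u)
      low-free u low≢0 eq = free-β u (λ f≡0 → low≢0 (trans (cong (_* 𝟙 (h u ℕ.<? h (α u))) f≡0) (ℤR.zeroˡ _))) (toℕ-injective eq)

      module Second = Halve First.low β ββ low-β toℕ low-free

    abstract
      ∑-free : ∑ f ≡ ℤ.+ 4 * ∑ Second.low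
      ∑-free = trans First.halve (trans (cong (ℤ.+ 2 *_) Second.halve)
        (solveℤ 1 (λ a → conℤ (ℤ.+ 2) ⟨*⟩ (conℤ (ℤ.+ 2) ⟨*⟩ a) ⟨=⟩ conℤ (ℤ.+ 4) ⟨*⟩ a) refl (∑ Second.low)))

-- The exceptional configuration at the prime 2.

module TwoPart {m : ℕ} (A : SRing m) (qd : Quasidense A) (tr : TrivialRadical A) where
  open Descent A qd tr public

  abstract
    D-coprime-cancel : ∀ {b c x} → gcd c b ≡ 1 → D b (π c · x) → D b x
    D-coprime-cancel {b} {c} {x} g≡1 h = case bezout₁ {c} {b} g≡1 of λ { (s , t , eq) →
      subst (D b) (trans (solve 5 (λ s c t b x → s :* (c :* x) :+ b :* (t :* x) := (s :* c :+ t :* b) :* x) refl s (π c) t (π b) x)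
        (trans (cong (_· x) (sym eq)) (CR.*-identityˡ x))) (D-∔ (D-·ˡ s h) (D-·ʳ (t · x) (D-self b))) }

    D-power-cancel : ∀ {q k x y} → Prime q → q ∣ n → q ℕ.^ k ∣ n → ¬ D q y → D (q ℕ.^ k) (y · x) → D (q ℕ.^ k) x
    D-power-cancel {q} {k} {x} {y} pq q∣n qk∣n ¬d h = toℕ-D (gcd≡1-∣ {q ℕ.^ k} {toℕ y} {toℕ x}
      (gcd-prime-power pq (λ q∣y → ¬d (toℕ-D q∣y)) k)
      (D-π qk∣n (subst (D (q ℕ.^ k)) (trans (cong₂ _·_ (sym (π-toℕ y)) (sym (π-toℕ x))) (sym (π-* (toℕ y) (toℕ x)))) h)))

    odd-mod4 : ∀ x → ¬ D 2 x → D 4 (x ⊟ π 1) ⊎ D 4 (x ∔ π 1)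
    odd-mod4 x h = case odd-element x h of λ { (y , eq) → case D? 2 y of λ
      { (yes (t , y≡)) → inj₁ (t , trans (cong (_⊟ π 1) (trans eq (cong (λ v → π 1 ∔ π 2 · v) y≡)))
          (solve 1 (λ t → :1 :+ :2 :* (:2 :* t) :- :1 := :4 :* t) refl t))
      ; (no y-odd) → case odd-element y y-odd of λ { (t , y≡) → inj₂ (π 1 ∔ t , trans (cong (_∔ π 1) (trans eq (cong (λ v → π 1 ∔ π 2 · v) y≡)))
          (solve 1 (λ t → :1 :+ :2 :* (:1 :+ :2 :* t) :+ :1 := :4 :* (:1 :+ t)) refl t)) } } }

  -- The only obstruction to reaching the 2-part of n by the orbit argument: K contains k₀ with
  -- k₀ ≡ 1 modulo b and k₀ ≡ 3 modulo 4, hence k₀² = 1.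
  module Exceptional {j b : ℕ} (n≡ : n ≡ 2 ℕ.^ (3 ℕ.+ j) ℕ.* b) (2∤b : ¬ 2 ∣ b) {k₀ : R} (K-k₀ : K k₀)
                     (k₀≡ : D b (k₀ ⊟ π 1)) (k₀≡3 : D 4 (k₀ ∔ π 1)) where
    a : ℕ
    a = 3 ℕ.+ j

    half : ℕ
    half = 2 ℕ.^ (2 ℕ.+ j) ℕ.* b

    n≡2half : n ≡ 2 ℕ.* half
    n≡2half = trans n≡ (ℕₚ.*-assoc 2 (2 ℕ.^ (2 ℕ.+ j)) b)

    b∣n : b ∣ n
    b∣n = *≡⇒∣ʳ (2 ℕ.^ a) b n≡
    2a∣n : 2 ℕ.^ a ∣ n
    2a∣n = *≡⇒∣ˡ (2 ℕ.^ a) b n≡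
    half∣n : half ∣ n
    half∣n = *≡⇒∣ʳ 2 half n≡2half
    4∣half : 4 ∣ half
    4∣half = divides (2 ℕ.^ j ℕ.* b) (trans (cong (ℕ._* b) (trans (sym (ℕₚ.*-assoc 2 2 (2 ℕ.^ j))) (ℕₚ.*-comm 4 (2 ℕ.^ j))))
      (trans (ℕₚ.*-assoc (2 ℕ.^ j) 4 b) (trans (cong (2 ℕ.^ j ℕ.*_) (ℕₚ.*-comm 4 b)) (sym (ℕₚ.*-assoc (2 ℕ.^ j) b 4)))))
    4∣n : 4 ∣ n
    4∣n = ∣-trans 4∣half half∣n
    2∣4 : 2 ∣ 4
    2∣4 = divides 2 refl
    2∣n : 2 ∣ n
    2∣n = ∣-trans 2∣4 4∣n
    b∣half : b ∣ half
    b∣half = n∣m*n (2 ℕ.^ (2 ℕ.+ j))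
    gcd-2-b : gcd 2 b ≡ 1
    gcd-2-b = gcd-prime-power prime[2] 2∤b 1

    N : R
    N = π half

    2N≡0 : π 2 · N ≡ π 0
    2N≡0 = trans (sym (π-* 2 half)) (trans (cong π (sym n≡2half)) π-n)

    N≢0 : N ≢ π 0
    N≢0 eq = ℕₚ.<⇒≱ (subst (half <_) (trans (ℕₚ.*-comm half 2) (sym n≡2half)) (ℕₚ.m<m*n half 2 {{ℕ.≢-nonZero (∣n⇒≢0 half∣n)}} (s≤s (s≤s z≤n))))
      (∣⇒≤ {{ℕ.≢-nonZero (∣n⇒≢0 half∣n)}} (D-π ∣-refl (subst (D n) (sym eq) D-0)))

    odd-N : ∀ {x} → ¬ D 2 x → x · N ≡ N
    odd-N {x} h = case odd-element x h of λ { (y , eq) → trans (cong (_· N) eq)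
      (trans (solve 2 (λ y N → (:1 :+ :2 :* y) :* N := N :+ y :* (:2 :* N)) refl y N)
        (trans (cong (λ v → N ∔ y · v) 2N≡0) (solve 2 (λ N y → N :+ y :* con 0ℤ := N) refl N y))) }

    D-half : ∀ {x} → D half x → x ≡ π 0 ⊎ x ≡ N
    D-half {x} (y , eq) = case D? 2 y of λ
      { (yes (t , y≡)) → inj₁ (trans eq (trans (cong (N ·_) y≡) (trans (solve 2 (λ N t → N :* (:2 :* t) := :2 :* N :* t) refl N t)
          (trans (cong (_· t) 2N≡0) (CR.zeroˡ t)))))
      ; (no y-odd) → inj₂ (trans eq (trans (CR.*-comm N y) (odd-N y-odd))) }

    prime-divides : ∀ {x} → D b x → D 2 x → PrimeDivisible x
    prime-divides db d2 p pp p∣n = case euclidsLemma (2 ℕ.^ a) b pp (subst (p ∣_) n≡ p∣n) of λ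
      { (inj₁ p∣2a) → subst (λ v → D v _) (sym (prime∣prime pp prime[2] (prime∣^ pp a p∣2a))) d2
      ; (inj₂ p∣b) → D-∣ p∣b db }

    K-one : ∀ {κ} → K κ → D b (κ ⊟ π 1) → D 4 (κ ⊟ π 1) → κ ≡ π 1
    K-one k db d4 = K-trivial k (prime-divides db (D-∣ 2∣4 d4)) (λ _ → d4)

    k₀²≡1 : k₀ · k₀ ≡ π 1
    k₀²≡1 = K-one (K-· K-k₀ K-k₀)
      (subst (D b) (solve 1 (λ k → (k :- :1) :* (k :+ :1) := k :* k :- :1) refl k₀) (D-·ʳ (k₀ ∔ π 1) k₀≡))
      (subst (D 4) (solve 1 (λ k → (k :- :1) :* (k :+ :1) := k :* k :- :1) refl k₀) (D-·ˡ (k₀ ⊟ π 1) k₀≡3))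

    K-b : ∀ {κ} → K κ → D b (κ ⊟ π 1) → κ ≡ π 1 ⊎ κ ≡ k₀
    K-b {κ} k db = case odd-mod4 κ (K-¬D k prime[2] 2∣n) of λ
      { (inj₁ d4) → inj₁ (K-one k db d4)
      ; (inj₂ d4) → inj₂ (begin
          κ              ≡⟨ CR.*-identityʳ κ ⟨
          κ · π 1        ≡⟨ cong (κ ·_) k₀²≡1 ⟨
          κ · (k₀ · k₀)  ≡⟨ CR.*-assoc κ k₀ k₀ ⟨
          κ · k₀ · k₀    ≡⟨ cong (_· k₀) (K-one (K-· k K-k₀)
            (subst (D b) (solve 2 (λ κ k → (κ :- :1) :* k :+ (k :- :1) := κ :* k :- :1) refl κ k₀) (D-∔ (D-·ʳ k₀ db) k₀≡))
            (subst (D 4) (solve 2 (λ κ k → (κ :+ :1) :* k :- (k :+ :1) := κ :* k :- :1) refl κ k₀) (D-⊟ (D-·ʳ k₀ d4) k₀≡3))) ⟩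
          π 1 · k₀       ≡⟨ CR.*-identityˡ k₀ ⟩
          k₀             ∎) }
      where open ≡-Reasoning

    -- The numbers of representations of `w` and `w′` as sums of two elements of `K` are compared
    -- modulo 4. Both points are fixed by `k₀` and divisible by 4; for `w′` the latter needs 4 to
    -- divide `half`, hence an exponent of at least 3.
    w w′ : R
    w = π 1 ∔ k₀
    w′ = w ∔ N

    k₀w : k₀ · w ≡ w
    k₀w = trans (solve 1 (λ k → k :* (:1 :+ k) := k :* k :+ k) refl k₀) (cong (_∔ k₀) k₀²≡1)

    k₀w′ : k₀ · w′ ≡ w′
    k₀w′ = trans (CR.distribˡ k₀ w N) (cong₂ _∔_ k₀w (odd-N (K-¬D K-k₀ prime[2] 2∣n)))

    D4-w : D 4 w
    D4-w = subst (D 4) (CR.+-comm k₀ (π 1)) k₀≡3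

    D4-w′ : D 4 w′
    D4-w′ = D-∔ D4-w (π-D 4∣half)

    -- Modulo `b` the residue `w` is 2, which is invertible there; so `u` is 1 modulo `b` and `K-b`
    -- applies.
    stabilise : ∀ {u} → K u → D b (u · w ⊟ w) → (u ≡ π 1 ⊎ u ≡ k₀) × u · w ≡ w
    stabilise {u} k h = cases , fixed cases
      where
      cases : u ≡ π 1 ⊎ u ≡ k₀
      cases = K-b k (D-coprime-cancel gcd-2-b (subst (D b)
        (solve 2 (λ u k → u :* (:1 :+ k) :- (:1 :+ k) :- (u :- :1) :* (k :- :1) := :2 :* (u :- :1)) refl u k₀)
        (D-⊟ h (D-·ˡ (u ⊟ π 1) k₀≡))))
      fixed : u ≡ π 1 ⊎ u ≡ k₀ → u · w ≡ w
      fixed (inj₁ refl) = CR.*-identityˡ w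
      fixed (inj₂ refl) = k₀w

    k₀≢1 : k₀ ≢ π 1
    k₀≢1 eq = case D-π {4} {2} 4∣n (subst (D 4) (trans (cong (_∔ π 1) eq) (sym (π-+ 1 1))) k₀≡3) of λ { (divides zero ()) ; (divides (suc _) ()) }

    K-even : ∀ {u z} → K u → D 4 z → u ≢ z ⊟ u
    K-even {u} {z} k d4 eq = K-¬D k prime[2] 2∣n (D-cancel {2} {2} 4∣n (subst (D 4)
      (trans (solve 2 (λ z u → z := z :- u :+ u) refl z u) (trans (cong (_∔ u) (sym eq)) (solve 1 (λ u → u :+ u := :2 :* u) refl u))) d4))

    K-k₀-free : ∀ {u} → K u → u ≢ k₀ · u
    K-k₀-free {u} k eq = k₀≢1 (sym (unit-cancel (K-unit k) (trans (CR.*-identityʳ u) (trans eq (CR.*-comm k₀ u)))))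

    pairs : R → R → ℤ
    pairs z u = 𝟙 (u ~? π 1) * 𝟙 (z ⊟ u ~? π 1)

    pairs-support : ∀ {z u} → pairs z u ≢ 0ℤ → K u × K (z ⊟ u)
    pairs-support {z} {u} h = case 𝟙*≢0 (u ~? π 1) h of λ { (k , h′) → k , 𝟙≢0 (z ⊟ u ~? π 1) h′ }

    pairs-one : ∀ {z u} → K u → K (z ⊟ u) → pairs z u ≡ 1ℤ
    pairs-one {z} {u} k k′ = trans (cong₂ _*_ (𝟙-yes (u ~? π 1) k) (𝟙-yes (z ⊟ u ~? π 1) k′)) (ℤR.*-identityˡ 1ℤ)

    reflect : ∀ z u → z ⊟ (z ⊟ u) ≡ u
    reflect = solve 2 (λ z u → z :- (z :- u) := u) refl

    pairs-reflect : ∀ z u → pairs z (z ⊟ u) ≡ pairs z u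
    pairs-reflect z u = trans (cong (λ v → 𝟙 (z ⊟ u ~? π 1) * 𝟙 (v ~? π 1)) (reflect z u)) (ℤR.*-comm _ _)

    k₀-involutive : ∀ u → k₀ · (k₀ · u) ≡ u
    k₀-involutive u = trans (sym (CR.*-assoc k₀ k₀ u)) (trans (cong (_· u) k₀²≡1) (CR.*-identityˡ u))

    k₀-reflect : ∀ {z} → k₀ · z ≡ z → ∀ u → z ⊟ k₀ · u ≡ k₀ · (z ⊟ u)
    k₀-reflect {z} k₀z u = trans (cong (_⊟ k₀ · u) (sym k₀z)) (solve 3 (λ k z u → k :* z :- k :* u := k :* (z :- u)) refl k₀ z u)

    pairs-k₀ : ∀ {z} → k₀ · z ≡ z → ∀ u → pairs z (k₀ · u) ≡ pairs z u
    pairs-k₀ {z} k₀z u = cong₂ _*_ (scale u) (trans (cong (λ v → 𝟙 (v ~? π 1)) (k₀-reflect k₀z u)) (scale (z ⊟ u)))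
      where
      scale : ∀ v → 𝟙 (k₀ · v ~? π 1) ≡ 𝟙 (v ~? π 1)
      scale v = 𝟙-⇔ (k₀ · v ~? π 1) (v ~? π 1) (K-cancel K-k₀) (K-· K-k₀)

    reflect-k₀ : ∀ {z u} → u ≡ z ⊟ k₀ · u → u · w ≡ z
    reflect-k₀ {z} {u} eq = trans (solve 2 (λ u k → u :* (:1 :+ k) := u :+ k :* u) refl u k₀)
      (trans (cong (_∔ k₀ · u) eq) (∔-⊟ z (k₀ · u)))

    -- Reflection in `w′` has no fixed point in `K` by parity, and multiplication by `k₀` has none
    -- because `k₀` is not 1. A fixed point `u` of the composite satisfies `u · w ≡ w′`, which
    -- agrees with `w` modulo `b`, so `stabilise` would give w = w′.
    count-w′ : ∃[ c ] ∑ (pairs w′) ≡ ℤ.+ 4 * c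
    count-w′ = _ , FreeInvolutions.∑-free m (pairs w′) (w′ ⊟_) (k₀ ·_) (reflect w′) k₀-involutive (k₀-reflect k₀w′)
      (pairs-reflect w′) (pairs-k₀ k₀w′)
      (λ u h → K-even (proj₁ (pairs-support h)) D4-w′) (λ u h → K-k₀-free (proj₁ (pairs-support h))) λ u h eq →
        let uw = reflect-k₀ eq
            fixed = proj₂ (stabilise (proj₁ (pairs-support h)) (subst (D b)
              (trans (solve 2 (λ w N → N := w :+ N :- w) refl w N) (cong (_⊟ w) (sym uw))) (π-D b∣half)))
        in N≢0 (trans (solve 2 (λ w N → N := w :+ N :- w) refl w N) (trans (cong (_⊟ w) (trans (sym uw) fixed)) (CR.-‿inverseʳ w)))

    reduced : R → ℤ
    reduced u = pairs w u * (𝟙 (¬? (u ≟F π 1)) * 𝟙 (¬? (u ≟F k₀)))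

    swap : (σ : R → R) → (∀ u → σ (σ u) ≡ u) → σ (π 1) ≡ k₀ → ∀ u →
      𝟙 (¬? (σ u ≟F π 1)) * 𝟙 (¬? (σ u ≟F k₀)) ≡ 𝟙 (¬? (u ≟F π 1)) * 𝟙 (¬? (u ≟F k₀))
    swap σ σσ σ1 u = trans (cong₂ _*_
      (𝟙-⇔ (¬? (σ u ≟F π 1)) (¬? (u ≟F k₀)) (λ h eq → h (trans (cong σ (trans eq (sym σ1))) (σσ (π 1)))) (λ h eq → h (trans (sym (σσ u)) (trans (cong σ eq) σ1))))
      (𝟙-⇔ (¬? (σ u ≟F k₀)) (¬? (u ≟F π 1)) (λ h eq → h (trans (cong σ eq) σ1)) (λ h eq → h (trans (sym (σσ u)) (trans (cong σ (trans eq (sym σ1))) (σσ (π 1)))))))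
      (ℤR.*-comm _ _)

    reduced-support : ∀ {u} → reduced u ≢ 0ℤ → K u × u ≢ π 1 × u ≢ k₀
    reduced-support {u} h = proj₁ (pairs-support (λ p≡0 → h (trans (cong (_* rest) p≡0) (ℤR.zeroˡ rest)))) ,
      (case 𝟙*≢0 (¬? (u ≟F π 1)) (λ r≡0 → h (trans (cong (pairs w u *_) r≡0) (ℤR.zeroʳ _))) of λ { (p , q) → p , 𝟙≢0 (¬? (u ≟F k₀)) q })
      where
      rest : ℤ
      rest = 𝟙 (¬? (u ≟F π 1)) * 𝟙 (¬? (u ≟F k₀))

    -- Here the composite involution fixes exactly 1 and `k₀` among the pairs; without these two,
    -- the action is free again.
    count-w : ∃[ c ] ∑ (pairs w) ≡ ℤ.+ 4 * c + ℤ.+ 2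
    count-w = _ , trans (∑-cong split) (trans (∑-+ _ _) (cong₂ _+_ ∑-reduced (trans (∑-+ _ _) (trans (cong₂ _+_ (point (π 1)) (point k₀)) (+-def 1ℤ 1ℤ)))))
      where
      point : ∀ x → ∑ (λ u → 𝟙 (u ≟F x)) ≡ 1ℤ
      point x = trans (∑-cong (λ u → sym (ℤR.*-identityʳ _))) (∑-δ x (λ _ → 1ℤ))
      pairs-1 : pairs w (π 1) ≡ 1ℤ
      pairs-1 = pairs-one K-1 (subst K (solve 1 (λ k → k := :1 :+ k :- :1) refl k₀) K-k₀)
      pairs-k : pairs w k₀ ≡ 1ℤ
      pairs-k = pairs-one K-k₀ (cong lab (solve 1 (λ k → :1 :+ k :- k := :1) refl k₀))
      split : ∀ u → pairs w u ≡ reduced u + (𝟙 (u ≟F π 1) + 𝟙 (u ≟F k₀))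
      split u = by-cases (u ≟F π 1) (u ≟F k₀)
        where
        by-cases : (d : Dec (u ≡ π 1)) (d′ : Dec (u ≡ k₀)) → pairs w u ≡ pairs w u * (𝟙 (¬? d) * 𝟙 (¬? d′)) + (𝟙 d + 𝟙 d′)
        by-cases (yes p) (yes q) = ⊥-elim (k₀≢1 (trans (sym q) p))
        by-cases (yes p) (no q) = trans (trans (cong (pairs w) p) pairs-1) (solveℤ 1 (λ a → conℤ 1ℤ ⟨=⟩ a ⟨*⟩ (conℤ 0ℤ ⟨*⟩ conℤ 1ℤ) ⟨+⟩ (conℤ 1ℤ ⟨+⟩ conℤ 0ℤ)) refl (pairs w u))
        by-cases (no p) (yes q) = trans (trans (cong (pairs w) q) pairs-k) (solveℤ 1 (λ a → conℤ 1ℤ ⟨=⟩ a ⟨*⟩ (conℤ 1ℤ ⟨*⟩ conℤ 0ℤ) ⟨+⟩ (conℤ 0ℤ ⟨+⟩ conℤ 1ℤ)) refl (pairs w u))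
        by-cases (no p) (no q) = solveℤ 1 (λ a → a ⟨=⟩ a ⟨*⟩ (conℤ 1ℤ ⟨*⟩ conℤ 1ℤ) ⟨+⟩ (conℤ 0ℤ ⟨+⟩ conℤ 0ℤ)) refl (pairs w u)
      ∑-reduced = FreeInvolutions.∑-free m reduced (w ⊟_) (k₀ ·_) (reflect w) k₀-involutive (k₀-reflect k₀w)
        (λ u → cong₂ _*_ (pairs-reflect w u) (swap (w ⊟_) (reflect w) (solve 1 (λ k → :1 :+ k :- :1 := k) refl k₀) u))
        (λ u → cong₂ _*_ (pairs-k₀ k₀w u) (swap (k₀ ·_) k₀-involutive (CR.*-identityʳ k₀) u))
        (λ u h → K-even (proj₁ (reduced-support h)) D4-w) (λ u h → K-k₀-free (proj₁ (reduced-support h)))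
        λ u h eq → case reduced-support h of λ { (k , u≢1 , u≢k₀) →
          case proj₁ (stabilise k (subst (D b) (sym (trans (cong (_⊟ w) (reflect-k₀ eq)) (CR.-‿inverseʳ w))) D-0)) of λ
            { (inj₁ u≡1) → u≢1 u≡1 ; (inj₂ u≡k₀) → u≢k₀ u≡k₀ } }

    abstract
      w≁w′ : ¬ w ~ w′
      w≁w′ h = case count-w of λ { (c , eq) → case count-w′ of λ { (c′ , eq′) →
        case multiple-abs 4 (c′ - c) (trans (solveℤ 2 (λ c t → t ⟨=⟩ conℤ (ℤ.+ 4) ⟨*⟩ c ⟨+⟩ t ⟨-⟩ conℤ (ℤ.+ 4) ⟨*⟩ c) refl c (ℤ.+ 2))
          (trans (cong (_- ℤ.+ 4 * c) (trans (sym eq) (trans (coeff-const (π 1) (π 1) h) eq′)))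
            (solveℤ 2 (λ c c′ → conℤ (ℤ.+ 4) ⟨*⟩ c′ ⟨-⟩ conℤ (ℤ.+ 4) ⟨*⟩ c ⟨=⟩ conℤ (ℤ.+ 4) ⟨*⟩ (c′ ⟨-⟩ c)) refl c c′))) of λ
        { (divides zero ()) ; (divides (suc _) ()) } } }

    D-CRT : ∀ {x} → D (2 ℕ.^ a) x → D b x → x ≡ π 0
    D-CRT {x} d2 db = D-n (subst (λ v → D v x) (sym n≡) (D-coprime (gcd-prime-power prime[2] 2∤b a) d2 db))

    abstract
      idempotent : ∃[ e′ ] (D (2 ℕ.^ a) e′ × D b (e′ ⊟ π 1))
      idempotent = case crt (gcd-prime-power prime[2] 2∤b a) (π 0) (π 1) of λ
        { (z , d2 , db) → z , subst (D _) (solve 1 (λ z → z :- con 0ℤ := z) refl z) d2 , db }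

      -- Doubling is not a unit multiplier, but on the idempotent `e′` it agrees with multiplication
      -- by this unit, to which `~-scale` applies.
      doubling : ∃[ u ] (D (2 ℕ.^ a) (u ⊟ π 1) × D b (u ⊟ π 2))
      doubling = crt (gcd-prime-power prime[2] 2∤b a) (π 1) (π 2)

    e′ u : R
    e′ = proj₁ idempotent
    u = proj₁ doubling

    e′≡0 : D (2 ℕ.^ a) e′
    e′≡0 = proj₁ (proj₂ idempotent)
    e′≡1 : D b (e′ ⊟ π 1)
    e′≡1 = proj₂ (proj₂ idempotent)
    u≡1 : D (2 ℕ.^ a) (u ⊟ π 1)
    u≡1 = proj₁ (proj₂ doubling)
    u≡2 : D b (u ⊟ π 2)
    u≡2 = proj₂ (proj₂ doubling)

    2∣2a : 2 ∣ 2 ℕ.^ a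
    2∣2a = m∣m*n (2 ℕ.^ (2 ℕ.+ j))

    u-odd : ¬ D 2 u
    u-odd d = ¬D-1 prime[2] 2∣n (subst (D 2) (reflect u (π 1)) (D-⊟ d (D-∣ 2∣2a u≡1)))

    u-unit : Unit u
    u-unit = unit λ p pp p∣n d → case euclidsLemma (2 ℕ.^ a) b pp (subst (p ∣_) n≡ p∣n) of λ
      { (inj₁ p∣2a) → u-odd (subst (λ v → D v u) (prime∣prime pp prime[2] (prime∣^ pp a p∣2a)) d)
      ; (inj₂ p∣b) → 2∤b (subst (_∣ b) (prime∣prime pp prime[2] (D-π p∣n (subst (D p) (reflect u (π 2)) (D-⊟ d (D-∣ p∣b u≡2))))) p∣b) }

    u-e′ : u · e′ ≡ π 2 · e′
    u-e′ = trans (solve 2 (λ u e → u :* e := (u :- :2) :* e :+ :2 :* e) refl u e′)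
      (trans (cong (_∔ π 2 · e′) (D-CRT (D-·ˡ (u ⊟ π 2) e′≡0) (D-·ʳ e′ u≡2))) (CR.+-identityˡ _))

    -- Modulo `b` both terms are 2. At the prime 2, (k₀ - 1)(k₀ + 1) = 0 and k₀ - 1 is twice an odd
    -- residue, so `w` is divisible by all but one of the factors 2 of n.
    w-2e′ : D half (w ⊟ π 2 · e′)
    w-2e′ = D-coprime (gcd-prime-power prime[2] 2∤b (2 ℕ.+ j))
      (D-⊟ (D-power-cancel {2} {2 ℕ.+ j} {w} {v} prime[2] 2∣n (∣-trans (m∣m*n b) half∣n) v-odd (D-∣ (m∣m*n b) D-half-vw))
           (D-·ˡ (π 2) (D-∣ (n∣m*n 2) e′≡0)))
      (subst (D b) (solve 2 (λ k e → (k :- :1) :- :2 :* (e :- :1) := :1 :+ k :- :2 :* e) refl k₀ e′)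
        (D-⊟ k₀≡ (D-·ˡ (π 2) e′≡1)))
      where
      v : R
      v = π 2 · proj₁ D4-w ⊟ π 1
      k₀-1≡ : k₀ ⊟ π 1 ≡ π 2 · v
      k₀-1≡ = trans (solve 1 (λ k → k :- :1 := :1 :+ k :- :2) refl k₀) (trans (cong (_⊟ π 2) (proj₂ D4-w))
        (solve 1 (λ t → :4 :* t :- :2 := :2 :* (:2 :* t :- :1)) refl (proj₁ D4-w)))
      v-odd : ¬ D 2 v
      v-odd d = ¬D-1 prime[2] 2∣n (subst (D 2) (solve 1 (λ t → t :- (t :- :1) := :1) refl (π 2 · proj₁ D4-w))
        (D-⊟ (D-·ʳ (proj₁ D4-w) (D-self 2)) d))
      D-half-vw : D half (v · w)
      D-half-vw = D-annihilator {2} {half} n≡2half (begin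
        π 2 · (v · w)              ≡⟨ CR.*-assoc (π 2) v w ⟨
        π 2 · v · w                ≡⟨ cong (_· w) k₀-1≡ ⟨
        (k₀ ⊟ π 1) · (π 1 ∔ k₀)    ≡⟨ solve 1 (λ k → (k :- :1) :* (:1 :+ k) := k :* k :- :1) refl k₀ ⟩
        k₀ · k₀ ⊟ π 1              ≡⟨ cong (_⊟ π 1) k₀²≡1 ⟩
        π 1 ⊟ π 1                  ≡⟨ CR.-‿inverseʳ (π 1) ⟩
        π 0                        ∎)
        where open ≡-Reasoning

    N+N : ∀ x → x ∔ N ∔ N ≡ x
    N+N x = trans (solve 2 (λ x N → x :+ N :+ N := x :+ :2 :* N) refl x N) (trans (cong (x ∔_) 2N≡0) (CR.+-identityʳ x))

    -- By `w-2e′` the points `w` and `w′` are 2e′ and 2e′ + N in some order, and the unit `u` maps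
    -- `e′` and e′ + N to these.
    e′≁ : ¬ e′ ∔ N ~ e′
    e′≁ h = case D-half w-2e′ of λ
      { (inj₁ eq) → let w≡ = trans (sym (∔-⊟ w (π 2 · e′))) (trans (cong (_∔ π 2 · e′) eq) (CR.+-identityˡ _)) in
          w≁w′ (subst₂ _~_ (sym w≡) (cong (_∔ N) (sym w≡)) doubled)
      ; (inj₂ eq) → let w≡ = trans (sym (∔-⊟ w (π 2 · e′))) (trans (cong (_∔ π 2 · e′) eq) (CR.+-comm N _)) in
          w≁w′ (subst₂ _~_ (sym w≡) (trans (sym (N+N _)) (cong (_∔ N) (sym w≡))) (sym doubled)) }
      where
      doubled : π 2 · e′ ~ π 2 · e′ ∔ N
      doubled = subst₂ _~_ u-e′ (trans (CR.distribˡ u e′ N) (cong₂ _∔_ u-e′ (odd-N u-odd))) (~-scale u-unit (sym h))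

    -- For `y ~ e′`, the product `u · y` lies in the block of 2e′, so `fibre` writes it as 2y′ with
    -- `y′ ~ e′`. Each round gains a factor 2.
    2-divisible : ∀ k {y} → y ~ e′ → D (2 ℕ.^ k) y
    2-divisible zero _ = D-1 _
    2-divisible (suc k) {y} y~ = case fibre {2} {e′} {e′ ∔ N} prime[2] 2∣n
        (sym (trans (CR.distribˡ (π 2) e′ N) (trans (cong (π 2 · e′ ∔_) 2N≡0) (CR.+-identityʳ _)))) e′≁
        (trans (~-scale u-unit y~) (cong lab u-e′)) of λ
      { (y′ , y′~ , eq) → D-unit u-unit (subst (D (2 ℕ.^ suc k)) (sym eq) (D-mul (2-divisible k y′~))) }

    abstract
      Good-2-part : Good (2 ℕ.^ a)
      Good-2-part = Good-generated 2a∣n (2-divisible a) (π (2 ℕ.^ a) , trans (solve 2 (λ p e → p := e :* p :- (e :- :1) :* p) refl (π (2 ℕ.^ a)) e′)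
        (trans (cong (λ v → e′ · π (2 ℕ.^ a) ⊟ v) (D-CRT (D-·ˡ (e′ ⊟ π 1) (D-self (2 ℕ.^ a))) (D-·ʳ _ e′≡1)))
          (solve 1 (λ v → v :- con 0ℤ := v) refl (e′ · π (2 ℕ.^ a)))))

-- Density.

module Density {m : ℕ} (A : SRing m) (qd : Quasidense A) (tr : TrivialRadical A) where
  open TwoPart A qd tr public

  module _ {q b : ℕ} (pq : Prime q) (q∤b : ¬ q ∣ b) where

    private
      Orbit : ℕ → Set
      Orbit j = ∀ y → y ~ π (q ℕ.^ j) → ∃[ κ ] (K κ × y ≡ π (q ℕ.^ j) · κ)

      Good-orbit : ∀ {a} → n ≡ q ℕ.^ a ℕ.* b → Orbit a → Good (q ℕ.^ a)
      Good-orbit {a} n≡ orb = Good-generated (*≡⇒∣ˡ (q ℕ.^ a) b n≡)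
        (λ h → case orb _ h of λ { (κ , _ , eq) → κ , eq }) (π 1 , sym (CR.*-identityʳ _))

      module Step {j i : ℕ} (n≡ : n ≡ q ℕ.^ (j ℕ.+ suc i) ℕ.* b) (orb : Orbit j) where
        P n′ c : ℕ
        P = q ℕ.^ j
        n′ = q ℕ.^ (j ℕ.+ i) ℕ.* b
        c = q ℕ.^ i ℕ.* b

        qn′ : n ≡ q ℕ.* n′
        qn′ = trans n≡ (trans (cong (λ v → q ℕ.^ v ℕ.* b) (ℕₚ.+-suc j i)) (ℕₚ.*-assoc q (q ℕ.^ (j ℕ.+ i)) b))

        n′≡ : n′ ≡ P ℕ.* c
        n′≡ = trans (cong (ℕ._* b) (ℕₚ.^-distribˡ-+-* q j i)) (ℕₚ.*-assoc P (q ℕ.^ i) b)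

        Pqc : n ≡ P ℕ.* (q ℕ.^ suc i ℕ.* b)
        Pqc = trans n≡ (trans (cong (ℕ._* b) (ℕₚ.^-distribˡ-+-* q j (suc i))) (ℕₚ.*-assoc P (q ℕ.^ suc i) b))

        q∣n : q ∣ n
        q∣n = *≡⇒∣ˡ q n′ qn′

        c≢0 : c ≢ 0
        c≢0 eq = ∣n⇒≢0 (*≡⇒∣ʳ q n′ qn′) (trans n′≡ (trans (cong (P ℕ.*_) eq) (ℕₚ.*-zeroʳ P)))

        q·n′≡0 : π q · π n′ ≡ π 0
        q·n′≡0 = trans (sym (π-* q n′)) (trans (cong π (sym qn′)) π-n)

        next : ∀ {t} → ¬ π P ∔ t · π n′ ~ π P → Orbit (suc j)
        next {t} ≁ y y~ = case fibre pq q∣n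
            (sym (trans (solve 4 (λ q P t v → q :* (P :+ t :* v) := q :* P :+ t :* (q :* v)) refl (π q) (π P) t (π n′))
              (trans (cong (λ v → π q · π P ∔ t · v) q·n′≡0) (solve 2 (λ a t → a :+ t :* con 0ℤ := a) refl _ t)))) ≁
            (subst (y ~_) (π-* q P) y~) of λ
          { (u , u~ , y≡) → case orb u u~ of λ
            { (κ , kκ , u≡) → κ , kκ , trans y≡ (trans (cong (π q ·_) u≡) (trans (sym (CR.*-assoc _ _ κ)) (cong (_· κ) (sym (π-* q P))))) } }

        module Blocked (all : ∀ t → π P ∔ t · π n′ ~ π P) where
          -- Dividing P κ = P + t n′ by `P` shows that `κ` is 1 + t c modulo n/P. The existence of
          -- such elements of `K` is refuted below, except for q = 2, i = 1 and positive j.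
          element : ∀ t → ∃[ κ ] (K κ × D (q ℕ.^ suc i ℕ.* b) (κ ⊟ π 1 ⊟ t · π c))
          element t = case orb _ (all t) of λ { (κ , kκ , eq) → κ , kκ , D-annihilator {P} Pqc
            (trans (solve 4 (λ P κ t c → P :* (κ :- :1 :- t :* c) := P :* κ :- (P :+ t :* (P :* c))) refl (π P) κ t (π c))
              (trans (cong₂ _⊟_ (sym eq) (cong (λ v → π P ∔ t · v) (trans (sym (π-* P c)) (cong π (sym n′≡))))) (CR.-‿inverseʳ _))) }

          c∤ : ∀ {κ} → κ ≡ π 1 → ¬ D (q ℕ.^ suc i ℕ.* b) (κ ⊟ π 1 ⊟ π 1 · π c)
          c∤ {κ} κ≡1 d = ℕₚ.<⇒≱ (ℕₚ.m<m*n c q {{ℕ.≢-nonZero c≢0}} (prime>1 pq))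
            (∣⇒≤ {{ℕ.≢-nonZero c≢0}} (subst (_∣ c) (trans (ℕₚ.*-assoc q (q ℕ.^ i) b) (ℕₚ.*-comm q c))
              (D-π (*≡⇒∣ʳ P _ Pqc) (subst (D (q ℕ.^ suc i ℕ.* b))
                (trans (cong (λ v → ⊝ (v ⊟ π 1 ⊟ π 1 · π c)) κ≡1) (solve 1 (λ c → :- (:1 :- :1 :- :1 :* c) := c) refl (π c))) (D-⊝ d)))))

          -- Here c = b is prime to `q`, and Bézout's identity provides a t for which 1 + t b, hence
          -- `κ`, is divisible by `q`.
          last-step : i ≡ 0 → ⊥
          last-step refl = case bezout₁ {q} {b} (subst (λ v → gcd v b ≡ 1) (ℕₚ.*-identityʳ q) (gcd-prime-power pq q∤b 1)) of λ
            { (s , t , eq) → case element (⊝ t) of λ { (κ , kκ , d) → K-¬D kκ pq q∣n (subst (D q) (sum s t κ eq)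
                (D-∔ (D-∣ (∣-trans (m∣m*n 1) (m∣m*n b)) d) (D-·ˡ s (D-self q)))) } }
            where
            sum : ∀ s t κ → π 1 ≡ s · π q ∔ t · π b → κ ⊟ π 1 ⊟ (⊝ t) · π c ∔ s · π q ≡ κ
            sum s t κ eq = trans (cong (λ v → κ ⊟ v ⊟ (⊝ t) · π c ∔ s · π q) eq)
              (trans (cong (λ v → κ ⊟ (s · π q ∔ t · π b) ⊟ (⊝ t) · π v ∔ s · π q) (ℕₚ.*-identityˡ b))
                (solve 5 (λ κ s q t b → κ :- (s :* q :+ t :* b) :- (:- t) :* b :+ s :* q := κ) refl κ s (π q) t (π b)))

          D-c : ∀ {κ} → D (q ℕ.^ suc i ℕ.* b) (κ ⊟ π 1 ⊟ π 1 · π c) → D c (κ ⊟ π 1)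
          D-c {κ} d = subst (D c) (solve 2 (λ x c → x :- :1 :* c :+ c := x) refl (κ ⊟ π 1) (π c))
            (D-∔ (D-∣ (divides q (ℕₚ.*-assoc q (q ℕ.^ i) b)) d) (D-self c))

          -- Now `c` is divisible by every prime divisor of n, so `K-trivial` forces the `κ`
          -- congruent to 1 + c to be 1, although `c` is not divisible by q c.
          inner-step : ∀ {i′} → i ≡ suc i′ → (4 ∣ n → 4 ∣ c) → ⊥
          inner-step {i′} refl 4∣c = case element (π 1) of λ { (κ , kκ , d) → c∤ (K-trivial kκ (λ p pp p∣n →
              case euclidsLemma (q ℕ.^ (j ℕ.+ suc i)) b pp (subst (p ∣_) n≡ p∣n) of λ
                { (inj₁ p∣qa) → D-∣ (subst (_∣ c) (sym (prime∣prime pp pq (prime∣^ pp (j ℕ.+ suc i) p∣qa))) (∣-trans (m∣m*n (q ℕ.^ i′)) (m∣m*n b))) (D-c d)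
                ; (inj₂ p∣b) → D-∣ (∣-trans p∣b (n∣m*n (q ℕ.^ i))) (D-c d) })
              (λ 4∣n → D-∣ (4∣c 4∣n) (D-c d))) d }

          π-n′≢0 : π n′ ≢ π 0
          π-n′≢0 eq = ℕₚ.<⇒≱ (subst (n′ <_) (trans (ℕₚ.*-comm n′ q) (sym qn′)) (ℕₚ.m<m*n n′ q {{ℕ.≢-nonZero n′≢0}} (prime>1 pq)))
            (∣⇒≤ {{ℕ.≢-nonZero n′≢0}} (D-π ∣-refl (subst (D n) (sym eq) D-0)))
            where
            n′≢0 : n′ ≢ 0
            n′≢0 = ∣n⇒≢0 (*≡⇒∣ʳ q n′ qn′)

          -- With P = 1, scaling by elements of `K` shows that n/q translates `K` into itself,
          -- against the trivial radical.
          first-step : j ≡ 0 → ⊥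
          first-step j≡0 = π-n′≢0 (radical-trivial λ κ kκ → subst (_~ π 1)
            (trans (solve 3 (λ κ u v → κ :* (:1 :+ u :* v) := κ :+ κ :* u :* v) refl κ (proj₁ (K-unit kκ)) (π n′))
              (cong (κ ∔_) (trans (cong (_· π n′) (proj₂ (K-unit kκ))) (CR.*-identityˡ _))))
            (K-· kκ (subst (λ v → π v ∔ proj₁ (K-unit kκ) · π n′ ~ π v) (cong (q ℕ.^_) j≡0) (all (proj₁ (K-unit kκ))))))

          -- Here c = 2b with `b` odd, so `κ` is 1 modulo `b` and 1 + 2b, that is 3, modulo 4. Since
          -- j is positive, the exponent of 2 in n is at least 3.
          exceptional : q ≡ 2 → i ≡ 1 → ∀ {j′} → j ≡ suc j′ → Good (q ℕ.^ (j ℕ.+ suc i))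
          exceptional q≡2 i≡1 {j′} j≡ = case element (π 1) of λ { (κ , kκ , d) →
              subst Good exponent (Exceptional.Good-2-part {j′} {b} (trans n≡ (cong (ℕ._* b) (sym exponent))) 2∤b kκ
                (D-∣ (n∣m*n (q ℕ.^ i)) (D-c d))
                (subst (D 4) (trans (cong (λ v → κ ⊟ π 1 ⊟ π 1 · π v ∔ (π 2 ∔ π 2 · π b)) c≡) (trans (cong (λ v → κ ⊟ π 1 ⊟ π 1 · v ∔ (π 2 ∔ π 2 · π b)) (π-* 2 b))
                   (solve 2 (λ κ b → κ :- :1 :- :1 :* (:2 :* b) :+ (:2 :+ :2 :* b) := κ :+ :1) refl κ (π b))))
                  (D-∔ (D-∣ (divides b (trans (cong₂ (λ u v → u ℕ.^ suc v ℕ.* b) q≡2 i≡1) (ℕₚ.*-comm 4 b))) d) even))) }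
            where
            2∤b : ¬ 2 ∣ b
            2∤b h = q∤b (subst (_∣ b) (sym q≡2) h)
            exponent : 2 ℕ.^ (3 ℕ.+ j′) ≡ q ℕ.^ (j ℕ.+ suc i)
            exponent = sym (trans (cong₂ ℕ._^_ q≡2 (cong₂ (λ u v → u ℕ.+ suc v) j≡ i≡1)) (cong (2 ℕ.^_) (ℕₚ.+-comm (suc j′) 2)))
            c≡ : c ≡ 2 ℕ.* b
            c≡ = cong₂ (λ u v → u ℕ.^ v ℕ.* b) q≡2 i≡1
            even : D 4 (π 2 ∔ π 2 · π b)
            even = case odd b 2∤b of λ { (h , b≡) → π 1 ∔ π h , trans (cong (λ v → π 2 ∔ π 2 · v) (trans (cong π b≡) (trans (π-+ 1 (h ℕ.+ h)) (cong (π 1 ∔_) (π-+ h h)))))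
              (solve 1 (λ h → :2 :+ :2 :* (:1 :+ (h :+ h)) := :4 :* (:1 :+ h)) refl (π h)) }

        step : Orbit (suc j) ⊎ Good (q ℕ.^ (j ℕ.+ suc i))
        step = case all? (λ t → π P ∔ t · π n′ ~? π P) of λ
          { (no ¬all) → inj₁ (next (proj₂ (¬∀⟶∃¬ n _ (λ t → π P ∔ t · π n′ ~? π P) ¬all)))
          ; (yes all) → inj₂ (blocked all i j (q ℕ.≟ 2) refl refl) }
          where
          blocked : (∀ t → π P ∔ t · π n′ ~ π P) → ∀ i₀ j₀ → Dec (q ≡ 2) → i ≡ i₀ → j ≡ j₀ → Good (q ℕ.^ (j ℕ.+ suc i))
          blocked all zero _ _ i≡ _ = ⊥-elim (Blocked.last-step all i≡)
          blocked all (suc i′) _ (no q≢2) i≡ _ = ⊥-elim (Blocked.inner-step all i≡ λ 4∣n →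
            ∣-trans (gcd≡1-∣ {4} {q ℕ.^ (j ℕ.+ suc i)} {b} (gcd≡1 4 _ (λ ()) λ p pp p∣4 p∣qa →
              q≢2 (trans (sym (prime∣prime pp pq (prime∣^ pp (j ℕ.+ suc i) p∣qa))) (prime∣prime pp prime[2] (prime∣^ {p} {2} pp 2 p∣4))))
              (subst (4 ∣_) n≡ 4∣n)) (n∣m*n (q ℕ.^ i)))
          blocked all (suc (suc i″)) _ (yes q≡2) i≡ _ = ⊥-elim (Blocked.inner-step all i≡ λ _ →
            ∣-trans (divides (2 ℕ.^ i″) (trans (cong₂ ℕ._^_ q≡2 i≡) (trans (sym (ℕₚ.*-assoc 2 2 (2 ℕ.^ i″))) (ℕₚ.*-comm 4 (2 ℕ.^ i″))))) (m∣m*n b))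
          blocked all (suc zero) zero (yes q≡2) i≡ j≡ = ⊥-elim (Blocked.first-step all j≡)
          blocked all (suc zero) (suc j′) (yes q≡2) i≡ j≡ = Blocked.exceptional all q≡2 i≡ j≡

      orbit : ∀ j i → n ≡ q ℕ.^ (j ℕ.+ i) ℕ.* b → Orbit j ⊎ Good (q ℕ.^ (j ℕ.+ i))
      orbit zero i n≡ = inj₁ λ y h → y , h , sym (CR.*-identityˡ y)
      orbit (suc j) i n≡ = case orbit j (suc i) n≡′ of λ
        { (inj₁ orb) → case Step.step {j} {i} n≡′ orb of λ { (inj₁ orb′) → inj₁ orb′ ; (inj₂ good) → inj₂ (subst (λ v → Good (q ℕ.^ v)) (ℕₚ.+-suc j i) good) }
        ; (inj₂ good) → inj₂ (subst (λ v → Good (q ℕ.^ v)) (ℕₚ.+-suc j i) good) }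
        where
        n≡′ : n ≡ q ℕ.^ (j ℕ.+ suc i) ℕ.* b
        n≡′ = subst (λ v → n ≡ q ℕ.^ v ℕ.* b) (sym (ℕₚ.+-suc j i)) n≡

    abstract
      Good-primary : ∀ {a} → n ≡ q ℕ.^ a ℕ.* b → Good (q ℕ.^ a)
      Good-primary {a} n≡ = case orbit a 0 (subst (λ v → n ≡ q ℕ.^ v ℕ.* b) (sym (ℕₚ.+-identityʳ a)) n≡) of λ
        { (inj₁ orb) → Good-orbit {a} n≡ orb ; (inj₂ good) → subst (λ v → Good (q ℕ.^ v)) (ℕₚ.+-identityʳ a) good }

  -- Once the full power q^a is good, `prime-step` between q^j and q^a can only multiply by `q`, so
  -- the exponents are reached one after another.
  Good-prime-power : ∀ {q} → Prime q → ∀ j → q ℕ.^ j ∣ n → Good (q ℕ.^ j)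
  Good-prime-power {q} pq j qj∣n = case split-prime q pq n n≢0 of λ { (a , b , n≡ , q∤b) →
      chain a (*≡⇒∣ˡ _ b n≡) (Good-primary pq q∤b {a} n≡) j (gcd≡1-∣ {q ℕ.^ j} {b} {q ℕ.^ a} (gcd-prime-power pq q∤b j) (subst (q ℕ.^ j ∣_) (trans n≡ (ℕₚ.*-comm (q ℕ.^ a) b)) qj∣n)) }
    where
    chain : ∀ a → q ℕ.^ a ∣ n → Good (q ℕ.^ a) → ∀ j → q ℕ.^ j ∣ q ℕ.^ a → Good (q ℕ.^ j)
    chain a qa∣n good zero _ = Good-1
    chain a qa∣n good (suc j) h = case prime-step qd (q ℕ.^ a) qa∣n qj∣qa proper (chain a qa∣n good j qj∣qa) good of λ
      { (p , pp , h′ , good′) → subst Good (trans (cong (q ℕ.^ j ℕ.*_) (prime∣prime pp pq (prime∣^ pp a (∣-trans (n∣m*n (q ℕ.^ j)) h′)))) (ℕₚ.*-comm (q ℕ.^ j) q)) good′ }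
      where
      qj∣qa : q ℕ.^ j ∣ q ℕ.^ a
      qj∣qa = ∣-trans (n∣m*n q) h
      nz : NonZero (q ℕ.^ j)
      nz = ℕₚ.m^n≢0 q j {{prime⇒nonZero pq}}
      proper : q ℕ.^ j ≢ q ℕ.^ a
      proper eq = ℕₚ.<⇒≱ (ℕₚ.m<m*n (q ℕ.^ j) q {{nz}} (prime>1 pq))
        (∣⇒≤ {{nz}} (subst₂ _∣_ (ℕₚ.*-comm q (q ℕ.^ j)) (sym eq) h))

  abstract
    Good-all : ∀ d → d ∣ n → Good d
    Good-all = <-rec _ go
      where
      go : ∀ d → (∀ {c} → c < d → c ∣ n → Good c) → d ∣ n → Good d
      go d rec d∣n = case d ℕ.≟ 1 of λ
        { (yes refl) → Good-1
        ; (no d≢1) → case prime-divisor d (∣n⇒≢0 d∣n) d≢1 of λ { (q , pq , q∣d) →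
            case split-prime q pq d (∣n⇒≢0 d∣n) of λ { (zero , c , d≡ , q∤c) → ⊥-elim (q∤c (subst (q ∣_) (trans d≡ (ℕₚ.*-identityˡ c)) q∣d))
              ; (suc j , c , d≡ , q∤c) → subst Good (sym d≡) (Good-coprime (gcd-prime-power pq q∤c (suc j))
                  (Good-prime-power pq (suc j) (∣-trans (*≡⇒∣ˡ _ c d≡) d∣n))
                  (rec (smaller q pq j c d≡ d∣n) (∣-trans (*≡⇒∣ʳ (q ℕ.^ suc j) c d≡) d∣n))) } } }
        where
        smaller : ∀ q → Prime q → ∀ j c → d ≡ q ℕ.^ suc j ℕ.* c → d ∣ n → c < d
        smaller q pq j c d≡ d∣n = subst (c <_) (trans (ℕₚ.*-comm c (q ℕ.^ suc j)) (sym d≡)) (ℕₚ.m<m*n c (q ℕ.^ suc j)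
          {{ℕ.≢-nonZero λ { refl → ∣n⇒≢0 d∣n (trans d≡ (ℕₚ.*-zeroʳ (q ℕ.^ suc j))) }}}
          (ℕₚ.<-≤-trans (prime>1 pq) (∣⇒≤ {{ℕₚ.m^n≢0 q (suc j) {{prime⇒nonZero pq}}}} (m∣m*n (q ℕ.^ j)))))

  dense : Dense A
  dense H sub = case subgroup-generator sub of λ { (g , g∣n , H⇒D , D⇒H) → record
    { subgroup = sub ; union = λ x y x~y hx → D⇒H (Good-all g g∣n x y x~y (H⇒D hx)) } }

-- Restriction to subgroups and averages over them.

module Averages (m : ℕ) where
  open Sums m

  -- Unnormalised, to keep integer values; this is where the factors `size d` come from.
  avg : ℕ → (R → ℤ) → R → ℤ
  avg d f w = ∑ (λ t → 𝟙 (D? d t) * f (w ∔ t))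

  restrict : ℕ → (R → ℤ) → R → ℤ
  restrict d f w = 𝟙 (D? d w) * f w

  size : ℕ → ℤ
  size d = ∑ (λ t → 𝟙 (D? d t))

  abstract
    size≢0 : ∀ d → size d ≢ 0ℤ
    size≢0 d = ∑≥1 _ (λ t → 𝟙-nonneg (D? d t)) (π 0) (𝟙-yes (D? d (π 0)) D-0)

    D-shift : ∀ {d v} t → D d v → 𝟙 (D? d (t ∔ v)) ≡ 𝟙 (D? d t)
    D-shift {d} {v} t h = 𝟙-⇔ (D? d (t ∔ v)) (D? d t) (λ k → subst (D d) (⊟-∔ t v) (D-⊟ k h)) (λ k → D-∔ k h)

    avg-shift : ∀ {d v} f w → D d v → avg d f (w ∔ v) ≡ avg d f w
    avg-shift {d} {v} f w h = trans (∑-cong λ t → cong₂ _*_ (sym (D-shift t h))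
      (cong f (solve 3 (λ w v t → w :+ v :+ t := w :+ (t :+ v)) refl w v t))) (sym (∑-shift v _))

    avg-invariant : ∀ {d w w′} f → D d (w ⊟ w′) → avg d f w ≡ avg d f w′
    avg-invariant {d} {w} {w′} f h = trans (cong (avg d f) (solve 2 (λ w v → w := v :+ (w :- v)) refl w w′)) (avg-shift f w′ h)

    avg-n : ∀ f w → avg n f w ≡ f w
    avg-n f w = trans (∑-cong λ t → cong (_* f (w ∔ t)) (𝟙-⇔ (D? n t) (t ≟F π 0) D-n (λ { refl → D-0 })))
      (trans (∑-δ (π 0) (λ t → f (w ∔ t))) (cong f (CR.+-identityʳ w)))

    avg-scale : ∀ {d u} → Unit u → ∀ f w → ∑ (λ t → 𝟙 (D? d t) * f (w ∔ u · t)) ≡ avg d f w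
    avg-scale {d} {u} uu f w = trans (∑-cong λ t → cong (_* f (w ∔ u · t)) (𝟙-⇔ (D? d t) (D? d (u · t)) (D-·ˡ u) (D-unit uu)))
      (sym (∑-scale uu (λ t → 𝟙 (D? d t) * f (w ∔ t))))

    avg-avg : ∀ {c d} → c ∣ d → ∀ f w → avg c (avg d f) w ≡ size d * avg c f w
    avg-avg {c} {d} c∣d f w = begin
      ∑ (λ t → 𝟙 (D? c t) * ∑ (λ v → 𝟙 (D? d v) * f (w ∔ t ∔ v)))  ≡⟨ ∑-cong (λ t → ∑-*ˡ _ _) ⟩
      ∑ (λ t → ∑ (λ v → 𝟙 (D? c t) * (𝟙 (D? d v) * f (w ∔ t ∔ v)))) ≡⟨ ∑-comm _ ⟩
      ∑ (λ v → ∑ (λ t → 𝟙 (D? c t) * (𝟙 (D? d v) * f (w ∔ t ∔ v)))) ≡⟨ ∑-cong (λ v → trans (∑-cong λ t → trans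
          (solveℤ 3 (λ a b c → a ⟨*⟩ (b ⟨*⟩ c) ⟨=⟩ b ⟨*⟩ (a ⟨*⟩ c)) refl (𝟙 (D? c t)) (𝟙 (D? d v)) (f (w ∔ t ∔ v)))
            (cong (λ y → 𝟙 (D? d v) * (𝟙 (D? c t) * f y)) (solve 3 (λ w t v → w :+ t :+ v := w :+ v :+ t) refl w t v))) (sym (∑-*ˡ _ _))) ⟩
      ∑ (λ v → 𝟙 (D? d v) * avg c f (w ∔ v))                         ≡⟨ ∑-cong (λ v → 𝟙-guard (D? d v) (λ h → avg-shift f w (D-∣ c∣d h))) ⟩
      ∑ (λ v → 𝟙 (D? d v) * avg c f w)                               ≡⟨ ∑-*ʳ _ _ ⟨
      size d * avg c f w                                              ∎
      where open ≡-Reasoning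

    avg-− : ∀ d f g w → avg d (λ w → f w - g w) w ≡ avg d f w - avg d g w
    avg-− d f g w = trans (∑-cong λ t → solveℤ 3 (λ a b c → a ⟨*⟩ (b ⟨-⟩ c) ⟨=⟩ a ⟨*⟩ b ⟨-⟩ a ⟨*⟩ c) refl (𝟙 (D? d t)) (f (w ∔ t)) (g (w ∔ t))) (∑-− _ _)

-- `K`-orbits of elements generating the ideal of an idempotent.

module Orbits {m : ℕ} (A : SRing m) (qd : Quasidense A) (tr : TrivialRadical A) where
  open Density A qd tr public
  open Averages m public

  restrict-AFun : ∀ {d f} → d ∣ n → AFun f → AFun (restrict d f)
  restrict-AFun {d} d∣n hf {x} {y} x~y = cong₂ _*_
    (𝟙-⇔ (D? d x) (D? d y) (Good-all d d∣n x y x~y) (Good-all d d∣n y x (sym x~y))) (hf x~y)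

  correlation-AFun : ∀ {f g} → AFun f → AFun g → AFun (λ z → ∑ (λ w → f w * g (z ∔ w)))
  correlation-AFun {f} {g} hf hg {z} {z′} z~z′ = trans (eq z) (trans (⋆-AFun {f ∘ ⊝_} {g} (hf ∘ ~-⊝) hg z~z′) (sym (eq z′)))
    where
    eq : ∀ z → ∑ (λ w → f w * g (z ∔ w)) ≡ ((f ∘ ⊝_) ⋆ g) z
    eq z = trans (∑-bij ⊝_ ⊝_ -‿involutive -‿involutive _) refl

  avg-AFun : ∀ {d f} → d ∣ n → AFun f → AFun (avg d f)
  avg-AFun {d} d∣n hf = correlation-AFun (λ {x} {y} x~y → 𝟙-⇔ (D? d x) (D? d y)
    (Good-all d d∣n x y x~y) (Good-all d d∣n y x (sym x~y))) hf

  𝟙K : R → ℤ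
  𝟙K κ = 𝟙 (κ ~? π 1)

  -- x generates the same ideal of ℤ/n as an idempotent, and this ideal is c ℤ/n, with complement b ℤ/n.
  record Regular (x : R) : Set where
    field
      c b : ℕ
      n≡ : n ≡ c ℕ.* b
      coprime : gcd c b ≡ 1
      D-c : D c x
      is-unit : Unit (x ∔ π b)

    c∣n : c ∣ n
    c∣n = *≡⇒∣ˡ c b n≡

    b∣n : b ∣ n
    b∣n = *≡⇒∣ʳ c b n≡

    u : R
    u = x ∔ π b

    D-cb : ∀ {y} → D c y → D b y → y ≡ π 0
    D-cb {y} hc hb = D-n (subst (λ v → D v y) (sym n≡) (D-coprime coprime hc hb))

  orbitCount : R → R → ℤ
  orbitCount x w = ∑ (λ κ → 𝟙K κ * 𝟙 (w ≟F κ · x))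

  -- `κ ↦ u · κ` maps `K` onto the block of the unit `u`, and `κ · x` is the component of `u · κ` in
  -- `c` ℤ/n. So for `w` in `c` ℤ/n the count is the number of elements of that block in the coset
  -- of `w` modulo `b` ℤ/n.
  orbitCount-≡ : ∀ {x} (r : Regular x) w → orbitCount x w ≡
    restrict (Regular.c r) (avg (Regular.b r) (λ y → 𝟙 (y ~? Regular.u r))) w
  orbitCount-≡ {x} r w = by-cases (D? c w)
    where
    open Regular r
    by-cases : (d : Dec (D c w)) → orbitCount x w ≡ 𝟙 d * avg b (λ y → 𝟙 (y ~? u)) w
    by-cases (no ¬d) = trans (∑-vanish λ κ → trans (cong (𝟙K κ *_) (𝟙-no (w ≟F κ · x) λ eq → ¬d (subst (D c) (sym eq) (D-·ˡ κ D-c)))) (ℤR.zeroʳ _)) (sym (ℤR.zeroˡ _))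
    by-cases (yes d) = sym (trans (ℤR.*-identityˡ _) (begin
      ∑ (λ v → 𝟙 (D? b v) * 𝟙 (w ∔ v ~? u))
        ≡⟨ ∑-shift (⊝ w) _ ⟩
      ∑ (λ t → 𝟙 (D? b (t ⊟ w)) * 𝟙 (w ∔ (t ⊟ w) ~? u))
        ≡⟨ ∑-scale is-unit _ ⟩
      ∑ (λ κ → 𝟙 (D? b (u · κ ⊟ w)) * 𝟙 (w ∔ (u · κ ⊟ w) ~? u))
        ≡⟨ ∑-cong (λ κ → trans (ℤR.*-comm _ _) (cong₂ _*_
             (𝟙-⇔ (w ∔ (u · κ ⊟ w) ~? u) (κ ~? π 1)
               (λ h → ~-cancel is-unit (trans (cong lab (sym (simplify κ))) (trans h (cong lab (sym (CR.*-identityʳ u))))))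
               (λ h → trans (cong lab (simplify κ)) (trans (~-scale is-unit h) (cong lab (CR.*-identityʳ u)))))
             (𝟙-⇔ (D? b (u · κ ⊟ w)) (w ≟F κ · x) (to κ) (from κ)))) ⟩
      ∑ (λ κ → 𝟙K κ * 𝟙 (w ≟F κ · x)) ∎))
      where
      open ≡-Reasoning
      simplify : ∀ κ → w ∔ (u · κ ⊟ w) ≡ u · κ
      simplify κ = solve 2 (λ w v → w :+ (v :- w) := v) refl w (u · κ)
      to : ∀ κ → D b (u · κ ⊟ w) → w ≡ κ · x
      to κ h = sym (trans (sym (∔-⊟ (κ · x) w)) (trans (cong (_∔ w) (D-cb (D-⊟ (D-·ˡ κ D-c) d)
        (subst (D b) (solve 4 (λ x b κ w → (x :+ b) :* κ :- w :- κ :* b := κ :* x :- w) refl x (π b) κ w) (D-⊟ h (D-·ˡ κ (D-self b)))))) (CR.+-identityˡ w)))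
      from : ∀ κ → w ≡ κ · x → D b (u · κ ⊟ w)
      from κ eq = subst (D b) (trans (solve 3 (λ x b κ → κ :* b := (x :+ b) :* κ :- κ :* x) refl x (π b) κ) (cong (u · κ ⊟_) (sym eq))) (D-·ˡ κ (D-self b))

  abstract
    orbitCount-AFun : ∀ {x} → Regular x → AFun (orbitCount x)
    orbitCount-AFun r {w} {w′} w~w′ = trans (orbitCount-≡ r w) (trans
      (restrict-AFun c∣n (avg-AFun b∣n (block-AFun u)) w~w′) (sym (orbitCount-≡ r w′)))
      where open Regular r

    orbitCount-sum : ∀ x (φ : R → ℤ) z → ∑ (λ w → orbitCount x w * φ (z ∔ w)) ≡ ∑ (λ κ → 𝟙K κ * φ (z ∔ κ · x))
    orbitCount-sum x φ z = begin
      ∑ (λ w → ∑ (λ κ → 𝟙K κ * 𝟙 (w ≟F κ · x)) * φ (z ∔ w))       ≡⟨ ∑-cong (λ w → ∑-*ʳ _ _) ⟩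
      ∑ (λ w → ∑ (λ κ → 𝟙K κ * 𝟙 (w ≟F κ · x) * φ (z ∔ w)))       ≡⟨ ∑-comm _ ⟩
      ∑ (λ κ → ∑ (λ w → 𝟙K κ * 𝟙 (w ≟F κ · x) * φ (z ∔ w)))       ≡⟨ ∑-cong (λ κ → trans (∑-cong λ w → ℤR.*-assoc _ _ _)
          (trans (sym (∑-*ˡ _ _)) (cong (𝟙K κ *_) (∑-δ (κ · x) (λ w → φ (z ∔ w)))))) ⟩
      ∑ (λ κ → 𝟙K κ * φ (z ∔ κ · x))                              ∎
      where open ≡-Reasoning

    orbit-AFun : ∀ {x φ} → Regular x → AFun φ → AFun (λ z → ∑ (λ κ → 𝟙K κ * φ (z ∔ κ · x)))
    orbit-AFun {x} {φ} r hφ {z} {z′} z~z′ = trans (sym (orbitCount-sum x φ z))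
      (trans (correlation-AFun (orbitCount-AFun r) hφ z~z′) (orbitCount-sum x φ z′))

    -- From κ u ~ u = x + b, `~-sum` gives κ u = s + t with `s ~ x` and t in the block of b. By
    -- density s and t lie in the complementary ideals, so s is the component `κ · x`.
    regular-~ : ∀ {x κ} → Regular x → K κ → κ · x ~ x
    regular-~ {x} {κ} r k = case ~-sum {u = x} {v = π b} (sym (trans (cong lab (CR.*-comm κ u)) (trans (~-scale is-unit k) (cong lab (CR.*-identityʳ u))))) refl of λ
      { (s , t , s~x , t~b , eq) → trans (cong lab (sym (trans (sym (∔-⊟ s (κ · x))) (trans (cong (_∔ κ · x) (D-cb
          (D-⊟ (Good-all c c∣n x s (sym s~x) D-c) (D-·ˡ κ D-c))
          (subst (D b) (trans (cong (λ v → v ⊟ κ · x ⊟ t) (trans (sym (CR.distribˡ κ x (π b))) eq)) (solve 3 (λ s t y → s :+ t :- y :- t := s :- y) refl s t (κ · x)))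
            (D-⊟ (subst (D b) (solve 3 (λ κ x b → κ :* b := κ :* x :+ κ :* b :- κ :* x) refl κ x (π b)) (D-·ˡ κ (D-self b)))
                 (Good-all b b∣n (π b) t (sym t~b) (D-self b))))))
          (CR.+-identityˡ _))))) s~x }
      where open Regular r

    K-scale-sum : ∀ {κ} → K κ → ∀ (g : R → ℤ) → ∑ (λ μ → 𝟙K μ * g (κ · μ)) ≡ ∑ (λ μ → 𝟙K μ * g μ)
    K-scale-sum {κ} k g = sym (trans (∑-scale (K-unit k) (λ μ → 𝟙K μ * g μ)) (∑-cong λ μ → cong (_* g (κ · μ))
      (𝟙-⇔ (κ · μ ~? π 1) (μ ~? π 1) (K-cancel k) (K-· k))))

-- Residues that are a unit or zero at every prime.

module Admissibility {m : ℕ} (A : SRing m) (qd : Quasidense A) (tr : TrivialRadical A) where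
  open Orbits A qd tr public

  Handled : ℕ → ℕ → Set
  Handled N q = 2 < q × q < N

  -- The odd prime divisors of n are treated in increasing order; N bounds those already treated.
  AdmissibleAt : ℕ → ℕ → R → Set
  AdmissibleAt N q x = ¬ D q x ⊎ (¬ Handled N q × (∀ k → q ℕ.^ k ∣ n → D (q ℕ.^ k) x))

  Admissible : ℕ → R → Set
  Admissible N x = ∀ q → Prime q → q ∣ n → AdmissibleAt N q x

  admissible-weaken : ∀ {N x} → Admissible (suc N) x → Admissible N x
  admissible-weaken h q pq q∣n = case h q pq q∣n of λ
    { (inj₁ ¬d) → inj₁ ¬d ; (inj₂ (¬h , d)) → inj₂ ((λ { (p , p′) → ¬h (p , ℕₚ.m<n⇒m<1+n p′) }) , d) }

  D-transfer : ∀ {d x y} → D d (x ⊟ y) → D d y → D d x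
  D-transfer {d} {x} {y} h k = subst (D d) (∔-⊟ x y) (D-∔ h k)

  D-transfer′ : ∀ {d x y} → D d (x ⊟ y) → D d x → D d y
  D-transfer′ {d} {x} {y} h k = subst (D d) (solve 2 (λ x y → x :- (x :- y) := y) refl x y) (D-⊟ k h)

  admissibleAt-transfer : ∀ {N q b x y} → q ∣ b → (∀ k → q ℕ.^ k ∣ n → q ℕ.^ k ∣ b) → D b (x ⊟ y) →
    AdmissibleAt N q y → AdmissibleAt N q x
  admissibleAt-transfer q∣b pow h (inj₁ ¬d) = inj₁ λ d → ¬d (D-transfer′ (D-∣ q∣b h) d)
  admissibleAt-transfer q∣b pow h (inj₂ (¬h , d)) = inj₂ (¬h , λ k qk∣n → D-transfer (D-∣ (pow k qk∣n) h) (d k qk∣n))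

  module Primary {q a b : ℕ} (pq : Prime q) (q∤b : ¬ q ∣ b) (n≡ : n ≡ q ℕ.^ a ℕ.* b) where
    qa∣n : q ℕ.^ a ∣ n
    qa∣n = *≡⇒∣ˡ (q ℕ.^ a) b n≡

    b∣n : b ∣ n
    b∣n = *≡⇒∣ʳ (q ℕ.^ a) b n≡

    primary-coprime : gcd (q ℕ.^ a) b ≡ 1
    primary-coprime = gcd-prime-power pq q∤b a

    D-primary : ∀ {x} → D (q ℕ.^ a) x → D b x → x ≡ π 0
    D-primary {x} h k = D-n (subst (λ v → D v x) (sym n≡) (D-coprime primary-coprime h k))

    prime-cases : ∀ {r} → Prime r → r ∣ n → r ≡ q ⊎ r ∣ b
    prime-cases {r} pr r∣n = case euclidsLemma (q ℕ.^ a) b pr (subst (r ∣_) n≡ r∣n) of λ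
      { (inj₁ r∣qa) → inj₁ (prime∣prime pr pq (prime∣^ pr a r∣qa)) ; (inj₂ r∣b) → inj₂ r∣b }

    power-∣ : ∀ {k} → q ℕ.^ k ∣ n → q ℕ.^ k ∣ q ℕ.^ a
    power-∣ {k} h = gcd≡1-∣ {q ℕ.^ k} {b} {q ℕ.^ a} (gcd-prime-power pq q∤b k) (subst (q ℕ.^ k ∣_) (trans n≡ (ℕₚ.*-comm (q ℕ.^ a) b)) h)

    power-∣-b : ∀ {r} → Prime r → r ≢ q → ∀ k → r ℕ.^ k ∣ n → r ℕ.^ k ∣ b
    power-∣-b {r} pr r≢q k h = gcd≡1-∣ {r ℕ.^ k} {q ℕ.^ a} {b}
      (gcd-prime-power pr (λ r∣qa → r≢q (prime∣prime pr pq (prime∣^ pr a r∣qa))) k) (subst (r ℕ.^ k ∣_) n≡ h)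

    primary-AdmissibleAt : ∀ {N x} → ¬ Handled N q → D (q ℕ.^ a) x → AdmissibleAt N q x
    primary-AdmissibleAt ¬h d = inj₂ (¬h , λ k qk∣n → D-∣ (power-∣ {k} qk∣n) d)

    admissible-modify : ∀ {N x y} → Admissible N y → D b (x ⊟ y) → AdmissibleAt N q x → Admissible N x
    admissible-modify {N} {x} {y} hy h hx r pr r∣n = case r ℕ.≟ q of λ
      { (yes refl) → hx
      ; (no r≢q) → case prime-cases pr r∣n of λ
          { (inj₁ r≡q) → ⊥-elim (r≢q r≡q)
          ; (inj₂ r∣b) → admissibleAt-transfer {N} r∣b (power-∣-b pr r≢q) h (hy r pr r∣n) } }

  abstract
    admissible-regular : ∀ {N x} → Admissible N x → Regular x
    admissible-regular {N} {x} h = record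
      { c = c ; b = b ; n≡ = n≡ ; coprime = gcd≡1 c b (∣n⇒≢0 c∣n) disjoint
      ; D-c = toℕ-D (gcd[m,n]∣n n (toℕ x)) ; is-unit = unit not-D }
      where
      c : ℕ
      c = gcd n (toℕ x)
      c∣n : c ∣ n
      c∣n = gcd[m,n]∣m n (toℕ x)
      b : ℕ
      b = quotient c∣n
      n≡ : n ≡ c ℕ.* b
      n≡ = trans (_∣_.equality c∣n) (ℕₚ.*-comm b c)
      disjoint : ∀ q → Prime q → q ∣ c → q ∣ b → ⊥
      disjoint q pq q∣c (divides b′ b≡) = case h q pq q∣n of λ
        { (inj₁ ¬d) → ¬d (toℕ-D (∣-trans q∣c (gcd[m,n]∣n n (toℕ x))))
        ; (inj₂ (_ , pow)) → case split-prime q pq n n≢0 of λ { (a , d , n≡′ , q∤d) →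
            case gcd-greatest {n} {toℕ x} {q ℕ.^ a} (*≡⇒∣ˡ _ d n≡′) (D-toℕ (*≡⇒∣ˡ _ d n≡′) (pow a (*≡⇒∣ˡ _ d n≡′))) of λ { (divides c′ c≡) →
              q∤d (divides (c′ ℕ.* b′) (ℕₚ.*-cancelˡ-≡ d _ (q ℕ.^ a) {{ℕₚ.m^n≢0 q a {{prime⇒nonZero pq}}}}
                (trans (sym n≡′) (trans n≡ (trans (cong₂ ℕ._*_ c≡ b≡) (rearrange c′ (q ℕ.^ a) b′ q)))))) } } }
        where
        q∣n : q ∣ n
        q∣n = ∣-trans q∣c c∣n
        rearrange : ∀ c′ p b′ q → c′ ℕ.* p ℕ.* (b′ ℕ.* q) ≡ p ℕ.* (c′ ℕ.* b′ ℕ.* q)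
        rearrange c′ p b′ q = trans (cong (ℕ._* (b′ ℕ.* q)) (ℕₚ.*-comm c′ p)) (trans (ℕₚ.*-assoc p c′ (b′ ℕ.* q)) (cong (p ℕ.*_) (sym (ℕₚ.*-assoc c′ b′ q))))
      not-D : ∀ q → Prime q → q ∣ n → ¬ D q (x ∔ π b)
      not-D q pq q∣n d = case q ∣? c of λ
        { (yes q∣c) → disjoint q pq q∣c (D-π q∣n (subst (D q) (solve 2 (λ x b → x :+ b :- x := b) refl x (π b)) (D-⊟ d (D-∣ q∣c (toℕ-D (gcd[m,n]∣n n (toℕ x)))))))
        ; (no q∤c) → q∤c (gcd-greatest q∣n (D-toℕ q∣n (subst (D q) (⊟-∔ x (π b)) (D-⊟ d
            (π-D (case euclidsLemma c b pq (subst (q ∣_) n≡ q∣n) of λ { (inj₁ q∣c) → ⊥-elim (q∤c q∣c) ; (inj₂ q∣b) → q∣b })))))) }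

    -- Modulo an odd prime, x = 1 works unless y is 1, and then x = -1 works since 2 is invertible;
    -- the choices are glued by `crt`. At the prime 2 an odd y admits no such x.
    odd-split : ∀ y b → b ∣ n → ¬ 2 ∣ b → ∃[ x ] (∀ q → Prime q → q ∣ b → ¬ D q x × ¬ D q (y ⊟ x))
    odd-split y = <-rec _ go
      where
      go : ∀ b → (∀ {c} → c < b → c ∣ n → ¬ 2 ∣ c → ∃[ x ] (∀ q → Prime q → q ∣ c → ¬ D q x × ¬ D q (y ⊟ x))) →
           b ∣ n → ¬ 2 ∣ b → ∃[ x ] (∀ q → Prime q → q ∣ b → ¬ D q x × ¬ D q (y ⊟ x))
      go b rec b∣n 2∤b = case b ℕ.≟ 1 of λ
        { (yes refl) → π 0 , λ q pq q∣1 → ⊥-elim (prime∤1 pq q∣1)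
        ; (no b≢1) → case prime-divisor b (∣n⇒≢0 b∣n) b≢1 of λ { (p , pp , p∣b) →
            case split-prime p pp b (∣n⇒≢0 b∣n) of λ
              { (zero , c , b≡ , p∤c) → ⊥-elim (p∤c (subst (p ∣_) (trans b≡ (ℕₚ.*-identityˡ c)) p∣b))
              ; (suc k , c , b≡ , p∤c) → glue p pp k c b≡ p∤c } } }
        where
        local : ∀ p → Prime p → p ∣ b → ∃[ x ] (¬ D p x × ¬ D p (y ⊟ x))
        local p pp p∣b = case D? p (y ⊟ π 1) of λ
          { (no ¬d) → π 1 , ¬D-1 pp p∣n , ¬d
          ; (yes d) → ⊝ π 1 , (λ d′ → ¬D-1 pp p∣n (subst (D p) (-‿involutive (π 1)) (D-⊝ d′))) ,
              λ d′ → 2∤b (subst (_∣ b) (prime∣prime pp prime[2] (D-π p∣n (subst (D p)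
                (solve 1 (λ y → (y :- :- :1) :- (y :- :1) := :2) refl y) (D-⊟ d′ d)))) p∣b) }
          where
          p∣n : p ∣ n
          p∣n = ∣-trans p∣b b∣n
        glue : ∀ p → Prime p → ∀ k c → b ≡ p ℕ.^ suc k ℕ.* c → ¬ p ∣ c → ∃[ x ] (∀ q → Prime q → q ∣ b → ¬ D q x × ¬ D q (y ⊟ x))
        glue p pp k c b≡ p∤c = case rec c<b c∣n (λ 2∣c → 2∤b (∣-trans 2∣c c∣b)) of λ { (x₁ , h₁) →
            case local p pp p∣b of λ { (x₂ , h₂ , h₂′) → case crt (gcd-prime-power pp p∤c (suc k)) x₂ x₁ of λ { (x , e₂ , e₁) →
              x , λ q pq q∣b → case euclidsLemma (p ℕ.^ suc k) c pq (subst (q ∣_) b≡ q∣b) of λ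
                { (inj₁ q∣pk) → subst (λ r → ¬ D r x × ¬ D r (y ⊟ x)) (sym (prime∣prime pq pp (prime∣^ pq (suc k) q∣pk)))
                    (both (D-∣ (m∣m*n (p ℕ.^ k)) e₂) h₂ h₂′)
                ; (inj₂ q∣c) → both (D-∣ q∣c e₁) (proj₁ (h₁ q pq q∣c)) (proj₂ (h₁ q pq q∣c)) } } } }
          where
          c∣b : c ∣ b
          c∣b = *≡⇒∣ʳ (p ℕ.^ suc k) c b≡
          c∣n : c ∣ n
          c∣n = ∣-trans c∣b b∣n
          p∣b : p ∣ b
          p∣b = subst (p ∣_) (sym b≡) (∣-trans (m∣m*n (p ℕ.^ k)) (m∣m*n c))
          c<b : c < b
          c<b = subst (c <_) (trans (ℕₚ.*-comm c (p ℕ.^ suc k)) (sym b≡)) (ℕₚ.m<m*n c (p ℕ.^ suc k) {{ℕ.≢-nonZero (∣n⇒≢0 c∣n)}}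
            (ℕₚ.<-≤-trans (prime>1 pp) (∣⇒≤ {{ℕₚ.m^n≢0 p (suc k) {{prime⇒nonZero pp}}}} (m∣m*n (p ℕ.^ k)))))
          both : ∀ {q x x′} → D q (x ⊟ x′) → ¬ D q x′ → ¬ D q (y ⊟ x′) → ¬ D q x × ¬ D q (y ⊟ x)
          both {q} {x} {x′} e h h′ = (λ d → h (D-transfer′ e d)) ,
            λ d → h′ (subst (D q) (solve 3 (λ y x x′ → y :- x :+ (x :- x′) := y :- x′) refl y x x′) (D-∔ d e))

ℤ-cancel : ∀ a b → a ≢ 0ℤ → a * b ≡ 0ℤ → b ≡ 0ℤ
ℤ-cancel a b a≢0 h = case ℤₚ.i*j≡0⇒i≡0∨j≡0 a (trans (sym (*-def a b)) h) of λ { (inj₁ a≡0) → ⊥-elim (a≢0 a≡0) ; (inj₂ b≡0) → b≡0 }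

-- Vanishing sums: the odd primes.

module Vanishing {m : ℕ} (A : SRing m) (qd : Quasidense A) (tr : TrivialRadical A) where
  open Admissibility A qd tr public

  record IsFamily (F : (R → ℤ) → Set) : Set where
    field
      restrict-closed : ∀ {d f} → d ∣ n → F f → F (restrict d f)
      avg-closed : ∀ {d f} → d ∣ n → F f → F (avg d f)
      orbit-zero : ∀ {f x z} → F f → Regular x → Regular z → ∑ (λ κ → 𝟙K κ * f (z ∔ κ · x)) ≡ 0ℤ

  OddDivisor : ℕ → Set
  OddDivisor q = 2 < q × Prime q × q ∣ n

  M : ℕ → R → Set
  M N κ = K κ × (∀ {q} → q < N → OddDivisor q → D q (κ ⊟ π 1))

  abstract
    M? : ∀ N κ → Dec (M N κ)
    M? N κ = κ ~? π 1 ×-dec ℕₚ.allUpTo? (λ q → (2 ℕ.<? q ×-dec prime? q ×-dec q ∣? n) →-dec D? q (κ ⊟ π 1)) N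

    M-zero : ∀ κ → 𝟙 (M? 0 κ) ≡ 𝟙K κ
    M-zero κ = 𝟙-⇔ (M? 0 κ) (κ ~? π 1) proj₁ (λ k → k , λ ())

    M-suc : ∀ N → OddDivisor N → ∀ κ → 𝟙 (M? (suc N) κ) ≡ 𝟙 (M? N κ) * 𝟙 (D? N (κ ⊟ π 1))
    M-suc N od κ = trans (𝟙-⇔ (M? (suc N) κ) (M? N κ ×-dec D? N (κ ⊟ π 1))
      (λ { (k , h) → (k , λ q<N → h (ℕₚ.m<n⇒m<1+n q<N)) , h (ℕₚ.n<1+n N) od })
      (λ { ((k , h) , d) → k , λ {q} q<1+N od′ → case ℕₚ.m<1+n⇒m<n∨m≡n q<1+N of λ { (inj₁ q<N) → h q<N od′ ; (inj₂ refl) → d } }))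
      (sym (𝟙-× (M? N κ) (D? N (κ ⊟ π 1))))

    M-skip : ∀ N → ¬ OddDivisor N → ∀ κ → 𝟙 (M? (suc N) κ) ≡ 𝟙 (M? N κ)
    M-skip N ¬od κ = 𝟙-⇔ (M? (suc N) κ) (M? N κ)
      (λ { (k , h) → k , λ q<N → h (ℕₚ.m<n⇒m<1+n q<N) })
      (λ { (k , h) → k , λ {q} q<1+N od → case ℕₚ.m<1+n⇒m<n∨m≡n q<1+N of λ { (inj₁ q<N) → h q<N od ; (inj₂ refl) → ⊥-elim (¬od od) } })

  M-sum : ℕ → (R → ℤ) → R → R → ℤ
  M-sum N f z x = ∑ (λ κ → 𝟙 (M? N κ) * f (z ∔ κ · x))

  module _ {F : (R → ℤ) → Set} (fam : IsFamily F) where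
    open IsFamily fam

    Zero : ℕ → Set
    Zero N = ∀ {f x z} → F f → Admissible N x → Admissible N z → M-sum N f z x ≡ 0ℤ

    zero-base : Zero 0
    zero-base {f} {x} {z} Ff hx hz = trans (∑-cong λ κ → cong (_* f (z ∔ κ · x)) (M-zero κ))
      (orbit-zero Ff (admissible-regular hx) (admissible-regular hz))

    -- One odd prime q at a time. With d = q^j b, the average over d ℤ/n of f is treated for
    -- j = 0, 1, …, a: restricting to q ℤ/n picks out κ ≡ 1 (mod q) when j = 0, and the step from j
    -- to j + 1 sums the hypothesis over the pairs (x - t, z + t) with t ∈ d ℤ/n.
    module ZeroStep {q a b : ℕ} (2<q : 2 < q) (pq : Prime q) (q∣n : q ∣ n) (q∤b : ¬ q ∣ b) (n≡ : n ≡ q ℕ.^ a ℕ.* b) (zero-q : Zero q)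
                    {f : R → ℤ} {x z : R} (Ff : F f) (hx : Admissible (suc q) x) (hz : Admissible (suc q) z) where
      open Primary {q} {a} {b} pq q∤b n≡

      private
        not-handled : ¬ Handled q q
        not-handled (_ , q<q) = ℕₚ.<-irrefl refl q<q

        unit-at : ∀ {y} → Admissible (suc q) y → ¬ D q y
        unit-at h = case h q pq q∣n of λ { (inj₁ ¬d) → ¬d ; (inj₂ (¬h , _)) → ⊥-elim (¬h (2<q , ℕₚ.n<1+n q)) }

        x-unit : ¬ D q x
        x-unit = unit-at hx

        S : ℕ → Set
        S j = M-sum (suc q) (avg (q ℕ.^ j ℕ.* b) f) z x ≡ 0ℤ

      base : S 0
      -- `z′` is -x at `q` and `z` at `b`. Then `q` divides z′ + κ x exactly when κ is 1 modulo `q`,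
      -- while `avg b f` does not see the change from `z` to `z′`.
      base = subst (λ d → M-sum (suc q) (avg d f) z x ≡ 0ℤ) (sym (ℕₚ.*-identityˡ b)) (case crt primary-coprime (⊝ x) z of λ { (z′ , e , e′) →
        trans (∑-cong λ κ → trans (cong (_* avg b f (z ∔ κ · x)) (M-suc q (2<q , pq , q∣n) κ)) (trans (ℤR.*-assoc _ _ _)
          (cong₂ (λ u v → 𝟙 (M? q κ) * (u * v)) (restricted z′ e κ) (avg-invariant f (subst (D b)
             (solve 3 (λ z w y → :- (w :- z) := z :+ y :- (w :+ y)) refl z z′ (κ · x)) (D-⊝ e′))))))
          (zero-q (restrict-closed q∣n (avg-closed b∣n Ff)) (admissible-weaken hx)
            (admissible-modify {q} {z′} {z} (admissible-weaken hz) e′ (inj₁ λ d → x-unit (subst (D q) (solve 2 (λ w x → w :- :- x :- w := x) refl z′ x)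
              (D-⊟ (D-∣ q∣qa e) d))))) })
        where
        q∣qa : q ∣ q ℕ.^ a
        q∣qa = subst (_∣ q ℕ.^ a) (ℕₚ.*-identityʳ q) (power-∣ {1} (subst (_∣ n) (sym (ℕₚ.*-identityʳ q)) q∣n))
        restricted : ∀ z′ → D (q ℕ.^ a) (z′ ⊟ ⊝ x) → ∀ κ → 𝟙 (D? q (κ ⊟ π 1)) ≡ 𝟙 (D? q (z′ ∔ κ · x))
        restricted z′ e κ = 𝟙-⇔ (D? q (κ ⊟ π 1)) (D? q (z′ ∔ κ · x))
          (λ d → subst (D q) identity (D-∔ (D-∣ q∣qa e) (D-·ʳ x d)))
          (λ d → case D-prime pq q∣n (subst (D q) identity′ (D-⊟ d (D-∣ q∣qa e))) of λ { (inj₁ d′) → d′ ; (inj₂ d′) → ⊥-elim (x-unit d′) })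
          where
          identity : z′ ⊟ ⊝ x ∔ (κ ⊟ π 1) · x ≡ z′ ∔ κ · x
          identity = solve 3 (λ w x κ → w :- :- x :+ (κ :- :1) :* x := w :+ κ :* x) refl z′ x κ
          identity′ : z′ ∔ κ · x ⊟ (z′ ⊟ ⊝ x) ≡ (κ ⊟ π 1) · x
          identity′ = solve 3 (λ w x κ → w :+ κ :* x :- (w :- :- x) := (κ :- :1) :* x) refl z′ x κ

      module Next {j : ℕ} (d′∣n : q ℕ.^ suc j ℕ.* b ∣ n) (S-j : S j) where
        d d′ : ℕ
        d = q ℕ.^ j ℕ.* b
        d′ = q ℕ.^ suc j ℕ.* b

        d′≡ : d′ ≡ q ℕ.* d
        d′≡ = ℕₚ.*-assoc q (q ℕ.^ j) b

        d∣d′ : d ∣ d′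
        d∣d′ = divides q d′≡

        d∣n : d ∣ n
        d∣n = ∣-trans d∣d′ d′∣n

        b∣d : b ∣ d
        b∣d = n∣m*n (q ℕ.^ j)

        g : R → ℤ
        g = avg d′ f

        -- Translation can make `y` divisible by `q` only when j = 0. Then d′ = q b, and `y` may be
        -- replaced by a residue that is zero at `q`, which is admissible because `q` is not among
        -- the primes handled at bound `q`.
        adjust : ∀ {y y₀} → Admissible (suc q) y₀ → D d (y ⊟ y₀) → ∃[ v ] (Admissible q v × D d′ (v ⊟ y))
        adjust {y} {y₀} h e = case D? q y of λ
          { (no ¬d) → y , admissible-modify {q} (admissible-weaken h) (D-∣ b∣d e) (inj₁ ¬d) , subst (D d′) (sym (CR.-‿inverseʳ y)) D-0
          ; (yes dq) → case crt primary-coprime (π 0) y of λ { (v , ea , eb) →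
              let ea′ = subst (D (q ℕ.^ a)) (solve 1 (λ v → v :- con 0ℤ := v) refl v) ea in
              v , admissible-modify {q} (admissible-weaken h) (subst (D b) (solve 3 (λ v y w → v :- y :+ (y :- w) := v :- w) refl v y y₀) (D-∔ eb (D-∣ b∣d e)))
                (primary-AdmissibleAt {q} not-handled ea′) ,
              small dq ea′ eb } }
          where
          small : ∀ {v} → D q y → D (q ℕ.^ a) v → D b (v ⊟ y) → D d′ (v ⊟ y)
          small {v} dq ea eb = by-exponent j refl
            where
            by-exponent : ∀ i → j ≡ i → D d′ (v ⊟ y)
            by-exponent (suc i) j≡ = ⊥-elim (unit-at h (D-transfer′ (D-∣ (∣-trans (divides (q ℕ.^ i) (trans (cong (q ℕ.^_) j≡) (ℕₚ.*-comm q (q ℕ.^ i)))) (m∣m*n b)) e) dq))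
            by-exponent zero j≡ = subst (λ c → D (c ℕ.* b) (v ⊟ y)) (cong (λ i → q ℕ.^ suc i) (sym j≡))
              (D-coprime (gcd-prime-power pq q∤b 1) (D-⊟ (D-∣ q1∣qa ea) (subst (λ c → D c y) (sym (ℕₚ.*-identityʳ q)) dq)) eb)
              where
              q1∣qa : q ℕ.^ 1 ∣ q ℕ.^ a
              q1∣qa = power-∣ {1} (subst (_∣ n) (sym (ℕₚ.*-identityʳ q)) q∣n)

        -- The argument of `g` equals (z + t) + κ(x - t), and `adjust` makes both terms admissible
        -- without changing it modulo `d′`.
        shifted : ∀ {t} → D d t → ∑ (λ κ → 𝟙 (M? q κ) * g (z ∔ κ · x ∔ (π 1 ⊟ κ) · t)) ≡ 0ℤ
        shifted {t} dt = case adjust {x ⊟ t} {x} hx (subst (D d) (solve 2 (λ x t → :- t := x :- t :- x) refl x t) (D-⊝ dt)) of λ { (x′ , ax , ex) →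
          case adjust {z ∔ t} {z} hz (subst (D d) (solve 2 (λ x t → t := x :+ t :- x) refl z t) dt) of λ { (z′ , az , ez) →
            trans (∑-cong λ κ → cong (𝟙 (M? q κ) *_) (avg-invariant f (subst (D d′)
              (solve 6 (λ x t z κ x′ z′ → :- (z′ :- (z :+ t) :+ κ :* (x′ :- (x :- t))) := z :+ κ :* x :+ (:1 :- κ) :* t :- (z′ :+ κ :* x′)) refl x t z κ x′ z′)
              (D-⊝ (D-∔ ez (D-·ˡ κ ex))))))
              (zero-q (avg-closed d′∣n Ff) ax az) } }

        inner-1 : ∀ {κ} → D q (κ ⊟ π 1) → ∀ w → ∑ (λ t → 𝟙 (D? d t) * g (w ∔ (π 1 ⊟ κ) · t)) ≡ size d * g w
        inner-1 {κ} h w = trans (∑-cong λ t → 𝟙-guard (D? d t) (λ dt → avg-shift f w (subst (λ c → D c ((π 1 ⊟ κ) · t)) (sym d′≡)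
          (D-·· (subst (D q) (solve 1 (λ κ → :- (κ :- :1) := :1 :- κ) refl κ) (D-⊝ h)) dt)))) (sym (∑-*ʳ _ _))

        -- 1 - κ is invertible at `q`; changing it to 1 modulo `b` gives a unit with the same
        -- product with every t in `d` ℤ/n, so the sum is an average over `d` ℤ/n.
        inner-unit : ∀ {κ} → ¬ D q (κ ⊟ π 1) → ∀ w → ∑ (λ t → 𝟙 (D? d t) * g (w ∔ (π 1 ⊟ κ) · t)) ≡ size d′ * avg d f w
        inner-unit {κ} h w = case crt primary-coprime (π 1 ⊟ κ) (π 1) of λ { (u , ea , eb) →
          trans (∑-cong λ t → 𝟙-guard (D? d t) (λ dt → cong (λ v → g (w ∔ v))
            (sym (D-primary-eq (D-·ʳ t ea) (subst (D b) (CR.*-comm t _) (D-·ʳ _ (D-∣ b∣d dt)))))))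
            (trans (avg-scale (is-unit ea eb) g w) (avg-avg d∣d′ f w)) }
          where
          is-unit : ∀ {u} → D (q ℕ.^ a) (u ⊟ (π 1 ⊟ κ)) → D b (u ⊟ π 1) → Unit u
          is-unit {u} ea eb = unit λ r pr r∣n dr → case prime-cases pr r∣n of λ
            { (inj₁ refl) → h (subst (D q) (solve 2 (λ u κ → u :- (:1 :- κ) :- u := κ :- :1) refl u κ)
                (D-⊟ (D-∣ (subst (_∣ q ℕ.^ a) (ℕₚ.*-identityʳ q) (power-∣ {1} (subst (_∣ n) (sym (ℕₚ.*-identityʳ q)) q∣n))) ea) dr))
            ; (inj₂ r∣b) → ¬D-1 pr r∣n (D-transfer′ (D-∣ r∣b eb) dr) }
          D-primary-eq : ∀ {u t} → D (q ℕ.^ a) ((u ⊟ (π 1 ⊟ κ)) · t) → D b ((u ⊟ (π 1 ⊟ κ)) · t) → u · t ≡ (π 1 ⊟ κ) · t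
          D-primary-eq {u} {t} ea eb = trans (solve 3 (λ u v t → u :* t := (u :- v) :* t :+ v :* t) refl u (π 1 ⊟ κ) t)
            (trans (cong (_∔ (π 1 ⊟ κ) · t) (D-primary ea eb)) (CR.+-identityˡ _))

        X Y₀ Y₁ : ℤ
        X = M-sum (suc q) g z x
        Y₀ = M-sum q (avg d f) z x
        Y₁ = M-sum (suc q) (avg d f) z x

        -- The sum of `shifted` over t in `d` ℤ/n, split by whether κ is 1 modulo `q`. As `Y₀` and
        -- `Y₁` vanish by `zero-q` and `S-j`, only `X` remains.
        total : size d * X + size d′ * (Y₀ - Y₁) ≡ 0ℤ
        total = begin
          size d * X + size d′ * (Y₀ - Y₁)
            ≡⟨ cong (λ v → size d * X + size d′ * v) (sym (∑-− _ _)) ⟩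
          size d * X + size d′ * ∑ (λ κ → 𝟙 (M? q κ) * avg d f (v κ) - 𝟙 (M? (suc q) κ) * avg d f (v κ))
            ≡⟨ cong₂ _+_ (∑-*ˡ _ _) (∑-*ˡ _ _) ⟩
          ∑ (λ κ → size d * (𝟙 (M? (suc q) κ) * g (v κ))) + ∑ (λ κ → size d′ * (𝟙 (M? q κ) * avg d f (v κ) - 𝟙 (M? (suc q) κ) * avg d f (v κ)))
            ≡⟨ ∑-+ _ _ ⟨
          ∑ (λ κ → size d * (𝟙 (M? (suc q) κ) * g (v κ)) + size d′ * (𝟙 (M? q κ) * avg d f (v κ) - 𝟙 (M? (suc q) κ) * avg d f (v κ)))
            ≡⟨ ∑-cong (λ κ → trans (cong (λ i → size d * (i * g (v κ)) + size d′ * (𝟙 (M? q κ) * avg d f (v κ) - i * avg d f (v κ))) (M-suc q (2<q , pq , q∣n) κ))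
                 (combine κ (D? q (κ ⊟ π 1)))) ⟩
          ∑ (λ κ → 𝟙 (M? q κ) * ∑ (λ t → 𝟙 (D? d t) * g (v κ ∔ (π 1 ⊟ κ) · t)))
            ≡⟨ ∑-cong (λ κ → trans (∑-*ˡ _ _) (∑-cong λ t → solveℤ 3 (λ a b c → a ⟨*⟩ (b ⟨*⟩ c) ⟨=⟩ b ⟨*⟩ (a ⟨*⟩ c)) refl _ _ _)) ⟩
          ∑ (λ κ → ∑ (λ t → 𝟙 (D? d t) * (𝟙 (M? q κ) * g (v κ ∔ (π 1 ⊟ κ) · t))))
            ≡⟨ ∑-comm _ ⟩
          ∑ (λ t → ∑ (λ κ → 𝟙 (D? d t) * (𝟙 (M? q κ) * g (v κ ∔ (π 1 ⊟ κ) · t))))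
            ≡⟨ ∑-vanish (λ t → trans (sym (∑-*ˡ _ _)) (trans (𝟙-guard (D? d t) shifted) (ℤR.zeroʳ _))) ⟩
          0ℤ ∎
          where
          open ≡-Reasoning
          v : R → R
          v κ = z ∔ κ · x
          combine : ∀ κ (e : Dec (D q (κ ⊟ π 1))) →
            size d * (𝟙 (M? q κ) * 𝟙 e * g (v κ)) + size d′ * (𝟙 (M? q κ) * avg d f (v κ) - 𝟙 (M? q κ) * 𝟙 e * avg d f (v κ)) ≡
            𝟙 (M? q κ) * ∑ (λ t → 𝟙 (D? d t) * g (v κ ∔ (π 1 ⊟ κ) · t))
          combine κ (yes e) = trans (solveℤ 5 (λ s s′ i g h → s ⟨*⟩ (i ⟨*⟩ conℤ 1ℤ ⟨*⟩ g) ⟨+⟩ s′ ⟨*⟩ (i ⟨*⟩ h ⟨-⟩ i ⟨*⟩ conℤ 1ℤ ⟨*⟩ h) ⟨=⟩ i ⟨*⟩ (s ⟨*⟩ g))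
            refl (size d) (size d′) (𝟙 (M? q κ)) (g (v κ)) (avg d f (v κ))) (cong (𝟙 (M? q κ) *_) (sym (inner-1 e (v κ))))
          combine κ (no e) = trans (solveℤ 5 (λ s s′ i g h → s ⟨*⟩ (i ⟨*⟩ conℤ 0ℤ ⟨*⟩ g) ⟨+⟩ s′ ⟨*⟩ (i ⟨*⟩ h ⟨-⟩ i ⟨*⟩ conℤ 0ℤ ⟨*⟩ h) ⟨=⟩ i ⟨*⟩ (s′ ⟨*⟩ h))
            refl (size d) (size d′) (𝟙 (M? q κ)) (g (v κ)) (avg d f (v κ))) (cong (𝟙 (M? q κ) *_) (sym (inner-unit e (v κ))))

        abstract
          next : S (suc j)
          next = ℤ-cancel (size d) X (size≢0 d) (trans (solveℤ 3 (λ s x s′ → s ⟨*⟩ x ⟨=⟩ s ⟨*⟩ x ⟨+⟩ s′ ⟨*⟩ (conℤ 0ℤ ⟨-⟩ conℤ 0ℤ)) refl (size d) X (size d′))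
            (trans (cong₂ (λ u v → size d * X + size d′ * (u - v)) (sym (zero-q (avg-closed d∣n Ff) (admissible-weaken hx) (admissible-weaken hz))) (sym S-j)) total))

      abstract
        conclusion : M-sum (suc q) f z x ≡ 0ℤ
        conclusion = trans (∑-cong λ κ → cong (𝟙 (M? (suc q) κ) *_) (sym (trans (cong (λ d → avg d f (z ∔ κ · x)) (sym n≡)) (avg-n f (z ∔ κ · x)))))
          (all a ∣-refl)
          where
          all : ∀ j → q ℕ.^ j ∣ q ℕ.^ a → S j
          all zero _ = base
          all (suc j) h = Next.next {j} (subst (q ℕ.^ suc j ℕ.* b ∣_) (sym n≡) (*-monoˡ-∣ b h)) (all j (∣-trans (n∣m*n q) h))

    zero-all : ∀ N → Zero N
    zero-all zero = zero-base
    zero-all (suc N) {f} {x} {z} Ff hx hz = case 2 ℕ.<? N ×-dec prime? N ×-dec N ∣? n of λ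
      { (yes (2<N , pN , N∣n)) → case split-prime N pN n n≢0 of λ { (a , b , n≡ , N∤b) → ZeroStep.conclusion {N} {a} {b} 2<N pN N∣n N∤b n≡ (zero-all N) Ff hx hz }
      ; (no ¬od) → trans (∑-cong λ κ → cong (_* f (z ∔ κ · x)) (M-skip N ¬od κ)) (zero-all N Ff (admissible-weaken hx) (admissible-weaken hz)) }

-- Vanishing of families: the prime 2.

module FamilyVanishing {m : ℕ} (A : SRing m) (qd : Quasidense A) (tr : TrivialRadical A) where
  open Vanishing A qd tr public

  -- `d` ℤ/n is the disjoint union of 2d ℤ/n and its translate by d.
  avg-halves : ∀ {d} f → 2 ℕ.* d ∣ n → ∀ y → avg d f y ≡ avg (2 ℕ.* d) f y + avg (2 ℕ.* d) f (y ∔ π d)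
  avg-halves {d} f 2d∣n y = trans (∑-cong λ t → trans (cong (_* f (y ∔ t)) (split t)) (ℤR.distribʳ _ _ _))
    (trans (∑-+ _ _) (cong (avg (2 ℕ.* d) f y +_) (trans (∑-shift (π d) _) (∑-cong λ t → cong₂ _*_
      (cong (λ v → 𝟙 (D? (2 ℕ.* d) v)) (⊟-∔ t (π d))) (cong f (solve 3 (λ y t d → y :+ (t :+ d) := y :+ d :+ t) refl y t (π d)))))))
    where
    d∣2d : d ∣ 2 ℕ.* d
    d∣2d = n∣m*n 2
    d∤ : ¬ D (2 ℕ.* d) (π d)
    d∤ h = ℕₚ.<⇒≱ (subst (d <_) (ℕₚ.*-comm d 2) (ℕₚ.m<m*n d 2 {{nz}} (s≤s (s≤s z≤n)))) (∣⇒≤ {{nz}} (D-π 2d∣n h))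
      where
      nz : NonZero d
      nz = ℕ.≢-nonZero (∣n⇒≢0 (∣-trans d∣2d 2d∣n))
    2d≡ : π d · π 2 ≡ π (2 ℕ.* d)
    2d≡ = trans (CR.*-comm _ _) (sym (π-* 2 d))
    even-or-odd : ∀ {t} → D d t → D (2 ℕ.* d) t ⊎ D (2 ℕ.* d) (t ⊟ π d)
    even-or-odd {t} (v , t≡) = case D? 2 v of λ
      { (yes (w , v≡)) → inj₁ (w , trans t≡ (trans (cong (π d ·_) v≡) (trans (sym (CR.*-assoc _ _ w)) (cong (_· w) 2d≡))))
      ; (no ¬d) → case odd-element v ¬d of λ { (w , v≡) → inj₂ (w , trans (cong (_⊟ π d) (trans t≡ (cong (π d ·_) v≡)))
          (trans (solve 2 (λ d w → d :* (:1 :+ :2 :* w) :- d := d :* :2 :* w) refl (π d) w) (cong (_· w) 2d≡))) } }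
    split : ∀ t → 𝟙 (D? d t) ≡ 𝟙 (D? (2 ℕ.* d) t) + 𝟙 (D? (2 ℕ.* d) (t ⊟ π d))
    split t = by-cases (D? (2 ℕ.* d) t) (D? (2 ℕ.* d) (t ⊟ π d))
      where
      by-cases : (e : Dec (D (2 ℕ.* d) t)) (e′ : Dec (D (2 ℕ.* d) (t ⊟ π d))) → 𝟙 (D? d t) ≡ 𝟙 e + 𝟙 e′
      by-cases (yes p) (yes p′) = ⊥-elim (d∤ (subst (D (2 ℕ.* d)) (solve 2 (λ t d → t :- (t :- d) := d) refl t (π d)) (D-⊟ p p′)))
      by-cases (yes p) (no _) = trans (𝟙-yes (D? d t) (D-∣ d∣2d p)) (sym (ℤR.+-identityʳ 1ℤ))
      by-cases (no _) (yes p′) = trans (𝟙-yes (D? d t) (subst (D d) (∔-⊟ t (π d)) (D-∔ (D-∣ d∣2d p′) (D-self d)))) (sym (ℤR.+-identityˡ 1ℤ))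
      by-cases (no ¬p) (no ¬p′) = trans (𝟙-no (D? d t) λ h → case even-or-odd h of λ { (inj₁ p) → ¬p p ; (inj₂ p) → ¬p′ p }) (sym (ℤR.+-identityˡ 0ℤ))

  double-zero : ∀ {x} → x + x ≡ 0ℤ → x ≡ 0ℤ
  double-zero {x} h = ℤ-cancel (ℤ.+ 2) x (λ ()) (trans (solveℤ 1 (λ x → conℤ (ℤ.+ 2) ⟨*⟩ x ⟨=⟩ x ⟨+⟩ x) refl x) h)

  K-odd : ∀ {κ} → 2 ∣ n → K κ → D 2 (κ ⊟ π 1)
  K-odd {κ} 2∣n k = case odd-element κ (K-¬D k prime[2] 2∣n) of λ { (y , eq) → y , trans (cong (_⊟ π 1) eq)
    (solve 2 (λ o y → o :+ y :- o := y) refl (π 1) (π 2 · y)) }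

  Final : R → Set
  Final = M (suc n)

  final-divisible : ∀ {κ} → Final κ → PrimeDivisible (κ ⊟ π 1)
  final-divisible (k , h) p pp p∣n = case p ℕ.≟ 2 of λ
    { (yes refl) → K-odd p∣n k
    ; (no p≢2) → h (s≤s (∣⇒≤ p∣n)) (ℕₚ.≤∧≢⇒< (prime>1 pp) (p≢2 ∘ sym) , pp , p∣n) }

  module _ {F : (R → ℤ) → Set} (fam : IsFamily F) where
    open IsFamily fam

    module TwoAdic {a b : ℕ} (2∤b : ¬ 2 ∣ b) (n≡ : n ≡ 2 ℕ.^ a ℕ.* b) where
      open Primary {2} {a} {b} prime[2] 2∤b n≡

      Local : R → Set
      Local x = ¬ D 2 x ⊎ D (2 ℕ.^ a) x

      local-admissible : ∀ {x} → Local x → AdmissibleAt (suc n) 2 x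
      local-admissible (inj₁ ¬d) = inj₁ ¬d
      local-admissible (inj₂ d) = primary-AdmissibleAt {suc n} (λ { (2<2 , _) → ℕₚ.<-irrefl refl 2<2 }) d

      2∣2a : 2 ∣ n → 2 ∣ 2 ℕ.^ a
      2∣2a 2∣n = power-∣ {1} 2∣n

      -- At 2 the summand is prescribed by `x₂`; at the odd primes `odd-split` makes both summands
      -- units.
      decompose : ∀ y x₂ → Local x₂ → Local (y ⊟ x₂) →
        ∃[ x ] (Admissible (suc n) x × Admissible (suc n) (y ⊟ x) × D (2 ℕ.^ a) (x ⊟ x₂))
      decompose y x₂ l l′ = case odd-split y b b∣n 2∤b of λ { (x₁ , h) → case crt primary-coprime x₂ x₁ of λ { (x , ea , eb) →
        x , (λ q pq q∣n → case prime-cases pq q∣n of λ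
          { (inj₁ refl) → admissibleAt-transfer {suc n} (2∣2a q∣n) (λ k → power-∣ {k}) ea (local-admissible l)
          ; (inj₂ q∣b) → inj₁ λ d → proj₁ (h q pq q∣b) (D-transfer′ (D-∣ q∣b eb) d) }) ,
        (λ q pq q∣n → case prime-cases pq q∣n of λ
          { (inj₁ refl) → admissibleAt-transfer {suc n} (2∣2a q∣n) (λ k → power-∣ {k}) (difference ea) (local-admissible l′)
          ; (inj₂ q∣b) → inj₁ λ d → proj₂ (h q pq q∣b) (D-transfer′ (D-∣ q∣b (difference eb)) d) }) , ea } }
        where
        difference : ∀ {d x x′} → D d (x ⊟ x′) → D d (y ⊟ x ⊟ (y ⊟ x′))
        difference {d} {x} {x′} h = subst (D d) (solve 3 (λ y x x′ → :- (x :- x′) := y :- x :- (y :- x′)) refl y x x′) (D-⊝ h)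

      even-minus-1 : 2 ∣ n → ∀ {y} → D 2 y → ¬ D 2 (y ⊟ π 1)
      even-minus-1 2∣n {y} d d′ = ¬D-1 prime[2] 2∣n (subst (D 2) (solve 2 (λ y o → y :- (y :- o) := o) refl y (π 1)) (D-⊟ d d′))

      minus-0 : ∀ {P : R → Set} {y} → P y → P (y ⊟ π 0)
      minus-0 {P} {y} = subst P (solve 1 (λ y → y := y :- con 0ℤ) refl y)

      -- If 2 does not divide n then every residue is zero modulo 2^a = 1.
      local-or-even : ∀ y → Local y ⊎ (2 ∣ n × D 2 y)
      local-or-even y = case D? 2 y of λ
        { (no ¬d) → inj₁ (inj₁ ¬d)
        ; (yes d) → by-exponent a refl d }
        where
        by-exponent : ∀ k → a ≡ k → D 2 y → Local y ⊎ (2 ∣ n × D 2 y)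
        by-exponent zero refl d = inj₁ (inj₂ (D-1 y))
        by-exponent (suc k) a≡ d = inj₂ (subst (2 ∣_) (trans (cong (λ j → 2 ℕ.^ j ℕ.* b) (sym a≡)) (sym n≡))
          (∣-trans (m∣m*n (2 ℕ.^ k)) (m∣m*n b)) , d)

      module Trivial (only : ∀ κ → Final κ → κ ≡ π 1) where
        vanish-at : ∀ {f x} → F f → ∀ y → Admissible (suc n) x → Admissible (suc n) (y ⊟ x) → f y ≡ 0ℤ
        vanish-at {f} {x} Ff y ax az = trans (sym (trans (∑-cong λ κ → cong (_* f (y ⊟ x ∔ κ · x))
            (𝟙-⇔ (M? (suc n) κ) (κ ≟F π 1) (only κ) (λ { refl → K-1 , λ _ _ → subst (D _) (sym (CR.-‿inverseʳ (π 1))) D-0 })))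
          (trans (∑-δ (π 1) _) (cong f (trans (cong (y ⊟ x ∔_) (CR.*-identityˡ x)) (∔-⊟ y x))))))
          (zero-all fam (suc n) Ff ax az)

        vanish : ∀ {f} → F f → ∀ y → f y ≡ 0ℤ
        -- At the prime 2 a local y is split as 0 + y, and an even one as 1 + (y - 1), a sum of two
        -- odd residues.
        vanish {f} Ff y = case local-or-even y of λ
          { (inj₁ l) → case decompose y (π 0) (inj₂ D-0) (minus-0 {Local} l) of λ { (x , ax , az , _) → vanish-at Ff y ax az }
          ; (inj₂ (2∣n , d)) → case decompose y (π 1) (inj₁ (¬D-1 prime[2] 2∣n)) (inj₁ (even-minus-1 2∣n d)) of λ { (x , ax , az , _) → vanish-at Ff y ax az } }

      -- Here the elements of K that are ≡ 1 modulo all odd primes are 1 and k₀, and k₀ ≡ 3 (mod 4).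
      module Pair {k₀ : R} (fk₀ : Final k₀) (k₀≢1 : k₀ ≢ π 1) where
        by-4 : ∀ {κ} → Final κ → κ ≡ π 1 ⊎ (4 ∣ n × D 4 (κ ∔ π 1))
        by-4 {κ} fκ = case 4 ∣? n of λ
          { (no 4∤n) → inj₁ (K-trivial (proj₁ fκ) (final-divisible fκ) (λ 4∣n → ⊥-elim (4∤n 4∣n)))
          ; (yes 4∣n) → case odd-mod4 κ (K-¬D (proj₁ fκ) prime[2] (∣-trans (divides 2 refl) 4∣n)) of λ
              { (inj₁ d) → inj₁ (K-trivial (proj₁ fκ) (final-divisible fκ) (λ _ → d)) ; (inj₂ d) → inj₂ (4∣n , d) } }

        4∣n : 4 ∣ n
        4∣n = case by-4 fk₀ of λ { (inj₁ eq) → ⊥-elim (k₀≢1 eq) ; (inj₂ (h , _)) → h }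

        2∣n : 2 ∣ n
        2∣n = ∣-trans (divides 2 refl) 4∣n

        k₀≡3 : D 4 (k₀ ∔ π 1)
        k₀≡3 = case by-4 fk₀ of λ { (inj₁ eq) → ⊥-elim (k₀≢1 eq) ; (inj₂ (_ , h)) → h }

        product : ∀ {κ μ} → Final κ → Final μ → D 4 (κ ∔ π 1) → D 4 (μ ∔ π 1) → κ · μ ≡ π 1
        product {κ} {μ} fκ fμ d e = K-trivial (K-· (proj₁ fκ) (proj₁ fμ))
          (λ p pp p∣n → subst (D p) (solve 2 (λ κ μ → (κ :- :1) :* μ :+ (μ :- :1) := κ :* μ :- :1) refl κ μ)
            (D-∔ (D-·ʳ μ (final-divisible fκ p pp p∣n)) (final-divisible fμ p pp p∣n)))
          (λ _ → subst (D 4) (solve 2 (λ κ μ → (κ :+ :1) :* μ :- (μ :+ :1) := κ :* μ :- :1) refl κ μ) (D-⊟ (D-·ʳ μ d) e))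

        cases : ∀ {κ} → Final κ → κ ≡ π 1 ⊎ κ ≡ k₀
        cases {κ} fκ = case by-4 fκ of λ { (inj₁ eq) → inj₁ eq
          ; (inj₂ (_ , d)) → inj₂ (unit-cancel (K-unit (proj₁ fk₀)) (trans (product fk₀ fκ k₀≡3 d) (sym (product fk₀ fk₀ k₀≡3 k₀≡3)))) }

        -- (k₀ + 1)(k₀ - 1) = 0, and k₀ + 1 is prime to `b`, being 2 modulo each prime divisor of
        -- `b`.
        k₀≡1-b : D b (k₀ ⊟ π 1)
        k₀≡1-b = D-coprime-cancel {b} {c} (trans (gcd-comm c b) (gcd≡1 b c (∣n⇒≢0 b∣n) λ p pp p∣b p∣c →
            2∤b (subst (_∣ b) (prime∣prime pp prime[2] (D-π (∣-trans p∣b b∣n) (subst (D p)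
              (solve 1 (λ k → (k :+ :1) :- (k :- :1) := :2) refl k₀)
              (D-⊟ (toℕ-D p∣c) (final-divisible fk₀ p pp (∣-trans p∣b b∣n)))))) p∣b)))
          (subst (D b) (sym (trans (cong (_· (k₀ ⊟ π 1)) (π-toℕ (k₀ ∔ π 1))) (trans
            (solve 1 (λ k → (k :+ :1) :* (k :- :1) := k :* k :- :1) refl k₀)
            (trans (cong (_⊟ π 1) (product fk₀ fk₀ k₀≡3 k₀≡3)) (CR.-‿inverseʳ (π 1)))))) D-0)
          where
          c : ℕ
          c = toℕ (k₀ ∔ π 1)

        pair-sum : ∀ (h : R → ℤ) → ∑ (λ κ → 𝟙 (M? (suc n) κ) * h κ) ≡ h (π 1) + h k₀
        pair-sum h = trans (∑-cong λ κ → trans (cong (_* h κ) (split κ (κ ≟F π 1) (κ ≟F k₀))) (ℤR.distribʳ _ _ _))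
          (trans (∑-+ _ _) (cong₂ _+_ (∑-δ (π 1) h) (∑-δ k₀ h)))
          where
          split : ∀ κ (e : Dec (κ ≡ π 1)) (e′ : Dec (κ ≡ k₀)) → 𝟙 (M? (suc n) κ) ≡ 𝟙 e + 𝟙 e′
          split κ (yes p) (yes p′) = ⊥-elim (k₀≢1 (trans (sym p′) p))
          split κ (yes refl) (no _) = trans (𝟙-yes (M? (suc n) (π 1)) (K-1 , λ _ _ → subst (D _) (sym (CR.-‿inverseʳ (π 1))) D-0)) (sym (ℤR.+-identityʳ 1ℤ))
          split κ (no _) (yes refl) = trans (𝟙-yes (M? (suc n) k₀) fk₀) (sym (ℤR.+-identityˡ 1ℤ))
          split κ (no ¬p) (no ¬p′) = trans (𝟙-no (M? (suc n) κ) λ fκ → case cases fκ of λ { (inj₁ p) → ¬p p ; (inj₂ p) → ¬p′ p }) (sym (ℤR.+-identityˡ 0ℤ))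

        pair-zero : ∀ {f x} → F f → ∀ y → Admissible (suc n) x → Admissible (suc n) (y ⊟ x) → f y + f (y ⊟ x ∔ k₀ · x) ≡ 0ℤ
        pair-zero {f} {x} Ff y ax az = trans (cong (_+ f (y ⊟ x ∔ k₀ · x)) (cong f (sym (trans (cong (y ⊟ x ∔_) (CR.*-identityˡ x)) (∔-⊟ y x)))))
          (trans (sym (pair-sum (λ κ → f (y ⊟ x ∔ κ · x)))) (zero-all fam (suc n) Ff ax az))

        -- The summand x can be chosen zero at 2. As `k₀` is 1 modulo `b`, it fixes x, and both
        -- terms of `pair-zero` equal `f y`.
        local-zero : ∀ {f} → F f → ∀ {y} → Local y → f y ≡ 0ℤ
        local-zero {f} Ff {y} l = case decompose y (π 0) (inj₂ D-0) (minus-0 {Local} l) of λ { (x , ax , az , e) →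
          double-zero (trans (cong (λ v → f y + f v) (sym (trans (cong (y ⊟ x ∔_) (fixed (subst (D (2 ℕ.^ a)) (solve 1 (λ v → v :- con 0ℤ := v) refl x) e))) (∔-⊟ y x))))
            (pair-zero Ff y ax az)) }
          where
          fixed : ∀ {x} → D (2 ℕ.^ a) x → k₀ · x ≡ x
          fixed {x} d = trans (solve 2 (λ k x → k :* x := (k :- :1) :* x :+ x) refl k₀ x)
            (trans (cong (_∔ x) (D-primary (D-·ˡ _ d) (D-·ʳ x k₀≡1-b))) (CR.+-identityˡ x))

        AvgZero : ℕ → Set
        AvgZero d = ∀ {f} → F f → ∀ y → avg d f y ≡ 0ℤ

        b-odd : ¬ D 2 (π b)
        b-odd d = 2∤b (D-π 2∣n d)

        -- y can be moved to a multiple of 2^a without changing averages over 2^j b ℤ/n.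
        reduce : ∀ {j f y} → 2 ℕ.^ j ∣ 2 ℕ.^ a → D (2 ℕ.^ j) y → F f → avg (2 ℕ.^ j ℕ.* b) f y ≡ 0ℤ
        reduce {j} {f} {y} h d Ff = case crt primary-coprime (π 0) y of λ { (y′ , ea , eb) →
          let ea′ = subst (D (2 ℕ.^ a)) (solve 1 (λ v → v :- con 0ℤ := v) refl y′) ea in
          trans (sym (avg-invariant {2 ℕ.^ j ℕ.* b} {y′} {y} f (D-coprime (gcd-prime-power prime[2] 2∤b j) (D-⊟ (D-∣ h ea′) d) eb)))
            (local-zero (avg-closed (subst (2 ℕ.^ j ℕ.* b ∣_) (sym n≡) (*-monoˡ-∣ b h)) Ff) (inj₂ ea′)) }

        suc-exponent : ∀ j → 2 ℕ.^ suc j ℕ.* b ≡ 2 ℕ.* (2 ℕ.^ j ℕ.* b)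
        suc-exponent j = ℕₚ.*-assoc 2 (2 ℕ.^ j) b

        -- Averages over `b` ℤ/n are invariant under translation by the odd number b, which makes an
        -- even y odd.
        avg-zero-0 : AvgZero (2 ℕ.^ 0 ℕ.* b)
        avg-zero-0 {f} Ff y = case D? 2 y of λ
          { (no ¬d) → local-zero (avg-closed d∣n Ff) (inj₁ ¬d)
          ; (yes d) → trans (sym (avg-shift f y (π-D {2 ℕ.^ 0 ℕ.* b} (divides 1 (sym (trans (ℕₚ.*-identityˡ _) (ℕₚ.*-identityˡ b)))))))
              (local-zero (avg-closed d∣n Ff) (inj₁ λ d′ → b-odd (subst (D 2) (solve 2 (λ y b → y :+ b :- y := b) refl y (π b)) (D-⊟ d′ d)))) }
          where
          d∣n : 2 ℕ.^ 0 ℕ.* b ∣ n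
          d∣n = subst (_∣ n) (sym (ℕₚ.*-identityˡ b)) b∣n

        avg-zero-1 : 2 ℕ.^ 1 ∣ 2 ℕ.^ a → AvgZero (2 ℕ.^ 1 ℕ.* b)
        avg-zero-1 h Ff y = case D? 2 y of λ
          { (no ¬d) → local-zero (avg-closed (subst (2 ℕ.^ 1 ℕ.* b ∣_) (sym n≡) (*-monoˡ-∣ b h)) Ff) (inj₁ ¬d)
          ; (yes d) → reduce {1} h d Ff }

        -- The case left by `local-zero` and `reduce` is y ≡ 2 (mod 4). There y + 2b is divisible by
        -- 4, and `avg-halves` relates the averages at these two points to an average over 2b ℤ/n.
        avg-zero-2 : 2 ℕ.^ 2 ∣ 2 ℕ.^ a → AvgZero (2 ℕ.^ 2 ℕ.* b)
        avg-zero-2 h {f} Ff y = case D? 2 y of λ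
          { (no ¬d) → local-zero (avg-closed d∣n Ff) (inj₁ ¬d)
          ; (yes d) → case D? 4 y of λ
            { (yes d4) → reduce {2} h d4 Ff
            ; (no ¬d4) → subst (λ c → avg c f y ≡ 0ℤ) (sym (suc-exponent 1)) (trans (solveℤ 2 (λ u v → u ⟨=⟩ u ⟨+⟩ v ⟨-⟩ v) refl (avg (2 ℕ.* (2 ℕ.^ 1 ℕ.* b)) f y) (avg (2 ℕ.* (2 ℕ.^ 1 ℕ.* b)) f (y ∔ π (2 ℕ.^ 1 ℕ.* b))))
                (trans (cong₂ _-_ (trans (sym (avg-halves f (subst (_∣ n) (suc-exponent 1) d∣n) y)) (avg-zero-1 (∣-trans (divides 2 refl) h) Ff y))
                    (subst (λ c → avg c f (y ∔ π (2 ℕ.^ 1 ℕ.* b)) ≡ 0ℤ) (suc-exponent 1) (reduce {2} h (shift d ¬d4) Ff)))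
                  (solveℤ 0 (conℤ 0ℤ ⟨-⟩ conℤ 0ℤ ⟨=⟩ conℤ 0ℤ) refl))) } }
          where
          d∣n : 2 ℕ.^ 2 ℕ.* b ∣ n
          d∣n = subst (2 ℕ.^ 2 ℕ.* b ∣_) (sym n≡) (*-monoˡ-∣ b h)
          shift : D 2 y → ¬ D 4 y → D 4 (y ∔ π (2 ℕ.^ 1 ℕ.* b))
          shift (v , y≡) ¬d4 = case odd-element v (λ { (w , v≡) → ¬d4 (w , trans y≡ (trans (cong (π 2 ·_) v≡) (solve 1 (λ w → :2 :* (:2 :* w) := :4 :* w) refl w))) }) of λ { (w , v≡) →
            case odd-element (π b) b-odd of λ { (w′ , b≡) → π 1 ∔ w ∔ w′ , trans (cong₂ _∔_ (trans y≡ (cong (π 2 ·_) v≡)) (trans (π-* 2 b) (cong (π 2 ·_) b≡)))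
              (solve 2 (λ w w′ → :2 :* (:1 :+ :2 :* w) :+ :2 :* (:1 :+ :2 :* w′) := :4 :* (:1 :+ w :+ w′)) refl w w′) } }

        -- Put v = y - x + k₀ x. Applying `pair-zero` to x and to x - t, with t = d/2, gives g(y) +
        -- g(v) = 0 and g(y) + g(v + d) = 0, because (1 - k₀)t ≡ 2t = d modulo d′ = 4t. The
        -- induction hypothesis gives g(v) + g(v + d) = 0, so 2g(y) = 0. From exponent 3 on, t is
        -- even and x - t stays odd.
        avg-zero-suc : ∀ i → 2 ℕ.^ (3 ℕ.+ i) ∣ 2 ℕ.^ a → AvgZero (2 ℕ.^ (2 ℕ.+ i) ℕ.* b) → AvgZero (2 ℕ.^ (3 ℕ.+ i) ℕ.* b)
        avg-zero-suc i h ih {f} Ff y = case D? 2 y of λ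
          { (no ¬d) → local-zero (avg-closed d′∣n Ff) (inj₁ ¬d)
          ; (yes even) → case decompose y (π 1) (inj₁ (¬D-1 prime[2] 2∣n)) (inj₁ (even-minus-1 2∣n even)) of λ { (x , ax , az , e) →
              double-zero (trans (solveℤ 3 (λ u v v′ → u ⟨+⟩ u ⟨=⟩ u ⟨+⟩ v ⟨+⟩ (u ⟨+⟩ v′) ⟨-⟩ (v ⟨+⟩ v′)) refl (g y) (g (y ⊟ x ∔ k₀ · x)) (g (y ⊟ x ∔ k₀ · x ∔ π d)))
                (trans (cong₂ _-_ (cong₂ _+_ (pair-zero (avg-closed d′∣n Ff) y ax az) (shifted even ax az e)) (halves (y ⊟ x ∔ k₀ · x)))
                  (solveℤ 0 (conℤ 0ℤ ⟨+⟩ conℤ 0ℤ ⟨-⟩ conℤ 0ℤ ⟨=⟩ conℤ 0ℤ) refl))) } }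
          where
          d d′ s : ℕ
          d = 2 ℕ.^ (2 ℕ.+ i) ℕ.* b
          d′ = 2 ℕ.^ (3 ℕ.+ i) ℕ.* b
          s = 2 ℕ.^ (1 ℕ.+ i) ℕ.* b
          g : R → ℤ
          g = avg d′ f
          t : R
          t = π s
          d′∣n : d′ ∣ n
          d′∣n = subst (d′ ∣_) (sym n≡) (*-monoˡ-∣ b h)
          halves : ∀ v → g v + g (v ∔ π d) ≡ 0ℤ
          halves v = subst (λ c → avg c f v + avg c f (v ∔ π d) ≡ 0ℤ) (sym (suc-exponent (2 ℕ.+ i)))
            (trans (sym (avg-halves f (subst (_∣ n) (suc-exponent (2 ℕ.+ i)) d′∣n) v)) (ih Ff v))
          2t : π 2 · t ≡ π d
          2t = trans (sym (π-* 2 s)) (cong π (sym (suc-exponent (1 ℕ.+ i))))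
          D2-t : D 2 t
          D2-t = π-D (∣-trans (m∣m*n (2 ℕ.^ i)) (m∣m*n b))
          Db-t : D b t
          Db-t = π-D (n∣m*n (2 ℕ.^ (1 ℕ.+ i)))
          D-k₀t : D d′ ((π 1 ⊟ k₀) · t ⊟ π d)
          D-k₀t = subst (D d′) (trans (solve 2 (λ k t → :- ((k :+ :1) :* t) := (:1 :- k) :* t :- :2 :* t) refl k₀ t) (cong ((π 1 ⊟ k₀) · t ⊟_) 2t))
            (D-⊝ (subst (λ c → D c ((k₀ ∔ π 1) · t)) 4s≡ (D-·· k₀≡3 (D-self s))))
            where
            4s≡ : 4 ℕ.* s ≡ d′
            4s≡ = trans (ℕₚ.*-assoc 2 2 s) (trans (cong (2 ℕ.*_) (sym (suc-exponent (1 ℕ.+ i)))) (sym (suc-exponent (2 ℕ.+ i))))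
          odd-shift : ∀ {x x′} → D b (x′ ⊟ x) → ¬ D 2 x′ → Admissible (suc n) x → Admissible (suc n) x′
          odd-shift e ¬d ax = admissible-modify {suc n} ax e (inj₁ ¬d)
          shifted : ∀ {x} → D 2 y → Admissible (suc n) x → Admissible (suc n) (y ⊟ x) → D (2 ℕ.^ a) (x ⊟ π 1) →
            g y + g (y ⊟ x ∔ k₀ · x ∔ π d) ≡ 0ℤ
          shifted {x} even ax az e = trans (cong (g y +_) (avg-invariant f (subst (D d′)
              (solve 5 (λ y x k t d → :- ((:1 :- k) :* t :- d) := y :- x :+ k :* x :+ d :- (y :- (x :- t) :+ k :* (x :- t))) refl y x k₀ t (π d)) (D-⊝ D-k₀t))))
            (pair-zero (avg-closed d′∣n Ff) y
              (odd-shift {x} {x ⊟ t} (subst (D b) (solve 2 (λ x t → :- t := x :- t :- x) refl x t) (D-⊝ Db-t))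
                (λ d → x-odd (subst (D 2) (∔-⊟ x t) (D-∔ d D2-t))) ax)
              (odd-shift {y ⊟ x} {y ⊟ (x ⊟ t)} (subst (D b) (solve 3 (λ y x t → t := y :- (x :- t) :- (y :- x)) refl y x t) Db-t)
                (λ d → z-odd (subst (D 2) (solve 3 (λ y x t → y :- (x :- t) :- t := y :- x) refl y x t) (D-⊟ d D2-t))) az))
            where
            x-odd : ¬ D 2 x
            x-odd d = ¬D-1 prime[2] 2∣n (D-transfer′ (D-∣ (2∣2a 2∣n) e) d)
            z-odd : ¬ D 2 (y ⊟ x)
            z-odd d = x-odd (subst (D 2) (solve 2 (λ y x → y :- (y :- x) := x) refl y x) (D-⊟ even d))

        avg-zero : ∀ j → 2 ℕ.^ j ∣ 2 ℕ.^ a → AvgZero (2 ℕ.^ j ℕ.* b)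
        avg-zero zero _ = avg-zero-0
        avg-zero (suc zero) h = avg-zero-1 h
        avg-zero (suc (suc zero)) h = avg-zero-2 h
        avg-zero (suc (suc (suc i))) h = avg-zero-suc i h (avg-zero (suc (suc i)) (∣-trans (n∣m*n 2) h))

        vanish : ∀ {f} → F f → ∀ y → f y ≡ 0ℤ
        vanish {f} Ff y = trans (sym (avg-n f y)) (subst (λ c → avg c f y ≡ 0ℤ) (sym n≡) (avg-zero a ∣-refl Ff y))

    abstract
      family-zero : ∀ {f} → F f → ∀ y → f y ≡ 0ℤ
      family-zero Ff y = case split-prime 2 prime[2] n n≢0 of λ { (a , b , n≡ , 2∤b) →
        case any? (λ κ → M? (suc n) κ ×-dec ¬? (κ ≟F π 1)) of λ
          { (yes (k₀ , fk₀ , k₀≢1)) → TwoAdic.Pair.vanish {a} {b} 2∤b n≡ fk₀ k₀≢1 Ff y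
          ; (no none) → TwoAdic.Trivial.vanish {a} {b} 2∤b n≡
              (λ κ fκ → case κ ≟F π 1 of λ { (yes eq) → eq ; (no ≢1) → ⊥-elim (none (κ , fκ , ≢1)) }) Ff y } }

-- Basic sets are `K`-orbits.

module BlocksAreOrbits {m : ℕ} (A : SRing m) (qd : Quasidense A) (tr : TrivialRadical A) where
  open FamilyVanishing A qd tr

  private
    Difference : R → (R → ℤ) → Set
    Difference κ f = ∃[ φ ] (AFun φ × (∀ w → f w ≡ φ w - φ (κ · w)))

    difference-family : ∀ {κ} → K κ → IsFamily (Difference κ)
    difference-family {κ} k = record
      { restrict-closed = λ { {d} {f} d∣n (φ , hφ , eq) → restrict d φ , restrict-AFun d∣n hφ , λ w →
          trans (cong (𝟙 (D? d w) *_) (eq w)) (trans (solveℤ 3 (λ i u v → i ⟨*⟩ (u ⟨-⟩ v) ⟨=⟩ i ⟨*⟩ u ⟨-⟩ i ⟨*⟩ v) refl (𝟙 (D? d w)) (φ w) (φ (κ · w)))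
            (cong (λ i → 𝟙 (D? d w) * φ w - i * φ (κ · w)) (𝟙-⇔ (D? d w) (D? d (κ · w)) (D-·ˡ κ) (D-unit (K-unit k))))) }
      ; avg-closed = λ { {d} {f} d∣n (φ , hφ , eq) → avg d φ , avg-AFun d∣n hφ , λ w →
          trans (∑-cong λ t → cong (𝟙 (D? d t) *_) (eq (w ∔ t))) (trans (avg-− d φ (λ v → φ (κ · v)) w)
            (cong (λ v → avg d φ w - v) (trans (∑-cong λ t → cong (λ v → 𝟙 (D? d t) * φ v) (CR.distribˡ κ w t)) (avg-scale (K-unit k) φ (κ · w))))) }
      -- Reindexing by `κ` turns the second sum into the first one with κ z in place of z. By
      -- `orbit-AFun` the sum is constant on blocks, and κ z ~ z by `regular-~`.
      ; orbit-zero = λ { {f} {x} {z} (φ , hφ , eq) rx rz →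
          trans (∑-cong λ μ → trans (cong (𝟙K μ *_) (eq (z ∔ μ · x))) (solveℤ 3 (λ i u v → i ⟨*⟩ (u ⟨-⟩ v) ⟨=⟩ i ⟨*⟩ u ⟨-⟩ i ⟨*⟩ v) refl _ _ _))
            (trans (∑-− _ _) (trans (cong (λ v → ∑ (λ μ → 𝟙K μ * φ (z ∔ μ · x)) - v) (trans (trans
                (∑-cong λ μ → cong (λ v → 𝟙K μ * φ v) (solve 4 (λ κ z μ x → κ :* (z :+ μ :* x) := κ :* z :+ κ :* μ :* x) refl κ z μ x))
                (K-scale-sum k (λ μ → φ (κ · z ∔ μ · x)))) (orbit-AFun rx hφ (regular-~ rz k))))
              (ℤR.-‿inverseʳ _))) } }

  abstract
    K-~ : ∀ {κ} → K κ → ∀ x → κ · x ~ x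
    K-~ {κ} k x = 𝟙≢0 (κ · x ~? x) λ eq → case trans (sym zero-at) (trans (cong₂ _-_ (𝟙-yes (x ~? x) refl) eq) one) of λ ()
      where
      zero-at : 𝟙 (x ~? x) - 𝟙 (κ · x ~? x) ≡ 0ℤ
      zero-at = family-zero (difference-family k) ((λ y → 𝟙 (y ~? x)) , block-AFun x , λ _ → refl) x
      one : 1ℤ - 0ℤ ≡ 1ℤ
      one = solveℤ 0 (conℤ 1ℤ ⟨-⟩ conℤ 0ℤ ⟨=⟩ conℤ 1ℤ) refl

  private
    Orthogonal : (R → ℤ) → Set
    Orthogonal f = (∀ {κ} → K κ → ∀ w → f (κ · w) ≡ f w) × (∀ φ → AFun φ → ∑ (λ w → f w * φ w) ≡ 0ℤ)

    𝟙K-sum≢0 : ∑ 𝟙K ≢ 0ℤ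
    𝟙K-sum≢0 = ∑≥1 𝟙K (λ κ → 𝟙-nonneg (κ ~? π 1)) (π 1) (𝟙-yes (π 1 ~? π 1) refl)

    -- Averaging over a subgroup is self-adjoint because the subgroup is closed under negation.
    orthogonal-avg : ∀ {d} f φ → d ∣ n → ∑ (λ w → avg d f w * φ w) ≡ ∑ (λ w → f w * avg d φ w)
    orthogonal-avg {d} f φ d∣n = begin
      ∑ (λ w → ∑ (λ t → 𝟙 (D? d t) * f (w ∔ t)) * φ w)              ≡⟨ ∑-cong (λ w → ∑-*ʳ _ _) ⟩
      ∑ (λ w → ∑ (λ t → 𝟙 (D? d t) * f (w ∔ t) * φ w))              ≡⟨ ∑-comm _ ⟩
      ∑ (λ t → ∑ (λ w → 𝟙 (D? d t) * f (w ∔ t) * φ w))              ≡⟨ ∑-bij ⊝_ ⊝_ -‿involutive -‿involutive _ ⟩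
      ∑ (λ t → ∑ (λ w → 𝟙 (D? d (⊝ t)) * f (w ⊟ t) * φ w))          ≡⟨ ∑-cong (λ t → trans (∑-shift t _) (∑-cong λ w →
          trans (cong₂ (λ i v → i * f v * φ (w ∔ t)) (𝟙-⇔ (D? d (⊝ t)) (D? d t) (λ h → subst (D d) (-‿involutive t) (D-⊝ h)) D-⊝) (⊟-∔ w t))
            (solveℤ 3 (λ i u v → i ⟨*⟩ u ⟨*⟩ v ⟨=⟩ u ⟨*⟩ (i ⟨*⟩ v)) refl _ _ _))) ⟩
      ∑ (λ t → ∑ (λ w → f w * (𝟙 (D? d t) * φ (w ∔ t))))            ≡⟨ ∑-comm _ ⟩
      ∑ (λ w → ∑ (λ t → f w * (𝟙 (D? d t) * φ (w ∔ t))))            ≡⟨ ∑-cong (λ w → ∑-*ˡ _ _) ⟨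
      ∑ (λ w → f w * avg d φ w)                                      ∎
      where open ≡-Reasoning

    -- By invariance of `f`, the sum times the order of `K` is the sum of f(κ z + μ x) over all κ
    -- and μ in `K`. This is the pairing of `f` with the convolution of two orbit counts, an element
    -- of the S-ring.
    orthogonal-orbit : ∀ {f x z} → Orthogonal f → Regular x → Regular z → ∑ (λ μ → 𝟙K μ * f (z ∔ μ · x)) ≡ 0ℤ
    orthogonal-orbit {f} {x} {z} (inv , orth) rx rz = ℤ-cancel (∑ 𝟙K) _ 𝟙K-sum≢0 (begin
      ∑ 𝟙K * ∑ (λ μ → 𝟙K μ * f (z ∔ μ · x))                       ≡⟨ ∑-*ʳ _ _ ⟩
      ∑ (λ κ → 𝟙K κ * ∑ (λ μ → 𝟙K μ * f (z ∔ μ · x)))            ≡⟨ ∑-cong (λ κ → 𝟙-guard (κ ~? π 1) (λ k → trans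
          (∑-cong λ μ → cong (𝟙K μ *_) (trans (sym (inv k (z ∔ μ · x))) (cong f (solve 4 (λ κ z μ x → κ :* (z :+ μ :* x) := κ :* z :+ κ :* μ :* x) refl κ z μ x))))
          (K-scale-sum k (λ μ → f (κ · z ∔ μ · x))))) ⟩
      ∑ (λ κ → 𝟙K κ * ∑ (λ μ → 𝟙K μ * f (κ · z ∔ μ · x)))        ≡⟨ ∑-cong (λ κ → cong (𝟙K κ *_) (trans (sym (orbitCount-sum x f (κ · z)))
          (trans (∑-shift (⊝ (κ · z)) _) (∑-cong λ w → cong (λ v → orbitCount x (w ⊟ κ · z) * f v) (solve 2 (λ w v → v :+ (w :- v) := w) refl w (κ · z)))))) ⟩
      ∑ (λ κ → 𝟙K κ * ∑ (λ w → orbitCount x (w ⊟ κ · z) * f w))   ≡⟨ ∑-cong (λ κ → trans (∑-*ˡ _ _) (∑-cong λ w →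
          solveℤ 3 (λ i o f → i ⟨*⟩ (o ⟨*⟩ f) ⟨=⟩ f ⟨*⟩ (i ⟨*⟩ o)) refl _ _ _)) ⟩
      ∑ (λ κ → ∑ (λ w → f w * (𝟙K κ * orbitCount x (w ⊟ κ · z))))  ≡⟨ ∑-comm _ ⟩
      ∑ (λ w → ∑ (λ κ → f w * (𝟙K κ * orbitCount x (w ⊟ κ · z))))  ≡⟨ ∑-cong (λ w → trans (sym (∑-*ˡ _ _)) (cong (f w *_) (∑-cong λ κ →
          cong (λ v → 𝟙K κ * orbitCount x v) (solve 2 (λ w v → w :- v := :- (:- w :+ v)) refl w (κ · z))))) ⟩
      ∑ (λ w → f w * ψ w)                                           ≡⟨ orth ψ ψ-AFun ⟩
      0ℤ                                                            ∎)
      where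
      open ≡-Reasoning
      -- The number of (κ, μ) in `K` × `K` with w = κ z + μ x; the double negation brings it into
      -- the form treated by `orbit-AFun`.
      ψ : R → ℤ
      ψ w = ∑ (λ κ → 𝟙K κ * orbitCount x (⊝ (⊝ w ∔ κ · z)))
      ψ-AFun : AFun ψ
      ψ-AFun w~w′ = orbit-AFun {φ = orbitCount x ∘ ⊝_} rz (orbitCount-AFun rx ∘ ~-⊝) (~-⊝ w~w′)

    orthogonal-family : IsFamily Orthogonal
    orthogonal-family = record
      { restrict-closed = λ { {d} {f} d∣n (inv , orth) →
          (λ {κ} k w → cong₂ _*_ (𝟙-⇔ (D? d (κ · w)) (D? d w) (D-unit (K-unit k)) (D-·ˡ κ)) (inv k w)) ,
          λ φ hφ → trans (∑-cong λ w → solveℤ 3 (λ i f φ → i ⟨*⟩ f ⟨*⟩ φ ⟨=⟩ f ⟨*⟩ (i ⟨*⟩ φ)) refl (𝟙 (D? d w)) (f w) (φ w))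
            (orth (restrict d φ) (restrict-AFun d∣n hφ)) }
      ; avg-closed = λ { {d} {f} d∣n (inv , orth) →
          (λ {κ} k w → trans (sym (avg-scale (K-unit k) f (κ · w))) (∑-cong λ t → cong (𝟙 (D? d t) *_)
            (trans (cong f (sym (CR.distribˡ κ w t))) (inv k (w ∔ t))))) ,
          λ φ hφ → trans (orthogonal-avg f φ d∣n) (orth (avg d φ) (avg-AFun d∣n hφ)) }
      ; orbit-zero = orthogonal-orbit }

    orbitCount-invariant : ∀ x {κ} → K κ → ∀ w → orbitCount x (κ · w) ≡ orbitCount x w
    orbitCount-invariant x {κ} k w = trans (sym (K-scale-sum k (λ μ → 𝟙 (κ · w ≟F μ · x)))) (∑-cong λ μ → cong (𝟙K μ *_)
      (𝟙-⇔ (κ · w ≟F κ · μ · x) (w ≟F μ · x) (λ eq → unit-cancel (K-unit k) (trans eq (CR.*-assoc κ μ x)))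
        (λ eq → trans (cong (κ ·_) eq) (sym (CR.*-assoc κ μ x)))))

    orbitCount-pairing : ∀ x φ → AFun φ → ∑ (λ w → orbitCount x w * φ w) ≡ ∑ 𝟙K * φ x
    orbitCount-pairing x φ hφ = trans (∑-cong λ w → cong (λ v → orbitCount x w * φ v) (sym (CR.+-identityˡ w)))
      (trans (orbitCount-sum x φ (π 0)) (trans (∑-cong λ κ → 𝟙-guard (κ ~? π 1) (λ k → trans (cong φ (CR.+-identityˡ _)) (hφ (K-~ k x)))) (sym (∑-*ʳ _ _))))

    -- By `K-~` an `AFun` is constant on `K`-orbits, so it pairs with the two orbit counts to the
    -- order of `K` times its values at `x` and `y`, which agree.
    orbit-difference : ∀ {x y} → x ~ y → Orthogonal (λ w → orbitCount x w - orbitCount y w)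
    orbit-difference {x} {y} x~y = (λ k w → cong₂ _-_ (orbitCount-invariant x k w) (orbitCount-invariant y k w)) ,
      λ φ hφ → trans (∑-cong λ w → solveℤ 3 (λ u v p → (u ⟨-⟩ v) ⟨*⟩ p ⟨=⟩ u ⟨*⟩ p ⟨-⟩ v ⟨*⟩ p) refl (orbitCount x w) (orbitCount y w) (φ w))
        (trans (∑-− _ _) (trans (cong₂ _-_ (orbitCount-pairing x φ hφ) (trans (orbitCount-pairing y φ hφ) (cong (∑ 𝟙K *_) (hφ (sym x~y))))) (ℤR.-‿inverseʳ _)))

  abstract
    -- By `family-zero` the orbit counts of `x` and `y` coincide, and that of `y` is positive at
    -- `y`.
    ~-orbit : ∀ {x y} → x ~ y → ∃[ κ ] (K κ × κ · x ≡ y)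
    ~-orbit {x} {y} x~y = case ∑≢0 _ nonzero of λ { (κ , nz) → case 𝟙*≢0 (κ ~? π 1) nz of λ { (k , nz′) → κ , k , sym (𝟙≢0 (y ≟F κ · x) nz′) } }
      where
      nonzero : orbitCount x y ≢ 0ℤ
      nonzero eq = ∑≥1 _ (λ κ → subst (0ℤ ℤ.≤_) (sym (𝟙-× (κ ~? π 1) (y ≟F κ · y))) (𝟙-nonneg (κ ~? π 1 ×-dec y ≟F κ · y))) (π 1)
        (trans (cong₂ _*_ (𝟙-yes (π 1 ~? π 1) refl) (𝟙-yes (y ≟F π 1 · y) (sym (CR.*-identityˡ y)))) (ℤR.*-identityˡ 1ℤ))
        (trans (solveℤ 2 (λ u v → u ⟨=⟩ u ⟨-⟩ v ⟨+⟩ v) refl (orbitCount y y) (orbitCount x y))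
          (trans (cong₂ _+_ (family-zero orthogonal-family (orbit-difference (sym x~y)) y) eq) (ℤR.+-identityˡ 0ℤ)))

  cyclotomic : Cyclotomic A
  cyclotomic = Multiplier , (automorphism , (π 1 , K-1 , λ x → sym (CR.*-identityˡ x)) , composition , inverse) ,
    λ x y → (λ x~y → case ~-orbit x~y of λ { (κ , k , eq) → (κ ·_) , (κ , k , λ _ → refl) , eq }) ,
            λ { (σ , (κ , k , eq) , σx≡y) → trans (sym (K-~ k x)) (cong lab (trans (sym (eq x)) σx≡y)) }
    where
    -- Agreement with a multiplication is pointwise, so that the identity and composites belong to
    -- it without function extensionality.
    Multiplier : (R → R) → Set
    Multiplier σ = ∃[ κ ] (K κ × (∀ x → σ x ≡ κ · x))
    composition : ∀ σ τ → Multiplier σ → Multiplier τ → Multiplier (λ x → σ (τ x))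
    composition σ τ (κ , k , eq) (μ , l , eq′) = κ · μ , K-· k l , λ x → trans (eq (τ x)) (trans (cong (κ ·_) (eq′ x)) (sym (CR.*-assoc κ μ x)))
    cancel : ∀ {κ} (k : K κ) x → proj₁ (K-unit k) · (κ · x) ≡ x
    cancel {κ} k x = trans (solve 3 (λ u κ x → u :* (κ :* x) := κ :* u :* x) refl (proj₁ (K-unit k)) κ x) (trans (cong (_· x) (proj₂ (K-unit k))) (CR.*-identityˡ x))
    inverse : ∀ σ → Multiplier σ → ∃[ τ ] (Multiplier τ × (∀ x → τ (σ x) ≡ x))
    inverse σ (κ , k , eq) = (proj₁ (K-unit k) ·_) , (proj₁ (K-unit k) , K-inverse k , λ _ → refl) ,
      λ x → trans (cong (proj₁ (K-unit k) ·_) (eq x)) (cancel k x)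
    automorphism : ∀ σ → Multiplier σ → IsAut A σ
    automorphism σ (κ , k , eq) =
      (λ x y → trans (eq (x ⊕ y)) (trans (cong (κ ·_) (∔-def x y)) (trans (CR.distribˡ κ x y) (trans (cong₂ _∔_ (sym (eq x)) (sym (eq y))) (sym (∔-def (σ x) (σ y))))))) ,
      (λ {x} {y} h → unit-cancel (K-unit k) (trans (sym (eq x)) (trans h (eq y)))) ,
      λ y → proj₁ (K-unit k) · y , λ { refl → trans (eq _) (trans (sym (CR.*-assoc _ _ y)) (trans (cong (_· y) (proj₂ (K-unit k))) (CR.*-identityˡ y))) }

theorem3p1 : (m : ℕ) (A : SRing m) → Quasidense A → TrivialRadical A →
    Cyclotomic A × Dense A
theorem3p1 m A qd tr = BlocksAreOrbits.cyclotomic A qd tr , Density.dense A qd tr
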